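{- Let $q$ be a positive power of a prime and $K=\mathbb{F}_q(Y)$, $\widehat K=\mathbb{F}_q((Y^{ -1}))$. For every positive integer $\ell$ there exists $\alpha\in K^{(2)}$ whose quadratic Lagrange spectrum $\mathrm{Sp}(\alpha)$ has exactly $\ell$ gaps.
   Context: $R=\mathbb{F}_q[Y]$. $\widehat K$ carries the absolute value extending $|P/Q|=q^{\deg P-\deg Q}$ for nonzero $P,Q\in R$. $K^{(2)}=\{f\in\widehat K: [K(f):K]=2\}$. For $\alpha\in K^{(2)}$, $\alpha^\sigma$ is its Galois conjugate over $K$. $\mathrm{PGL}_2(R)$ acts on $\widehat K\cup\{\infty\}$ by homographies, $\Theta_\alpha=\mathrm{PGL}_2(R)\cdot\{\alpha,\alpha^\sigma\}$. For $f\in\widehat K\setminus(K\cup\Theta_\alpha)$, $c_\alpha(f)=\liminf_{\beta\in\Theta_\alpha,\ |\beta-\beta^\sigma|\to0}\frac{|f-\beta|}{|\beta-\beta^\sigma|}$, and $\mathrm{Sp}(\alpha)=\{c_\alpha(f): f\in\widehat K\setminus(K\cup\Theta_\alpha)\}$. One knows $\mathrm{Sp}(\alpha)\subset\{0\}\cup\{q^{ -n}:n\in\mathbb{Z},n\ge2\}$, that $\mathrm{Sp}(\alpha)$ has a maximum $q^{ -n_0}$, and that $q^{ -n}\in\mathrm{Sp}(\alpha)$ for all sufficiently large $n$ (Hall's ray). A gap of $\mathrm{Sp}(\alpha)$ is a maximal nonempty set of consecutive integers $n\ge n_0$ such that $q^{ -n}\notin\mathrm{Sp}(\alpha)$. 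-}

module Defs where

open import Level using (0ℓ)
open import Algebra.Bundles using (CommutativeRing)
open import Data.Nat as ℕ using (ℕ; zero; suc)
open import Data.Integer as ℤ using (ℤ; +_; -[1+_])
open import Data.Fin using (Fin; toℕ)
open import Data.List using (List; []; _∷_)
open import Data.Bool using (Bool; true; false)
open import Data.Product using (Σ; ∃; _×_; _,_)
open import Relation.Nullary using (¬_)
open import Relation.Binary.PropositionalEquality using (_≡_)
open import Function.Bundles using (_⇔_)

-- A finite field F_q (q = card, automatically a positive prime power).

record FiniteField : Set₁ where
  field
    ring : CommutativeRing 0ℓ 0ℓ
  open CommutativeRing ring
  field
    1≉0       : ¬ (1# ≈ 0#)
    inverse   : ∀ x → ¬ (x ≈ 0#) → ∃ λ y → x * y ≈ 1#
    card      : ℕ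
    enum      : Fin card → Carrier
    enum-inj  : ∀ i j → enum i ≈ enum j → i ≡ j
    enum-surj : ∀ x → ∃ λ i → enum i ≈ x

module Laurent (F : FiniteField) where
  open FiniteField F
  open CommutativeRing ring renaming (_+_ to _+F_; _*_ to _*F_; -_ to -F_)

  -- a series sum_{i ≤ top} coeff i · Y^i (coeff i is the coefficient of Y^i)
  record LS : Set where
    constructor mkLS
    field
      top   : ℤ
      coeff : ℤ → Carrier
  open LS public

  IsLS : LS → Set
  IsLS f = ∀ i → top f ℤ.< i → coeff f i ≈ 0#

  _≈L_ : LS → LS → Set
  f ≈L g = ∀ i → coeff f i ≈ coeff g i

  0L : LS
  0L = mkLS (+ 0) (λ _ → 0#)

  _+L_ : LS → LS → LS
  f +L g = mkLS (top f ℤ.⊔ top g) (λ i → coeff f i +F coeff g i)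

  -L_ : LS → LS
  -L f = mkLS (top f) (λ i → -F coeff f i)

  _-L_ : LS → LS → LS
  f -L g = f +L (-L g)

  clamp : ℤ → ℕ
  clamp (+ n)    = suc n
  clamp -[1+ _ ] = 0

  sumFrom : ℤ → ℕ → (ℤ → Carrier) → Carrier
  sumFrom lo zero    h = 0#
  sumFrom lo (suc n) h = h (lo ℤ.+ + n) +F sumFrom lo n h

  -- Cauchy product: (fg)_k = Σ_{k - top g ≤ i ≤ top f} f_i g_{k-i}
  _*L_ : LS → LS → LS
  f *L g = mkLS (top f ℤ.+ top g)
    (λ k → sumFrom (k ℤ.- top g) (clamp (top f ℤ.+ top g ℤ.- k))
                   (λ i → coeff f i *F coeff g (k ℤ.- i)))

  -- Polynomials R = F_q[Y] as coefficient lists (constant term first)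

  Poly : Set
  Poly = List Carrier

  lookupP : Poly → ℕ → Carrier
  lookupP []       _       = 0#
  lookupP (a ∷ p)  zero    = a
  lookupP (a ∷ p)  (suc n) = lookupP p n

  lenP : Poly → ℕ
  lenP []      = 0
  lenP (_ ∷ p) = suc (lenP p)

  embed : Poly → LS
  embed p = mkLS (+ lenP p) coe
    where
      coe : ℤ → Carrier
      coe (+ n)    = lookupP p n
      coe -[1+ _ ] = 0#

  constP : Carrier → Poly
  constP u = u ∷ []

  NonzeroP : Poly → Set
  NonzeroP p = ¬ (embed p ≈L 0L)

  -- Absolute value |f| = q^{deg f} via comparisons with powers of q

  -- |f| ≤ q^m
  AbsLe : LS → ℤ → Set
  AbsLe f m = ∀ i → m ℤ.< i → coeff f i ≈ 0#

  -- |X| ≤ q^e · |Y|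
  ScaledLe : LS → LS → ℤ → Set
  ScaledLe X Y e = ∀ m → AbsLe Y m → AbsLe X (m ℤ.+ e)

  NotInK : LS → Set
  NotInK f = ∀ (P Q : Poly) → NonzeroP Q → ¬ ((embed Q *L f) ≈L embed P)

  record Quad : Set where
    field
      α       : LS
      ασ      : LS
      α-ok    : IsLS α
      ασ-ok   : IsLS ασ
      α∉K     : NotInK α
      α≉ασ    : ¬ (α ≈L ασ)
      A B C   : Poly
      A≠0     : NonzeroP A
      α-root  : ((embed A *L (α *L α)) +L ((embed B *L α) +L embed C)) ≈L 0L
      ασ-root : ((embed A *L (ασ *L ασ)) +L ((embed B *L ασ) +L embed C)) ≈L 0L

  -- Elements β of Θ_α = PGL₂(R)·{α, α^σ}:  β = (aγ+b)/(cγ+d) with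
  -- (γ,γ') = (α,α^σ) or (α^σ,α), ad - bc ∈ F_q^*; then β^σ = (aγ'+b)/(cγ'+d).

  record OrbitElt : Set where
    field
      a b c d : Poly
      u       : Carrier
      u≠0     : ¬ (u ≈ 0#)
      det     : ((embed a *L embed d) -L (embed b *L embed c)) ≈L embed (constP u)
      swap    : Bool

  module _ (Q : Quad) where
    open Quad Q

    γ γ' : OrbitElt → LS
    γ  o with OrbitElt.swap o
    ... | false = α
    ... | true  = ασ
    γ' o with OrbitElt.swap o
    ... | false = ασ
    ... | true  = α

    num den den' : OrbitElt → LS
    num  o = (embed (OrbitElt.a o) *L γ o) +L embed (OrbitElt.b o)
    den  o = (embed (OrbitElt.c o) *L γ o) +L embed (OrbitElt.d o)
    den' o = (embed (OrbitElt.c o) *L γ' o) +L embed (OrbitElt.d o)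

    IsBeta : LS → OrbitElt → Set
    IsBeta f o = (f *L den o) ≈L num o

    -- |β - β^σ| ≤ q^m   (β - β^σ = det·(γ-γ')/((cγ+d)(cγ'+d)), |det| = 1)
    DistLe : OrbitElt → ℤ → Set
    DistLe o m = ScaledLe (γ o -L γ' o) (den o *L den' o) m

    -- |f-β|/|β-β^σ| = |(f(cγ+d) - (aγ+b))(cγ'+d)| / |γ-γ'|
    errL : LS → OrbitElt → LS
    errL f o = ((f *L den o) -L num o) *L den' o

    -- |f-β|/|β-β^σ| ≤ q^{-n}
    RatioLe : LS → OrbitElt → ℤ → Set
    RatioLe f o n = ScaledLe (errL f o) (γ o -L γ' o) (ℤ.- n)

    -- |f-β|/|β-β^σ| ≥ q^{-n}
    RatioGe : LS → OrbitElt → ℤ → Set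
    RatioGe f o n = ScaledLe (γ o -L γ' o) (errL f o) n

    -- c_α(f) = q^{-n}: the liminf (over β ∈ Θ_α with |β-β^σ| → 0) of the
    -- ratio, whose values lie in q^ℤ, equals q^{-n}.
    CEq : LS → ℤ → Set
    CEq f n =
      (∃ λ m₀ → ∀ o → DistLe o m₀ → RatioGe f o n) ×
      (∀ m → ∃ λ o → DistLe o m × RatioLe f o n)

    -- q^{-n} ∈ Sp(α)
    InSp : ℤ → Set
    InSp n = ∃ λ f → IsLS f × NotInK f × (∀ o → ¬ IsBeta f o) × CEq f n

    -- Sp(α) has maximum q^{-n₀} and exactly ℓ gaps
    HasExactlyGaps : ℕ → Set
    HasExactlyGaps ℓ = ∃ λ (n₀ : ℤ) →
      (InSp n₀ × (∀ n → InSp n → n₀ ℤ.≤ n)) ×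
      Σ (Fin ℓ → ℤ) λ lo → Σ (Fin ℓ → ℤ) λ hi →
        (∀ i → (n₀ ℤ.≤ lo i) × (lo i ℤ.≤ hi i)) ×
        (∀ i j → toℕ j ≡ suc (toℕ i) → hi i ℤ.+ + 1 ℤ.< lo j) ×
        (∀ n → n₀ ℤ.≤ n → ((¬ InSp n) ⇔ (∃ λ i → (lo i ℤ.≤ n) × (n ℤ.≤ hi i))))

{-# OPTIONS --safe #-}
module Submission where

-- In the Bruhat–Tits tree of PGL₂, c_α(f) = q⁻ⁿ where n is the upper limit of the lengths
-- of the overlaps between the path from ∞ to f and the geodesics joining β to β^σ, β ∈ Θ_α.
-- These geodesics are coded by the bi-infinite word of partial quotients of α. Choose α
-- with partial quotients of degree 1, such that all words of ℓ letters of degree 1 occur,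
-- but not ℓ + 1 consecutive letters Y, even up to units. Since an overlap runs alternately
-- through vertices of level 0 and 1, one of odd length 2k + 1 contains k + 1 vertices of
-- level 0, hence spells k letters of degree 1; if k ≤ ℓ, another geodesic of the orbit
-- spells them as well and overlaps in length 2k + 2. So 3, 5, …, 2ℓ + 1 are missing. The
-- other values n ≥ 2 are attained by continued fractions made of blocks of degree 1
-- separated by Y²: blocks of k consecutive partial quotients of α give 2k + 2, and such
-- blocks ending with Y^ℓ and followed by one more Y give 2k + 3, for k ≥ ℓ.

open import Defs
open import Level using (0ℓ)
open import Algebra.Bundles using (CommutativeRing)
open import Algebra.Structures using (IsCommutativeRing)
import Algebra.Properties.AbelianGroup
import Algebra.Properties.CommutativeSemigroup
import Algebra.Properties.Ring
import Algebra.Properties.Semiring.Mult.TCOptimised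
import Algebra.Solver.Ring
import Algebra.Solver.Ring.AlmostCommutativeRing as ACR
open import Data.Bool using (true; false)
open import Data.Empty using (⊥-elim)
open import Data.Fin as Fin using (Fin; zero; suc; toℕ)
import Data.Fin.Properties as Finₚ
open import Data.Integer as ℤ using (ℤ; +_; -[1+_]; _⊖_; -1ℤ)
import Data.Integer.Properties as ℤₚ
open import Data.Integer.Tactic.RingSolver using () renaming (solve-∀ to ring-ℤ)
open import Data.List using (List; []; _∷_; length; replicate)
import Data.List.Properties as Listₚ
open import Data.Maybe using (Maybe; just; nothing)
open import Data.Nat as ℕ using (ℕ; zero; suc; _≥_)
open import Data.Nat.Divisibility using (divides)
import Data.Nat.DivMod as ℕᵈ
import Data.Nat.Properties as ℕₚ
open import Data.Nat.Tactic.RingSolver using () renaming (solve-∀ to ring-ℕ)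
open import Data.Product using (Σ; ∃; ∃₂; _×_; _,_; proj₁; proj₂)
import Data.Sign as Sign
open import Data.Sum using (_⊎_; inj₁; inj₂)
open import Data.Unit using (⊤; tt)
open import Function using (_∘_)
open import Function.Bundles using (mk⇔)
import Relation.Binary.PropositionalEquality as ≡
open ≡ using (_≡_)
import Relation.Binary.Reasoning.Setoid
open import Relation.Nullary using (¬_; Dec; yes; no)
open import Relation.Nullary.Decidable using (decidable-stable)

-- The matrices fixing a vertex of level 0 form the finite group PGL₂(F_q), which permutes its q + 1
-- edges. So an odd overlap does not hand over its k letters unchanged: the first and the last are
-- first altered by constants, chosen such that the edges entering and leaving the stretch agree as
-- well. The altered word still consists of k polynomials of degree 1. An upper limit is at stake,
-- so the second geodesic must not only overlap in length 2k + 2: its ends β, β^σ must also be close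
-- to each other. This fails if it follows the path from ∞ long before the word begins. Therefore
-- every word is asked for twice, behind two different pasts; one of the two geodesics leaves the
-- path soon, and the loss is bounded by the constant 4. The letters Y and Y + 1 exist over every
-- F_q, F_2 included, and are not proportional; this makes Y + 1 a separator that cuts all runs of
-- Y. The vanishing of a series cannot be decided, so its degree exists only up to double negation.
-- This is harmless because what is deduced from a degree found in this way is a contradiction or a
-- stable bound.

module ℤᵍ = Algebra.Properties.AbelianGroup ℤₚ.+-0-abelianGroup

-- Integer coefficients let the solver cancel x - x although equality in R is not decidable.
module IntegerCoefficients (R : CommutativeRing 0ℓ 0ℓ) where
  open CommutativeRing R
  open Algebra.Properties.Semiring.Mult.TCOptimised semiring
    using (×-homo-+; ×1-homo-*; 1+×) renaming (_×_ to _·_)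
  open Algebra.Properties.Ring ring
    using (-0#≈0#; -‿distribˡ-*; -‿distribʳ-*; -‿involutive)
  open Algebra.Properties.AbelianGroup +-abelianGroup using (⁻¹-∙-comm)
  open Relation.Binary.Reasoning.Setoid setoid

  ⟦_⟧ : ℤ → Carrier
  ⟦ + n ⟧      = n · 1#
  ⟦ -[1+ n ] ⟧ = - (suc n · 1#)

  ⊖-homo : ∀ m n → ⟦ m ⊖ n ⟧ ≈ m · 1# + - (n · 1#)
  ⊖-homo zero zero       = sym (-‿inverseʳ 0#)
  ⊖-homo zero (suc n)    = sym (+-identityˡ _)
  ⊖-homo (suc m) zero    = sym (trans (+-congˡ -0#≈0#) (+-identityʳ _))
  ⊖-homo (suc m) (suc n) = begin
    ⟦ suc m ⊖ suc n ⟧                         ≡⟨ ≡.cong ⟦_⟧ (ℤₚ.[1+m]⊖[1+n]≡m⊖n m n) ⟩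
    ⟦ m ⊖ n ⟧                                 ≈⟨ ⊖-homo m n ⟩
    a + - b                                   ≈⟨ +-congʳ (+-identityˡ a) ⟨
    0# + a + - b                              ≈⟨ +-congʳ (+-congʳ (-‿inverseʳ 1#)) ⟨
    1# + - 1# + a + - b                       ≈⟨ +-congʳ (trans (+-assoc _ _ _) (+-congˡ (+-comm _ _))) ⟩
    1# + (a + - 1#) + - b                     ≈⟨ +-congʳ (+-assoc _ _ _) ⟨
    1# + a + - 1# + - b                       ≈⟨ +-assoc _ _ _ ⟩
    1# + a + (- 1# + - b)                     ≈⟨ +-congˡ (⁻¹-∙-comm 1# b) ⟩
    1# + a + - (1# + b)                       ≈⟨ +-cong (1+× m 1#) (-‿cong (1+× n 1#)) ⟨
    suc m · 1# + - (suc n · 1#)               ∎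
    where
    a = m · 1#
    b = n · 1#

  +-homo : ∀ i j → ⟦ i ℤ.+ j ⟧ ≈ ⟦ i ⟧ + ⟦ j ⟧
  +-homo (+ m) (+ n)           = ×-homo-+ 1# m n
  +-homo (+ m) -[1+ n ]        = ⊖-homo m (suc n)
  +-homo -[1+ m ] (+ n)        = trans (⊖-homo n (suc m)) (+-comm _ _)
  +-homo -[1+ m ] -[1+ n ]     = begin
    - (suc (suc (m ℕ.+ n)) · 1#)        ≡⟨ ≡.cong (λ k → - (suc k · 1#)) (≡.sym (ℕₚ.+-suc m n)) ⟩
    - ((suc m ℕ.+ suc n) · 1#)          ≈⟨ -‿cong (×-homo-+ 1# (suc m) (suc n)) ⟩
    - (suc m · 1# + suc n · 1#)         ≈⟨ ⁻¹-∙-comm _ _ ⟨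
    - (suc m · 1#) + - (suc n · 1#)     ∎

  neg-homo : ∀ i → ⟦ ℤ.- i ⟧ ≈ - ⟦ i ⟧
  neg-homo (+ zero)  = sym -0#≈0#
  neg-homo (+ suc n) = refl
  neg-homo -[1+ n ]  = sym (-‿involutive _)

  -◃-homo : ∀ n → ⟦ Sign.- ℤ.◃ n ⟧ ≈ - (n · 1#)
  -◃-homo zero    = sym -0#≈0#
  -◃-homo (suc n) = refl

  +◃-homo : ∀ n → ⟦ Sign.+ ℤ.◃ n ⟧ ≈ n · 1#
  +◃-homo zero    = refl
  +◃-homo (suc n) = refl

  *-homo : ∀ i j → ⟦ i ℤ.* j ⟧ ≈ ⟦ i ⟧ * ⟦ j ⟧
  *-homo (+ m) (+ n)       = trans (+◃-homo (m ℕ.* n)) (×1-homo-* m n)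
  *-homo (+ m) -[1+ n ]    = trans (-◃-homo (m ℕ.* suc n))
    (trans (-‿cong (×1-homo-* m (suc n))) (-‿distribʳ-* _ _))
  *-homo -[1+ m ] (+ n)    = trans (-◃-homo (suc m ℕ.* n))
    (trans (-‿cong (×1-homo-* (suc m) n)) (-‿distribˡ-* _ _))
  *-homo -[1+ m ] -[1+ n ] = trans (+◃-homo (suc m ℕ.* suc n)) (begin
    (suc m ℕ.* suc n) · 1#                ≈⟨ ×1-homo-* (suc m) (suc n) ⟩
    x * y                                 ≈⟨ -‿involutive _ ⟨
    - - (x * y)                           ≈⟨ -‿cong (-‿distribˡ-* _ _) ⟩
    - (- x * y)                           ≈⟨ -‿distribʳ-* _ _ ⟩
    - x * - y                             ∎)
    where
    x = suc m · 1#
    y = suc n · 1#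

  ≈-weakly-decidable : ∀ i j → Maybe (⟦ i ⟧ ≈ ⟦ j ⟧)
  ≈-weakly-decidable i j with i ℤ.≟ j
  ... | yes ≡.refl = just refl
  ... | no _       = nothing

  homomorphism : CommutativeRing.rawRing ℤₚ.+-*-commutativeRing ACR.-Raw-AlmostCommutative⟶ ACR.fromCommutativeRing R
  homomorphism = record
    { ⟦_⟧ = ⟦_⟧ ; +-homo = +-homo ; *-homo = *-homo ; -‿homo = neg-homo ; 0-homo = refl ; 1-homo = refl }

  open Algebra.Solver.Ring (CommutativeRing.rawRing ℤₚ.+-*-commutativeRing) (ACR.fromCommutativeRing R)
    homomorphism ≈-weakly-decidable
    public using (solve; _:=_; _:+_; _:*_; _:-_; :-_; con)

-- Linear inequalities between integers

module IntegerOrder where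
  open import Data.Integer using (_+_; _-_; _≤_; _<_; _≤?_; ∣_∣; +<+)

  ≤-by : ∀ {i j} (d : ℕ) → j ≡ i + + d → i ≤ j
  ≤-by {i} d ≡.refl = ℤₚ.i≤i+j i (+ d)

  <-by : ∀ {i j} (d : ℕ) → j ≡ i + + suc d → i < j
  <-by {i} d ≡.refl = ℤₚ.<-≤-trans
    (ℤₚ.≤-<-trans (ℤₚ.≤-reflexive (≡.sym (ℤₚ.+-identityʳ i))) (ℤₚ.+-monoʳ-< i (+<+ (ℕ.s≤s ℕ.z≤n))))
    ℤₚ.≤-refl

  ≤⇒+ : ∀ {i j} → i ≤ j → ∃ λ d → j ≡ i + + d
  ≤⇒+ {i} {j} i≤j = ∣ j - i ∣ , (begin
    j                   ≡⟨ cancel i j ⟩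
    i + (j - i)         ≡⟨ ≡.cong (λ z → i + z) (ℤₚ.0≤i⇒+∣i∣≡i (ℤₚ.i≤j⇒0≤j-i i≤j)) ⟨
    i + + ∣ j - i ∣     ∎)
    where
    open ≡.≡-Reasoning
    cancel : ∀ i j → j ≡ i + (j - i)
    cancel = ring-ℤ

  <⇒+ : ∀ {i j} → i < j → ∃ λ d → j ≡ i + + suc d
  <⇒+ {i} {j} i<j with ≤⇒+ (ℤₚ.i<j⇒suc[i]≤j i<j)
  ... | d , eq = d , ≡.trans eq (shift i (+ d))
    where
    shift : ∀ i d → + 1 + i + d ≡ i + (+ 1 + d)
    shift = ring-ℤ

  ≤-or-> : ∀ i j → (∃ λ d → j ≡ i + + d) ⊎ (∃ λ d → i ≡ j + + suc d)
  ≤-or-> i j with i ≤? j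
  ... | yes i≤j = inj₁ (≤⇒+ i≤j)
  ... | no i≰j  = inj₂ (<⇒+ (ℤₚ.≰⇒> i≰j))

  common-upper : ∀ i j → ∃₂ λ d e → i + + d ≡ j + + e
  common-upper i j with ≤-or-> i j
  ... | inj₁ (d , eq) = d , 0 , ≡.trans (≡.sym eq) (≡.sym (ℤₚ.+-identityʳ j))
  ... | inj₂ (d , eq) = 0 , suc d , ≡.trans (ℤₚ.+-identityʳ i) eq

  1≰0 : ¬ + 1 ≤ + 0
  1≰0 (ℤ.+≤+ ())

  i≤∣i∣ : ∀ i → i ≤ + ∣ i ∣
  i≤∣i∣ (+ n)    = ℤₚ.≤-refl
  i≤∣i∣ -[1+ n ] = ℤ.-≤+

  transpose : ∀ {i j k} → j ≡ i + k → i ≡ j - k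
  transpose {i} {_} {k} ≡.refl = lem i k
    where
    lem : ∀ i k → i ≡ i + k - k
    lem = ring-ℤ

  -- A certificate for linear arithmetic: the goal is the hypothesis plus a natural number `d`, so
  -- that only an identity remains for the ring solver.
  lin₁ : ∀ {a b i j} (d : ℕ) → a ≤ b → j + a ≡ i + b + + d → i ≤ j
  lin₁ {a} {b} {i} {j} d a≤b eq with ≤⇒+ a≤b
  ... | e , ≡.refl = ≤-by (d ℕ.+ e) (≡.trans (lem₁ j a) (≡.trans (≡.cong (λ z → z - a) eq) (lem₂ i a (+ d) (+ e))))
    where
    lem₁ : ∀ j a → j ≡ j + a - a
    lem₁ = ring-ℤ
    lem₂ : ∀ i a d e → i + (a + e) + d - a ≡ i + (d + e)
    lem₂ = ring-ℤ

  lin₂ : ∀ {a b a′ b′ i j} (d : ℕ) → a ≤ b → a′ ≤ b′ → j + (a + a′) ≡ i + (b + b′) + + d → i ≤ j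
  lin₂ d p q eq = lin₁ d (ℤₚ.+-mono-≤ p q) eq

open IntegerOrder

-- Cauchy products of sequences

module Convolution (R : CommutativeRing 0ℓ 0ℓ) where
  open CommutativeRing R
  open Relation.Binary.Reasoning.Setoid setoid
  open Algebra.Properties.CommutativeSemigroup (CommutativeRing.+-commutativeSemigroup R)
    using (interchange; x∙yz≈y∙xz)

  conv : (ℕ → Carrier) → (ℕ → Carrier) → ℕ → Carrier
  conv f g zero    = f 0 * g 0
  conv f g (suc n) = f 0 * g (suc n) + conv (f ∘ suc) g n

  conv-cong : ∀ {f f′ g g′} → (∀ i → f i ≈ f′ i) → (∀ i → g i ≈ g′ i) →
              ∀ n → conv f g n ≈ conv f′ g′ n
  conv-cong p q zero    = *-cong (p 0) (q 0)
  conv-cong p q (suc n) = +-cong (*-cong (p 0) (q (suc n))) (conv-cong (p ∘ suc) q n)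

  conv-sucʳ : ∀ f g n → conv f g (suc n) ≈ f (suc n) * g 0 + conv f (g ∘ suc) n
  conv-sucʳ f g zero    = +-comm _ _
  conv-sucʳ f g (suc n) = trans (+-congˡ (conv-sucʳ (f ∘ suc) g n)) (x∙yz≈y∙xz _ _ _)

  conv-comm : ∀ f g n → conv f g n ≈ conv g f n
  conv-comm f g zero    = *-comm _ _
  conv-comm f g (suc n) =
    trans (+-cong (*-comm _ _) (conv-comm (f ∘ suc) g n)) (sym (conv-sucʳ g f n))

  conv-distribʳ : ∀ f f′ g n → conv (λ i → f i + f′ i) g n ≈ conv f g n + conv f′ g n
  conv-distribʳ f f′ g zero    = distribʳ _ _ _
  conv-distribʳ f f′ g (suc n) =
    trans (+-cong (distribʳ _ _ _) (conv-distribʳ (f ∘ suc) (f′ ∘ suc) g n)) (interchange _ _ _ _)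

  conv-scale : ∀ c f g n → conv (λ i → c * f i) g n ≈ c * conv f g n
  conv-scale c f g zero    = *-assoc _ _ _
  conv-scale c f g (suc n) =
    trans (+-cong (*-assoc _ _ _) (conv-scale c (f ∘ suc) g n)) (sym (distribˡ _ _ _))

  conv-assoc : ∀ f g h n → conv (conv f g) h n ≈ conv f (conv g h) n
  conv-assoc f g h zero    = *-assoc _ _ _
  conv-assoc f g h (suc n) = begin
    f 0 * g 0 * h (suc n) + conv (λ i → f 0 * g (suc i) + conv (f ∘ suc) g i) h n
      ≈⟨ +-cong (*-assoc _ _ _) (conv-distribʳ _ _ h n) ⟩
    f 0 * (g 0 * h (suc n)) + (conv (λ i → f 0 * g (suc i)) h n + conv (conv (f ∘ suc) g) h n)
      ≈⟨ +-congˡ (+-cong (conv-scale _ _ h n) (conv-assoc (f ∘ suc) g h n)) ⟩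
    f 0 * (g 0 * h (suc n)) + (f 0 * conv (g ∘ suc) h n + conv (f ∘ suc) (conv g h) n)
      ≈⟨ +-assoc _ _ _ ⟨
    f 0 * (g 0 * h (suc n)) + f 0 * conv (g ∘ suc) h n + conv (f ∘ suc) (conv g h) n
      ≈⟨ +-congʳ (distribˡ _ _ _) ⟨
    f 0 * conv g h (suc n) + conv (f ∘ suc) (conv g h) n ∎

  conv-zero : ∀ f g n → (∀ i j → i ℕ.+ j ≡ n → f i * g j ≈ 0#) → conv f g n ≈ 0#
  conv-zero f g zero    p = p 0 0 ≡.refl
  conv-zero f g (suc n) p = trans
    (+-cong (p 0 (suc n) ≡.refl) (conv-zero (f ∘ suc) g n (λ i j eq → p (suc i) j (≡.cong suc eq))))
    (+-identityˡ 0#)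

  conv-identityˡ : ∀ f g n → f 0 ≈ 1# → (∀ i → f (suc i) ≈ 0#) → conv f g n ≈ g n
  conv-identityˡ f g zero    p q = trans (*-congʳ p) (*-identityˡ _)
  conv-identityˡ f g (suc n) p q = trans
    (+-cong (trans (*-congʳ p) (*-identityˡ _))
            (conv-zero (f ∘ suc) g n (λ i j _ → trans (*-congʳ (q i)) (zeroˡ _))))
    (+-identityʳ _)

-- The commutative ring of Laurent series in 1/Y

module LaurentRing (F : FiniteField) where
  open FiniteField F
  open CommutativeRing ring hiding (ring)
  open Laurent F
  open Convolution ring
  open Relation.Binary.Reasoning.Setoid setoid
  open Algebra.Properties.Ring (CommutativeRing.ring ring) using (-0#≈0#)

  coeff-cong : ∀ f {i j} → i ≡ j → coeff f i ≈ coeff f j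
  coeff-cong f eq = reflexive (≡.cong (coeff f) eq)

  infix 9 _↓_
  -- Read downwards from an exponent `B`, a series in 1/Y becomes a sequence, and the product of
  -- series becomes convolution.
  _↓_ : LS → ℤ → ℕ → Carrier
  (f ↓ B) n = coeff f (B ℤ.- + n)

  sumFrom≈conv : ∀ N lo h f g → (∀ n m → n ℕ.+ m ≡ N → h (lo ℤ.+ + n) ≈ f m * g n) →
                 sumFrom lo (suc N) h ≈ conv f g N
  sumFrom≈conv zero lo h f g p    = trans (+-identityʳ _) (p 0 0 ≡.refl)
  sumFrom≈conv (suc N) lo h f g p = +-cong (p (suc N) 0 (ℕₚ.+-identityʳ _))
    (sumFrom≈conv N lo h (f ∘ suc) g
      (λ n m eq → p n (suc m) (≡.trans (ℕₚ.+-suc n m) (≡.cong suc eq))))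

  *L-below-tops : ∀ f g N →
    coeff (f *L g) (top f ℤ.+ top g ℤ.- + N) ≈ conv (f ↓ top f) (g ↓ top g) N
  *L-below-tops f g N = begin
    sumFrom lo (clamp (top f ℤ.+ top g ℤ.- k)) h ≡⟨ ≡.cong (λ z → sumFrom lo (clamp z) h) (lem₁ (top f) (top g) (+ N)) ⟩
    sumFrom lo (suc N) h                         ≈⟨ sumFrom≈conv N lo h _ _ agree ⟩
    conv (f ↓ top f) (g ↓ top g) N               ∎
    where
    k = top f ℤ.+ top g ℤ.- + N
    lo = k ℤ.- top g
    h : ℤ → Carrier
    h i = coeff f i * coeff g (k ℤ.- i)
    lem₁ : ∀ a b n → a ℤ.+ b ℤ.- (a ℤ.+ b ℤ.- n) ≡ n
    lem₁ = ring-ℤ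
    lem₂ : ∀ a b n m → a ℤ.+ b ℤ.- (n ℤ.+ m) ℤ.- b ℤ.+ n ≡ a ℤ.- m
    lem₂ = ring-ℤ
    lem₃ : ∀ a b n m → a ℤ.+ b ℤ.- (n ℤ.+ m) ℤ.- (a ℤ.+ b ℤ.- (n ℤ.+ m) ℤ.- b ℤ.+ n) ≡ b ℤ.- n
    lem₃ = ring-ℤ
    agree : ∀ n m → n ℕ.+ m ≡ N → h (lo ℤ.+ + n) ≈ (f ↓ top f) m * (g ↓ top g) n
    agree n m ≡.refl = *-cong (coeff-cong f (lem₂ (top f) (top g) (+ n) (+ m)))
                              (coeff-cong g (lem₃ (top f) (top g) (+ n) (+ m)))

  *L-above-tops : ∀ f g d → coeff (f *L g) (top f ℤ.+ top g ℤ.+ + suc d) ≈ 0#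
  *L-above-tops f g d = reflexive (≡.cong (λ z → sumFrom (k ℤ.- top g) (clamp z) h)
    (lem (top f) (top g) (+ suc d)))
    where
    k = top f ℤ.+ top g ℤ.+ + suc d
    h : ℤ → Carrier
    h i = coeff f i * coeff g (k ℤ.- i)
    lem : ∀ a b n → a ℤ.+ b ℤ.- (a ℤ.+ b ℤ.+ n) ≡ ℤ.- n
    lem = ring-ℤ

  *L-isLS : ∀ f g → IsLS (f *L g)
  *L-isLS f g i lt with <⇒+ lt
  ... | d , ≡.refl = *L-above-tops f g d

  conv-raiseˡ : ∀ f B G e N → AbsLe f B →
                conv (f ↓ (B ℤ.+ + e)) G (e ℕ.+ N) ≈ conv (f ↓ B) G N
  conv-raiseˡ f B G zero N f≤B    = conv-cong (λ i → coeff-cong f (lem B (+ i))) (λ _ → refl) N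
    where
    lem : ∀ b i → b ℤ.+ + 0 ℤ.- i ≡ b ℤ.- i
    lem = ring-ℤ
  conv-raiseˡ f B G (suc e) N f≤B = begin
    (f ↓ (B ℤ.+ + suc e)) 0 * G (suc e ℕ.+ N) + conv ((f ↓ (B ℤ.+ + suc e)) ∘ suc) G (e ℕ.+ N)
      ≈⟨ +-cong (trans (*-congʳ (f≤B _ (<-by e (ℤₚ.+-identityʳ _)))) (zeroˡ _))
                (conv-cong (λ i → coeff-cong f (lem B (+ e) (+ i))) (λ _ → refl) (e ℕ.+ N)) ⟩
    0# + conv (f ↓ (B ℤ.+ + e)) G (e ℕ.+ N) ≈⟨ +-identityˡ _ ⟩
    conv (f ↓ (B ℤ.+ + e)) G (e ℕ.+ N)      ≈⟨ conv-raiseˡ f B G e N f≤B ⟩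
    conv (f ↓ B) G N                        ∎
    where
    lem : ∀ b e i → b ℤ.+ (+ 1 ℤ.+ e) ℤ.- (+ 1 ℤ.+ i) ≡ b ℤ.+ e ℤ.- i
    lem = ring-ℤ

  conv-raise : ∀ f g B C d e N → AbsLe f B → AbsLe g C →
               conv (f ↓ (B ℤ.+ + d)) (g ↓ (C ℤ.+ + e)) (d ℕ.+ (e ℕ.+ N)) ≈ conv (f ↓ B) (g ↓ C) N
  conv-raise f g B C d e N f≤B g≤C = begin
    conv (f ↓ (B ℤ.+ + d)) (g ↓ (C ℤ.+ + e)) (d ℕ.+ (e ℕ.+ N)) ≈⟨ conv-raiseˡ f B _ d _ f≤B ⟩
    conv (f ↓ B) (g ↓ (C ℤ.+ + e)) (e ℕ.+ N)                   ≈⟨ conv-comm _ _ (e ℕ.+ N) ⟩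
    conv (g ↓ (C ℤ.+ + e)) (f ↓ B) (e ℕ.+ N)                   ≈⟨ conv-raiseˡ g C _ e N g≤C ⟩
    conv (g ↓ C) (f ↓ B) N                                     ≈⟨ conv-comm _ _ N ⟩
    conv (f ↓ B) (g ↓ C) N                                     ∎

  conv-beyond : ∀ f g B C B′ C′ N d → AbsLe f B′ → AbsLe g C′ →
    B ℤ.+ C ℤ.- + N ≡ B′ ℤ.+ C′ ℤ.+ + suc d → conv (f ↓ B) (g ↓ C) N ≈ 0#
  conv-beyond f g B C B′ C′ N d f≤B′ g≤C′ eq = conv-zero _ _ N vanish
    where
    lem₁ : ∀ b c i j → b ℤ.+ c ℤ.- (i ℤ.+ j) ≡ b ℤ.- i ℤ.+ (c ℤ.- j)
    lem₁ = ring-ℤ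
    lem₄ : ∀ x z → z ≡ x ℤ.+ z ℤ.- x
    lem₄ = ring-ℤ
    lem₅ : ∀ x y e s → x ℤ.+ y ℤ.+ s ℤ.- (x ℤ.- e) ≡ y ℤ.+ (s ℤ.+ e)
    lem₅ = ring-ℤ
    lem₆ : ∀ x e → x ≡ x ℤ.+ e ℤ.- e
    lem₆ = ring-ℤ
    vanish : ∀ i j → i ℕ.+ j ≡ N → (f ↓ B) i * (g ↓ C) j ≈ 0#
    vanish i j ≡.refl with ≤-or-> (B ℤ.- + i) B′
    ... | inj₂ (e , eq₁) = trans (*-congʳ (f≤B′ _ (<-by e eq₁))) (zeroˡ _)
    ... | inj₁ (e , eq₁) = trans (*-congˡ (g≤C′ _ (<-by (d ℕ.+ e) eq₂))) (zeroʳ _)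
      where
      eq₃ : B ℤ.- + i ℤ.+ (C ℤ.- + j) ≡ B′ ℤ.+ C′ ℤ.+ + suc d
      eq₃ = ≡.trans (≡.sym (lem₁ B C (+ i) (+ j))) eq
      eq₂ : C ℤ.- + j ≡ C′ ℤ.+ + suc (d ℕ.+ e)
      eq₂ = ≡.trans (lem₄ (B ℤ.- + i) (C ℤ.- + j))
            (≡.trans (≡.cong₂ ℤ._-_ eq₃ (≡.trans (lem₆ _ (+ e)) (≡.cong (ℤ._- + e) (≡.sym eq₁))))
                     (lem₅ B′ C′ (+ e) (+ suc d)))

  -- The product `_*L_` reads the bounds `top`, which `_≈L_` ignores. Raising a bound only pads a
  -- sequence with zeros, so all valid bounds give the same coefficients; congruence and
  -- distributivity rest on this.
  *L-coeff : ∀ f g B C → IsLS f → IsLS g → AbsLe f B → AbsLe g C →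
             ∀ N → coeff (f *L g) (B ℤ.+ C ℤ.- + N) ≈ conv (f ↓ B) (g ↓ C) N
  *L-coeff f g B C okf okg f≤B g≤C N
    with ≤-or-> (B ℤ.+ C ℤ.- + N) (top f ℤ.+ top g)
  ... | inj₂ (d , eq) = trans (trans (coeff-cong (f *L g) eq) (*L-above-tops f g d))
                              (sym (conv-beyond f g B C _ _ N d okf okg eq))
  -- Both pairs of bounds are raised to a common pair, where the two convolutions coincide.
  ... | inj₁ (M , eq) with common-upper (top f) B | common-upper (top g) C
  ... | d , d′ , eqf | e , e′ , eqg = begin
    coeff (f *L g) (B ℤ.+ C ℤ.- + N)               ≈⟨ coeff-cong (f *L g) at-M ⟩
    coeff (f *L g) (top f ℤ.+ top g ℤ.- + M)       ≈⟨ *L-below-tops f g M ⟩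
    conv (f ↓ top f) (g ↓ top g) M                 ≈⟨ conv-raise f g _ _ d e M okf okg ⟨
    conv (f ↓ (top f ℤ.+ + d)) (g ↓ (top g ℤ.+ + e)) (d ℕ.+ (e ℕ.+ M))
      ≡⟨ ≡.cong₂ (λ x y → conv (f ↓ x) (g ↓ y) (d ℕ.+ (e ℕ.+ M))) eqf eqg ⟩
    conv (f ↓ (B ℤ.+ + d′)) (g ↓ (C ℤ.+ + e′)) (d ℕ.+ (e ℕ.+ M))
      ≡⟨ ≡.cong (conv (f ↓ (B ℤ.+ + d′)) (g ↓ (C ℤ.+ + e′))) (ℤₚ.+-injective indices) ⟩
    conv (f ↓ (B ℤ.+ + d′)) (g ↓ (C ℤ.+ + e′)) (d′ ℕ.+ (e′ ℕ.+ N)) ≈⟨ conv-raise f g B C d′ e′ N f≤B g≤C ⟩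
    conv (f ↓ B) (g ↓ C) N                         ∎
    where
    at-M : B ℤ.+ C ℤ.- + N ≡ top f ℤ.+ top g ℤ.- + M
    at-M = transpose eq
    lem₃ : ∀ a b d e n → (a ℤ.+ d) ℤ.+ (b ℤ.+ e) ℤ.- (a ℤ.+ b ℤ.- n) ≡ d ℤ.+ (e ℤ.+ n)
    lem₃ = ring-ℤ
    indices : + (d ℕ.+ (e ℕ.+ M)) ≡ + (d′ ℕ.+ (e′ ℕ.+ N))
    indices = ≡.trans (≡.sym (lem₃ (top f) (top g) (+ d) (+ e) (+ M)))
      (≡.trans (≡.cong₂ ℤ._-_ (≡.cong₂ ℤ._+_ eqf eqg) (≡.sym at-M))
               (lem₃ B C (+ d′) (+ e′) (+ N)))

  AbsLe-* : ∀ f g B C → IsLS f → IsLS g → AbsLe f B → AbsLe g C → AbsLe (f *L g) (B ℤ.+ C)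
  AbsLe-* f g B C okf okg f≤B g≤C k lt with ≤-or-> k (top f ℤ.+ top g)
  ... | inj₂ (d , ≡.refl) = *L-above-tops f g d
  ... | inj₁ (M , eq) with <⇒+ lt
  ...   | d , eq′ = trans (coeff-cong (f *L g) at-M) (trans (*L-below-tops f g M)
            (conv-beyond f g (top f) (top g) B C M d f≤B g≤C (≡.trans (≡.sym at-M) eq′)))
    where
    at-M : k ≡ top f ℤ.+ top g ℤ.- + M
    at-M = transpose eq

  Series : Set
  Series = Σ LS IsLS

  _≈S_ : Series → Series → Set
  x ≈S y = proj₁ x ≈L proj₁ y

  AbsLe-mono : ∀ f {m n} → m ℤ.≤ n → AbsLe f m → AbsLe f n
  AbsLe-mono f m≤n p i n<i = p i (ℤₚ.≤-<-trans m≤n n<i)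

  AbsLe-+ : ∀ f g m → AbsLe f m → AbsLe g m → AbsLe (f +L g) m
  AbsLe-+ f g m p q i lt = trans (+-cong (p i lt) (q i lt)) (+-identityˡ 0#)

  infixl 6 _+S_
  infixl 7 _*S_
  _+S_ _*S_ : Series → Series → Series
  (f , p) +S (g , q) = f +L g , AbsLe-+ f g (top f ℤ.⊔ top g)
    (AbsLe-mono f (ℤₚ.i≤i⊔j (top f) (top g)) p) (AbsLe-mono g (ℤₚ.i≤j⊔i (top f) (top g)) q)
  (f , p) *S (g , q) = f *L g , *L-isLS f g

  -S_ : Series → Series
  -S (f , p) = -L f , λ i lt → trans (-‿cong (p i lt)) -0#≈0#

  lookupP-beyond : ∀ P n → lenP P ℕ.≤ n → lookupP P n ≈ 0#
  lookupP-beyond [] n _                    = refl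
  lookupP-beyond (a ∷ P) (suc n) (ℕ.s≤s p) = lookupP-beyond P n p

  embed-isLS : ∀ P → IsLS (embed P)
  embed-isLS P (+ n) (ℤ.+<+ lt) = lookupP-beyond P n (ℕₚ.<⇒≤ lt)

  polyS : Poly → Series
  polyS P = embed P , embed-isLS P

  0S 1S : Series
  0S = 0L , λ _ _ → refl
  1S = polyS (1# ∷ [])

  ≈L-below : ∀ f g B → AbsLe f B → AbsLe g B → (∀ N → coeff f (B ℤ.- + N) ≈ coeff g (B ℤ.- + N)) → f ≈L g
  ≈L-below f g B f≤B g≤B p k with ≤-or-> k B
  ... | inj₂ (d , eq) = trans (f≤B k (<-by d eq)) (sym (g≤B k (<-by d eq)))
  ... | inj₁ (N , eq) = trans (coeff-cong f at-N) (trans (p N) (sym (coeff-cong g at-N)))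
    where
    at-N : k ≡ B ℤ.- + N
    at-N = transpose eq

  *S-cong : ∀ {x x′ y y′} → x ≈S x′ → y ≈S y′ → (x *S y) ≈S (x′ *S y′)
  *S-cong {f , p} {f′ , p′} {g , q} {g′ , q′} ef eg =
    ≈L-below (f *L g) (f′ *L g′) (top f ℤ.+ top g) (*L-isLS f g)
      (AbsLe-* f′ g′ _ _ p′ q′ p″ q″)
      (λ N → trans (*L-below-tops f g N)
        (trans (conv-cong (λ i → ef _) (λ i → eg _) N)
               (sym (*L-coeff f′ g′ (top f) (top g) p′ q′ p″ q″ N))))
    where
    p″ : AbsLe f′ (top f)
    p″ i lt = trans (sym (ef i)) (p i lt)
    q″ : AbsLe g′ (top g)
    q″ i lt = trans (sym (eg i)) (q i lt)

  *S-comm : ∀ x y → (x *S y) ≈S (y *S x)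
  *S-comm (f , p) (g , q) = ≈L-below (f *L g) (g *L f) (top f ℤ.+ top g) (*L-isLS f g)
    (≡.subst (AbsLe (g *L f)) (ℤₚ.+-comm (top g) (top f)) (*L-isLS g f))
    (λ N → trans (*L-below-tops f g N) (trans (conv-comm _ _ N)
      (trans (sym (*L-below-tops g f N))
             (coeff-cong (g *L f) (≡.cong (ℤ._- + N) (ℤₚ.+-comm (top g) (top f)))))))

  *S-assoc : ∀ x y z → ((x *S y) *S z) ≈S (x *S (y *S z))
  *S-assoc (f , p) (g , q) (h , r) =
    ≈L-below ((f *L g) *L h) (f *L (g *L h)) (top f ℤ.+ top g ℤ.+ top h) (*L-isLS (f *L g) h)
      (≡.subst (AbsLe (f *L (g *L h))) (≡.sym assoc) (*L-isLS f (g *L h)))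
      (λ N → begin
        coeff ((f *L g) *L h) (top f ℤ.+ top g ℤ.+ top h ℤ.- + N)
          ≈⟨ *L-below-tops (f *L g) h N ⟩
        conv ((f *L g) ↓ (top f ℤ.+ top g)) (h ↓ top h) N
          ≈⟨ conv-cong (*L-below-tops f g) (λ _ → refl) N ⟩
        conv (conv (f ↓ top f) (g ↓ top g)) (h ↓ top h) N
          ≈⟨ conv-assoc _ _ _ N ⟩
        conv (f ↓ top f) (conv (g ↓ top g) (h ↓ top h)) N
          ≈⟨ conv-cong (λ _ → refl) (*L-below-tops g h) N ⟨
        conv (f ↓ top f) ((g *L h) ↓ (top g ℤ.+ top h)) N
          ≈⟨ *L-below-tops f (g *L h) N ⟨
        coeff (f *L (g *L h)) (top f ℤ.+ (top g ℤ.+ top h) ℤ.- + N)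
          ≈⟨ coeff-cong (f *L (g *L h)) (≡.cong (ℤ._- + N) assoc) ⟨
        coeff (f *L (g *L h)) (top f ℤ.+ top g ℤ.+ top h ℤ.- + N) ∎)
    where
    assoc = ℤₚ.+-assoc (top f) (top g) (top h)

  *S-distribʳ : ∀ z x y → ((x +S y) *S z) ≈S ((x *S z) +S (y *S z))
  *S-distribʳ (h , r) (f , p) (g , q) =
    ≈L-below ((f +L g) *L h) ((f *L h) +L (g *L h)) (t ℤ.+ top h) (*L-isLS (f +L g) h)
      (AbsLe-+ (f *L h) (g *L h) _ (AbsLe-* f h _ _ p r p′ r) (AbsLe-* g h _ _ q r q′ r))
      (λ N → trans (*L-below-tops (f +L g) h N) (trans (conv-distribʳ (f ↓ t) (g ↓ t) (h ↓ top h) N)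
        (sym (+-cong (*L-coeff f h t (top h) p r p′ r N) (*L-coeff g h t (top h) q r q′ r N)))))
    where
    t = top f ℤ.⊔ top g
    p′ = AbsLe-mono f (ℤₚ.i≤i⊔j (top f) (top g)) p
    q′ = AbsLe-mono g (ℤₚ.i≤j⊔i (top f) (top g)) q

  AbsLe-const : ∀ c → AbsLe (embed (c ∷ [])) (+ 0)
  AbsLe-const c (+ suc n) _         = refl
  AbsLe-const c (+ zero) (ℤ.+<+ ())

  *S-identityˡ : ∀ x → (1S *S x) ≈S x
  *S-identityˡ (f , p) = ≈L-below (proj₁ 1S *L f) f (+ 0 ℤ.+ top f)
    (AbsLe-* _ f _ _ (proj₂ 1S) p (AbsLe-const 1#) p) (≡.subst (AbsLe f) (≡.sym (ℤₚ.+-identityˡ _)) p)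
    (λ N → trans (*L-coeff _ f (+ 0) (top f) (proj₂ 1S) p (AbsLe-const 1#) p N)
      (trans (conv-identityˡ _ _ N refl (λ i → refl))
             (coeff-cong f (≡.cong (ℤ._- + N) (≡.sym (ℤₚ.+-identityˡ (top f)))))))

  *S-identityʳ : ∀ x → (x *S 1S) ≈S x
  *S-identityʳ x k = trans (*S-comm x 1S k) (*S-identityˡ x k)

  *S-distribˡ : ∀ z x y → (z *S (x +S y)) ≈S ((z *S x) +S (z *S y))
  *S-distribˡ z x y k = trans (*S-comm z (x +S y) k) (trans (*S-distribʳ z x y k)
    (+-cong (*S-comm x z k) (*S-comm y z k)))

  seriesIsCommutativeRing : IsCommutativeRing _≈S_ _+S_ _*S_ -S_ 0S 1S
  seriesIsCommutativeRing = record
    { isRing = record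
      { +-isAbelianGroup = record
        { isGroup = record
          { isMonoid = record
            { isSemigroup = record
              { isMagma = record
                { isEquivalence = record
                  { refl = λ _ → refl ; sym = λ p k → sym (p k) ; trans = λ p q k → trans (p k) (q k) }
                ; ∙-cong = λ p q k → +-cong (p k) (q k) }
              ; assoc = λ x y z k → +-assoc _ _ _ }
            ; identity = (λ x k → +-identityˡ _) , (λ x k → +-identityʳ _) }
          ; inverse = (λ x k → -‿inverseˡ _) , (λ x k → -‿inverseʳ _)
          ; ⁻¹-cong = λ p k → -‿cong (p k) }
        ; comm = λ x y k → +-comm _ _ }
      ; *-cong = λ {x} {x′} {y} {y′} → *S-cong {x} {x′} {y} {y′}
      ; *-assoc = *S-assoc
      ; *-identity = *S-identityˡ , *S-identityʳ
      ; distrib = *S-distribˡ , *S-distribʳ }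
    ; *-comm = *S-comm }

  seriesRing : CommutativeRing 0ℓ 0ℓ
  seriesRing = record { isCommutativeRing = seriesIsCommutativeRing }

-- Absolute values, polynomials and degrees

-- F_q((1/Y)) seen through Le x m, meaning |x| ≤ q^m, and its subring Poly = F_q[Y].
record ValuedRing : Set₁ where
  field
    R : CommutativeRing 0ℓ 0ℓ
  open CommutativeRing R public
  field
    Le         : Carrier → ℤ → Set
    Le-resp    : ∀ {x y m} → x ≈ y → Le x m → Le y m
    Le-mono    : ∀ {x m n} → m ℤ.≤ n → Le x m → Le x n
    Le-0       : ∀ {m} → Le 0# m
    Le-+       : ∀ {x y m} → Le x m → Le y m → Le (x + y) m
    Le-neg     : ∀ {x m} → Le x m → Le (- x) m
    Le-*       : ∀ {x y m n} → Le x m → Le y n → Le (x * y) (m ℤ.+ n)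
    -- For series this reflects that equality of coefficients in a finite field is decidable; it
    -- removes double negations from upper bounds.
    Le-stable  : ∀ {x m} → ¬ ¬ Le x m → Le x m
    Le-bounded : ∀ x → ∃ λ m → Le x m
    Le-zero    : ∀ {x} → (∀ n → Le x (ℤ.- + n)) → x ≈ 0#
  Deg : Carrier → ℤ → Set
  Deg x m = Le x m × ¬ Le x (m ℤ.- + 1)
  field
    Deg-*     : ∀ {x y m n} → Deg x m → Deg y n → Deg (x * y) (m ℤ.+ n)
    Poly      : Carrier → Set
    Poly-resp : ∀ {x y} → x ≈ y → Poly x → Poly y
    Poly-0    : Poly 0#
    Poly-1    : Poly 1#
    Poly-+    : ∀ {x y} → Poly x → Poly y → Poly (x + y)
    Poly-neg  : ∀ {x} → Poly x → Poly (- x)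
    Poly-*    : ∀ {x y} → Poly x → Poly y → Poly (x * y)
    Poly-zero : ∀ {x} → Poly x → Le x -1ℤ → x ≈ 0#
    Deg-1     : Deg 1# (+ 0)
    -- The constant is the quotient of two leading coefficients. Division with remainder, inverses
    -- of units and, with `limit`, values of continued fractions are all derived from it.
    residue   : ∀ {x y n} → Deg y n → Le x n →
                ∃ λ c → Poly c × Le c (+ 0) × Le (x - c * y) (n ℤ.- + 1)
    Y Y⁻¹     : Carrier
    Poly-Y    : Poly Y
    Deg-Y     : Deg Y (+ 1)
    Y-inverse : Y * Y⁻¹ ≈ 1#
    limit     : (x : ℕ → Carrier) → (∀ n → Le (x (suc n) - x n) (ℤ.- + suc n)) →
                ∃ λ l → ∀ n → Le (l - x n) (ℤ.- + suc n)

module Degree (V : ValuedRing) where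
  open ValuedRing V
  open IntegerCoefficients R public
  open Algebra.Properties.Ring (CommutativeRing.ring R) public using (-0#≈0#)

  Le-by : ∀ {x m n} (d : ℕ) → n ≡ m ℤ.+ + d → Le x m → Le x n
  Le-by d eq = Le-mono (≤-by d eq)

  Le-cast : ∀ {x m n} → m ≡ n → Le x m → Le x n
  Le-cast {x} = ≡.subst (Le x)

  Le-sub : ∀ {x y m} → Le x m → Le y m → Le (x - y) m
  Le-sub p q = Le-+ p (Le-neg q)

  Le-zero′ : ∀ {x m} → (∀ n → Le x (m ℤ.- + n)) → x ≈ 0#
  Le-zero′ {x} {m} p = Le-zero below
    where
    lem₁ : ∀ m d e → m ℤ.- d ℤ.+ e ≡ m ℤ.+ e ℤ.- d
    lem₁ = ring-ℤ
    lem₂ : ∀ m d → m ℤ.+ d ℤ.- d ≡ m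
    lem₂ = ring-ℤ
    below : ∀ n → Le x (ℤ.- + n)
    below n with common-upper (ℤ.- + n) m
    ... | d , e , eq = Le-mono (ℤₚ.≤-trans (ℤₚ.i≤i+j _ (+ e)) (ℤₚ.≤-reflexive
            (≡.trans (lem₁ m (+ d) (+ e)) (≡.trans (≡.cong (ℤ._- + d) (≡.sym eq)) (lem₂ (ℤ.- + n) (+ d))))))
            (p d)

  ≈0-stable : ∀ {x} → ¬ ¬ x ≈ 0# → x ≈ 0#
  ≈0-stable p = Le-zero λ n → Le-stable λ q → p λ x≈0 → q (Le-resp (sym x≈0) Le-0)

  Deg-cast : ∀ {x m n} → m ≡ n → Deg x m → Deg x n
  Deg-cast {x} = ≡.subst (Deg x)

  Deg-resp : ∀ {x y m} → x ≈ y → Deg x m → Deg y m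
  Deg-resp e (p , q) = Le-resp e p , q ∘ Le-resp (sym e)

  x-[x-y]≈y : ∀ x y → x - (x - y) ≈ y
  x-[x-y]≈y = solve 2 (λ x y → x :- (x :- y) := y) refl

  x+y-x≈y : ∀ x y → x + y - x ≈ y
  x+y-x≈y = solve 2 (λ x y → x :+ y :- x := y) refl

  -[x-y]≈y-x : ∀ x y → - (x - y) ≈ y - x
  -[x-y]≈y-x = solve 2 (λ x y → :- (x :- y) := y :- x) refl

  x-0≈x : ∀ x → x - 0# ≈ x
  x-0≈x x = trans (+-congˡ -0#≈0#) (+-identityʳ x)

  double-neg : ∀ x → x ≈ - - x
  double-neg = solve 1 (λ x → x := :- (:- x)) refl

  Deg-neg : ∀ {x m} → Deg x m → Deg (- x) m
  Deg-neg (p , q) = Le-neg p , λ r → q (Le-resp (sym (double-neg _)) (Le-neg r))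

  Deg-≤ : ∀ {x m n} → Deg x m → Le x n → m ℤ.≤ n
  Deg-≤ {x} {m} {n} (_ , p) q with ≤-or-> m n
  ... | inj₁ (d , eq) = ≤-by d eq
  ... | inj₂ (d , eq) = ⊥-elim (p (Le-by d (≡.trans (≡.cong (ℤ._- + 1) eq) (lem n (+ d))) q))
    where
    lem : ∀ n d → n ℤ.+ (+ 1 ℤ.+ d) ℤ.- + 1 ≡ n ℤ.+ d
    lem = ring-ℤ

  Deg-unique : ∀ {x m n} → Deg x m → Deg x n → m ≡ n
  Deg-unique p q = ℤₚ.≤-antisym (Deg-≤ p (proj₁ q)) (Deg-≤ q (proj₁ p))

  pred-≤ : ∀ m → m ℤ.- + 1 ℤ.≤ m
  pred-≤ m = ≤-by 1 (lem m)
    where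
    lem : ∀ m → m ≡ m ℤ.- + 1 ℤ.+ + 1
    lem = ring-ℤ

  Deg-+ : ∀ {x y m} → Deg x m → Le y (m ℤ.- + 1) → Deg (x + y) m
  Deg-+ {x} {y} {m} (p , q) r = Le-+ p (Le-mono (pred-≤ m) r) ,
    λ s → q (Le-resp (lem x y) (Le-sub s r))
    where
    lem : ∀ x y → x + y - y ≈ x
    lem = solve 2 (λ x y → x :+ y :- y := x) refl

  Deg-sub : ∀ {x y m} → Deg x m → Le y (m ℤ.- + 1) → Deg (x - y) m
  Deg-sub p r = Deg-+ p (Le-neg r)

  ¬Deg-0 : ∀ {m} → ¬ Deg 0# m
  ¬Deg-0 (_ , q) = q Le-0

  -- If a bound on x above m were sharp, the product would have an exact degree above m + n. So the
  -- bound can be lowered, one degree at a time.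
  Le-cancel : ∀ {x y m n} → Deg y n → Le (x * y) (m ℤ.+ n) → Le x m
  Le-cancel {x} {y} {m} {n} dy le with Le-bounded x
  ... | B , x≤B with common-upper B m
  ... | d , e , eq = descend e (Le-mono (ℤₚ.≤-trans (ℤₚ.i≤i+j B (+ d)) (ℤₚ.≤-reflexive eq)) x≤B)
    where
    lem₁ : ∀ m e → m ℤ.+ (+ 1 ℤ.+ e) ℤ.- + 1 ≡ m ℤ.+ e
    lem₁ = ring-ℤ
    lem₂ : ∀ m e n → m ℤ.+ (+ 1 ℤ.+ e) ℤ.+ n ℤ.- + 1 ≡ m ℤ.+ n ℤ.+ e
    lem₂ = ring-ℤ
    descend : ∀ e → Le x (m ℤ.+ + e) → Le x m
    descend zero p    = Le-cast (ℤₚ.+-identityʳ m) p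
    descend (suc e) p = descend e (Le-stable λ q →
      proj₂ (Deg-* (p , λ r → q (Le-cast (lem₁ m (+ e)) r)) dy)
            (Le-by e (lem₂ m (+ e) n) le))

  Deg-cancel : ∀ {x y m n} → Deg y n → Deg (x * y) (m ℤ.+ n) → Deg x m
  Deg-cancel {x} {y} {m} {n} dy (p , q) =
    Le-cancel dy p , λ r → q (Le-cast (lem m n) (Le-* r (proj₁ dy)))
    where
    lem : ∀ m n → m ℤ.- + 1 ℤ.+ n ≡ m ℤ.+ n ℤ.- + 1
    lem = ring-ℤ

  *-cancel : ∀ {x y n} → Deg y n → x * y ≈ 0# → x ≈ 0#
  *-cancel {x} {y} {n} dy e = Le-zero λ k → Le-cancel dy (Le-resp (sym e) Le-0)

  Le-pred-* : ∀ {x y m} → Le x -1ℤ → Le y m → Le (x * y) (m ℤ.- + 1)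
  Le-pred-* {m = m} p q = Le-cast (ℤₚ.+-comm -1ℤ m) (Le-* p q)

  Le-0-* : ∀ {x y m} → Le x (+ 0) → Le y m → Le (x * y) m
  Le-0-* {m = m} p q = Le-cast (ℤₚ.+-identityˡ m) (Le-* p q)

  -- Substituting w ≈ t w into itself improves any bound on w by one, indefinitely.
  contraction-zero : ∀ {t w} → Le t -1ℤ → w ≈ t * w → w ≈ 0#
  contraction-zero {t} {w} t≤ w≈tw with Le-bounded w
  ... | m , w≤m = Le-zero′ {m = m} small
    where
    lem : ∀ m n → m ℤ.- n ℤ.- + 1 ≡ m ℤ.- (+ 1 ℤ.+ n)
    lem = ring-ℤ
    small : ∀ n → Le w (m ℤ.- + n)
    small zero    = Le-cast (≡.sym (ℤₚ.+-identityʳ m)) w≤m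
    small (suc n) = Le-resp (sym w≈tw) (Le-cast (lem m (+ n)) (Le-pred-* t≤ (small n)))

  Poly-sub : ∀ {x y} → Poly x → Poly y → Poly (x - y)
  Poly-sub p q = Poly-+ p (Poly-neg q)

  Poly-Deg-≥0 : ∀ {x m} → Poly x → Deg x m → + 0 ℤ.≤ m
  Poly-Deg-≥0 {x} {m} p d with ≤-or-> (+ 0) m
  ... | inj₁ (k , eq) = ≤-by k eq
  ... | inj₂ (k , eq) = ⊥-elim (proj₂ d (Le-resp (sym (Poly-zero p
          (Le-by k (≡.trans (lem m (+ k)) (≡.trans (≡.cong (λ z → m ℤ.+ + k ℤ.- z) (≡.sym eq)) (ℤₚ.+-identityʳ _))) (proj₁ d)))) Le-0))
    where
    lem : ∀ m k → ℤ.- + 1 ≡ m ℤ.+ k ℤ.- (m ℤ.+ (+ 1 ℤ.+ k))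
    lem = ring-ℤ

  -- The residue v of 1 by u leaves the polynomial 1 - v u of negative degree, which is zero.
  unit : ∀ {u} → Poly u → Deg u (+ 0) → ∃ λ v → Poly v × Deg v (+ 0) × u * v ≈ 1#
  unit {u} Pu du with residue du (proj₁ Deg-1)
  ... | v , Pv , _ , le = v , Pv , Deg-cancel du (Deg-resp (trans (sym uv≈1) (*-comm u v)) Deg-1) , uv≈1
    where
    uv≈1 : u * v ≈ 1#
    uv≈1 = trans (trans (*-comm u v) (sym (x-[x-y]≈y 1# (v * u)))) (trans (+-congˡ (trans (-‿cong (Poly-zero (Poly-sub Poly-1 (Poly-* Pv Pu)) le)) -0#≈0#)) (+-identityʳ 1#))

  Y^ Y⁻^ : ℕ → Carrier
  Y^ zero     = 1#
  Y^ (suc n)  = Y * Y^ n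
  Y⁻^ zero    = 1#
  Y⁻^ (suc n) = Y⁻¹ * Y⁻^ n

  Poly-Y^ : ∀ n → Poly (Y^ n)
  Poly-Y^ zero    = Poly-1
  Poly-Y^ (suc n) = Poly-* Poly-Y (Poly-Y^ n)

  Deg-Y^ : ∀ n → Deg (Y^ n) (+ n)
  Deg-Y^ zero    = Deg-1
  Deg-Y^ (suc n) = Deg-* Deg-Y (Deg-Y^ n)

  Y^-inverse : ∀ n → Y⁻^ n * Y^ n ≈ 1#
  Y^-inverse zero    = *-identityˡ 1#
  Y^-inverse (suc n) = trans (lem Y Y⁻¹ (Y^ n) (Y⁻^ n))
    (trans (*-cong Y-inverse (Y^-inverse n)) (*-identityˡ 1#))
    where
    lem : ∀ a b c d → b * d * (a * c) ≈ a * b * (d * c)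
    lem = solve 4 (λ a b c d → b :* d :* (a :* c) := a :* b :* (d :* c)) refl

  Deg-Y⁻^ : ∀ n → Deg (Y⁻^ n) (ℤ.- + n)
  Deg-Y⁻^ n = Deg-cancel (Deg-Y^ n)
    (Deg-resp (sym (Y^-inverse n)) (Deg-cast (≡.sym (ℤₚ.+-inverseˡ (+ n))) Deg-1))

  approximate-inverse : ∀ {a} d → Deg a (+ suc d) →
    ∃ λ e → Le e -1ℤ × Le (1# - e * a) -1ℤ
  approximate-inverse {a} d da with residue da (proj₁ (Deg-Y^ (suc d)))
  ... | c , _ , c≤0 , le = c * y , Le-by d (lem₁ (+ d)) (Le-0-* c≤0 (proj₁ (Deg-Y⁻^ (suc d)))) ,
        Le-resp (trans (lem₂ a c y (Y^ (suc d))) (+-congʳ (Y^-inverse (suc d))))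
          (Le-cast (lem₃ (+ d)) (Le-* (proj₁ (Deg-Y⁻^ (suc d))) le))
    where
    y = Y⁻^ (suc d)
    lem₁ : ∀ d → ℤ.- + 1 ≡ ℤ.- (+ 1 ℤ.+ d) ℤ.+ d
    lem₁ = ring-ℤ
    lem₂ : ∀ a c y z → y * (z - c * a) ≈ y * z - c * y * a
    lem₂ = solve 4 (λ a c y z → y :* (z :- c :* a) := y :* z :- c :* y :* a) refl
    lem₃ : ∀ d → ℤ.- (+ 1 ℤ.+ d) ℤ.+ (+ 1 ℤ.+ d ℤ.- + 1) ≡ ℤ.- + 1
    lem₃ = ring-ℤ

-- Existence of infinite continued fractions

-- A family x with x i = 1 / (a i + x (next i)): all tails of continued fractions
-- whose partial quotients are read along next.
module ContinuedFraction (V : ValuedRing) {I : Set} (next : I → I)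
  (a : I → ValuedRing.Carrier V) (d : I → ℕ)
  (Deg-a : ∀ i → ValuedRing.Deg V (a i) (+ suc (d i))) where
  open ValuedRing V
  open Degree V

  e : I → Carrier
  e i = proj₁ (approximate-inverse (d i) (Deg-a i))

  e≤ : ∀ i → Le (e i) -1ℤ
  e≤ i = proj₁ (proj₂ (approximate-inverse (d i) (Deg-a i)))

  1-ea≤ : ∀ i → Le (1# - e i * a i) -1ℤ
  1-ea≤ i = proj₂ (proj₂ (approximate-inverse (d i) (Deg-a i)))

  -- A contraction whose fixed points satisfy e * (1 - x * (a + x′)) = 0.
  T : I → Carrier → Carrier → Carrier
  T i x x′ = x * (1# - e i * a i) + e i * (1# - x * x′)

  T-contracts : ∀ i {x x′ z z′ m} → Le (x - z) m → Le (x′ - z′) m → Le x′ (+ 0) → Le z (+ 0) →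
                Le (T i x x′ - T i z z′) (m ℤ.- + 1)
  T-contracts i {x} {x′} {z} {z′} {m} p p′ x′≤ z≤ = Le-resp (lem x x′ z z′ (1# - e i * a i) (e i))
    (Le-sub (Le-pred-* (1-ea≤ i) p)
            (Le-pred-* (e≤ i) (Le-+ (Le-0-* x′≤ p) (Le-0-* z≤ p′))))
    where
    lem : ∀ x x′ z z′ t e → t * (x - z) - e * (x′ * (x - z) + z * (x′ - z′)) ≈
          x * t + e * (1# - x * x′) - (z * t + e * (1# - z * z′))
    lem = solve 6 (λ x x′ z z′ t e → t :* (x :- z) :- e :* (x′ :* (x :- z) :+ z :* (x′ :- z′)) :=
          x :* t :+ e :* (con (+ 1) :- x :* x′) :- (z :* t :+ e :* (con (+ 1) :- z :* z′))) refl

  approx : ℕ → I → Carrier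
  approx zero i    = 0#
  approx (suc n) i = T i (approx n i) (approx n (next i))

  ≤-1⇒≤0 : ∀ {x} → Le x -1ℤ → Le x (+ 0)
  ≤-1⇒≤0 = Le-mono ℤ.-≤+

  approx≤ : ∀ n i → Le (approx n i) -1ℤ
  approx≤ zero i    = Le-0
  approx≤ (suc n) i = Le-+
    (Le-mono (ℤ.-≤- ℕ.z≤n) (Le-* (approx≤ n i) (1-ea≤ i)))
    (Le-* (e≤ i) (Le-sub (proj₁ Deg-1)
      (Le-mono ℤ.-≤+ (Le-* (approx≤ n i) (approx≤ n (next i))))))

  private
    minus-suc : ∀ n → ℤ.- (+ suc n) ℤ.- + 1 ≡ ℤ.- (+ suc (suc n))
    minus-suc n = lem (+ n)
      where
      lem : ∀ n → ℤ.- (+ 1 ℤ.+ n) ℤ.- + 1 ≡ ℤ.- (+ 2 ℤ.+ n)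
      lem = ring-ℤ

  approx-step : ∀ n i → Le (approx (suc n) i - approx n i) (ℤ.- + suc n)
  approx-step zero i    = Le-sub (approx≤ 1 i) Le-0
  approx-step (suc n) i = Le-cast (minus-suc n) (T-contracts i (approx-step n i) (approx-step n (next i))
    (≤-1⇒≤0 (approx≤ (suc n) (next i))) (≤-1⇒≤0 (approx≤ n i)))

  x : I → Carrier
  x i = proj₁ (limit (λ n → approx n i) (λ n → approx-step n i))

  x-approx : ∀ n i → Le (x i - approx n i) (ℤ.- + suc n)
  x-approx n i = proj₂ (limit (λ n → approx n i) (λ n → approx-step n i)) n

  x≤ : ∀ i → Le (x i) -1ℤ
  x≤ i = Le-resp (x-0≈x _) (x-approx 0 i)

  x-fixed : ∀ i → x i - T i (x i) (x (next i)) ≈ 0#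
  x-fixed i = Le-zero λ n → Le-mono (ℤₚ.neg-mono-≤ (ℤ.+≤+ (ℕₚ.≤-trans (ℕₚ.n≤1+n n) (ℕₚ.n≤1+n _))))
    (Le-resp (lem _ _ _) (Le-sub (x-approx (suc n) i)
      (Le-cast (minus-suc n) (T-contracts i (x-approx n i) (x-approx n (next i))
        (≤-1⇒≤0 (x≤ (next i))) (≤-1⇒≤0 (approx≤ n i))))))
    where
    lem : ∀ a b c → a - b - (c - b) ≈ a - c
    lem = solve 3 (λ a b c → a :- b :- (c :- b) := a :- c) refl

  x-equation : ∀ i → x i * (a i + x (next i)) ≈ 1#
  x-equation i = begin
    x i * (a i + x (next i))                 ≈⟨ x-[x-y]≈y 1# _ ⟨
    1# - (1# - x i * (a i + x (next i)))     ≈⟨ +-congˡ (-‿cong w≈0) ⟩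
    1# - 0#                                  ≈⟨ x-0≈x _ ⟩
    1#                                       ∎
    where
    open Relation.Binary.Reasoning.Setoid setoid
    lem₂ : ∀ x x′ e a → let w = 1# - x * (a + x′) in
           w ≈ (1# - e * a) * w - a * (x - (x * (1# - e * a) + e * (1# - x * x′)))
    lem₂ = solve 4 (λ x x′ e a → let w = con (+ 1) :- x :* (a :+ x′) in
           w := (con (+ 1) :- e :* a) :* w :- a :* (x :- (x :* (con (+ 1) :- e :* a) :+ e :* (con (+ 1) :- x :* x′)))) refl
    -- For the defect w = 1 - x (a + x′), being a fixed point only says e w ≈ 0. Then w ≈ (1 - e a)
    -- w, and 1 - e a is small.
    w≈0 : 1# - x i * (a i + x (next i)) ≈ 0#
    w≈0 = contraction-zero (1-ea≤ i) (trans (lem₂ (x i) (x (next i)) (e i) (a i))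
      (trans (+-congˡ (-‿cong (trans (*-congˡ (x-fixed i)) (zeroʳ _)))) (x-0≈x _)))

-- Geodesics with partial quotients of degree 1 and polynomial matrices

module Geodesic (V : ValuedRing) where
  open ValuedRing V
  open Degree V

  -- (x , y) are homogeneous coordinates of the point x / y.
  Point : Set
  Point = Carrier × Carrier

  step back : Carrier → Point → Point
  step a (x , y) = y , x - a * y
  back a (x , y) = a * x + y , x

  _≈ₚ_ : Point → Point → Set
  (x , y) ≈ₚ (x′ , y′) = (x ≈ x′) × (y ≈ y′)

  -- Up to scaling, the distances from a point to the two ends 1/ξ and -η of a geodesic.
  toward away : Carrier → Point → Carrier
  toward ξ (x , y) = x * ξ - y
  away η (x , y)   = x + y * η

  toward-cong : ∀ ξ {u u′} → u ≈ₚ u′ → toward ξ u ≈ toward ξ u′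
  toward-cong ξ (p , q) = +-cong (*-congʳ p) (-‿cong q)

  away-cong : ∀ η {u u′} → u ≈ₚ u′ → away η u ≈ away η u′
  away-cong η (p , q) = +-cong p (*-congʳ q)

  -- One letter `a` of a bi-infinite word: `ξ` and `η` are the right and left tails at the position
  -- before it, `ξ⁺` and `η⁺` those at the position after it.
  record Link (a ξ η ξ⁺ η⁺ : Carrier) : Set where
    field
      Poly-a : Poly a
      Deg-a  : Deg a (+ 1)
      ξ⁺≤    : Le ξ⁺ -1ℤ
      η≤     : Le η -1ℤ
      ξ-eq   : ξ * (a + ξ⁺) ≈ 1#
      η-eq   : η⁺ * (a + η) ≈ 1#

    ξ-denominator : Deg (a + ξ⁺) (+ 1)
    ξ-denominator = Deg-+ Deg-a (Le-mono ℤ.-≤+ ξ⁺≤)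

    η-denominator : Deg (a + η) (+ 1)
    η-denominator = Deg-+ Deg-a (Le-mono ℤ.-≤+ η≤)

    Deg-ξ : Deg ξ -1ℤ
    Deg-ξ = Deg-cancel ξ-denominator (Deg-resp (sym ξ-eq) Deg-1)

    Deg-η⁺ : Deg η⁺ -1ℤ
    Deg-η⁺ = Deg-cancel η-denominator (Deg-resp (sym η-eq) Deg-1)

  -- Many identities below are stated as a target plus multiples of known equations, which makes
  -- them provable by the ring solver; `modulo` then discards the multiples.
  modulo : ∀ {p q b} c → p ≈ q → b + c * (p - q) ≈ b
  modulo {p} {q} {b} c p≈q = trans (+-congˡ (trans (*-congˡ (trans (+-congʳ p≈q) (-‿inverseʳ q))) (zeroʳ c)))
                                   (+-identityʳ b)

  step-back : ∀ a u → step a (back a u) ≈ₚ u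
  step-back a (x , y) = refl , x+y-x≈y (a * x) y

  module _ {a ξ η ξ⁺ η⁺ : Carrier} (l : Link a ξ η ξ⁺ η⁺) where
    open Link l

    toward-step : ∀ u → toward ξ⁺ (step a u) ≈ - (a + ξ⁺) * toward ξ u
    toward-step (x , y) = trans (lem x y a ξ ξ⁺) (modulo x ξ-eq)
      where
      lem : ∀ x y a ξ ξ⁺ → y * ξ⁺ - (x - a * y) ≈ - (a + ξ⁺) * (x * ξ - y) + x * (ξ * (a + ξ⁺) - 1#)
      lem = solve 5 (λ x y a ξ ξ⁺ → y :* ξ⁺ :- (x :- a :* y) :=
              (:- (a :+ ξ⁺)) :* (x :* ξ :- y) :+ x :* (ξ :* (a :+ ξ⁺) :- con (+ 1))) refl

    toward-unstep : ∀ u → toward ξ u ≈ - ξ * toward ξ⁺ (step a u)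
    toward-unstep (x , y) = trans (lem x y a ξ ξ⁺) (modulo y ξ-eq)
      where
      lem : ∀ x y a ξ ξ⁺ → x * ξ - y ≈ - ξ * (y * ξ⁺ - (x - a * y)) + y * (ξ * (a + ξ⁺) - 1#)
      lem = solve 5 (λ x y a ξ ξ⁺ → x :* ξ :- y :=
              (:- ξ) :* (y :* ξ⁺ :- (x :- a :* y)) :+ y :* (ξ :* (a :+ ξ⁺) :- con (+ 1))) refl

    away-step : ∀ u → away η⁺ (step a u) ≈ η⁺ * away η u
    away-step (x , y) = trans (lem x y a η η⁺) (modulo (- y) η-eq)
      where
      lem : ∀ x y a η η⁺ → y + (x - a * y) * η⁺ ≈ η⁺ * (x + y * η) + (- y) * (η⁺ * (a + η) - 1#)
      lem = solve 5 (λ x y a η η⁺ → y :+ (x :- a :* y) :* η⁺ :=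
              η⁺ :* (x :+ y :* η) :+ (:- y) :* (η⁺ :* (a :+ η) :- con (+ 1))) refl

    away-unstep : ∀ u → away η u ≈ (a + η) * away η⁺ (step a u)
    away-unstep (x , y) = trans (lem x y a η η⁺) (modulo (- (x - a * y)) η-eq)
      where
      lem : ∀ x y a η η⁺ → x + y * η ≈ (a + η) * (y + (x - a * y) * η⁺) + (- (x - a * y)) * (η⁺ * (a + η) - 1#)
      lem = solve 5 (λ x y a η η⁺ → x :+ y :* η :=
              (a :+ η) :* (y :+ (x :- a :* y) :* η⁺) :+ (:- (x :- a :* y)) :* (η⁺ :* (a :+ η) :- con (+ 1))) refl

    private
      regroup : ∀ b e x y → - b * x * (e * y) ≈ - b * e * (x * y)
      regroup = solve 4 (λ b e x y → (:- b) :* x :* (e :* y) := (:- b) :* e :* (x :* y)) refl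

    -- A step multiplies `toward` by a factor of degree 1 and `away` by one of degree -1. The points
    -- u and v are arbitrary, so the absolute values of `error` and `height` are both invariant
    -- along the line.
    product-step : ∀ {u v m} → Le (toward ξ u * away η v) m → Le (toward ξ⁺ (step a u) * away η⁺ (step a v)) m
    product-step {u} {v} p = Le-resp
      (sym (trans (*-cong (toward-step u) (away-step v)) (regroup (a + ξ⁺) η⁺ (toward ξ u) (away η v))))
      (Le-0-* (Le-* (Le-neg (proj₁ ξ-denominator)) (proj₁ Deg-η⁺)) p)

    product-unstep : ∀ {u v m} → Le (toward ξ⁺ (step a u) * away η⁺ (step a v)) m → Le (toward ξ u * away η v) m
    product-unstep {u} {v} p = Le-resp
      (sym (trans (*-cong (toward-unstep u) (away-unstep v)) (regroup ξ (a + η) _ _)))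
      (Le-0-* (Le-* (Le-neg (proj₁ Deg-ξ)) (proj₁ η-denominator)) p)

    product-back : ∀ {u v m} → Le (toward ξ⁺ u * away η⁺ v) m → Le (toward ξ (back a u) * away η (back a v)) m
    product-back {u} {v} p = product-unstep (Le-resp
      (sym (*-cong (toward-cong ξ⁺ (step-back a u)) (away-cong η⁺ (step-back a v)))) p)

    product-unback : ∀ {u v m} → Le (toward ξ (back a u) * away η (back a v)) m → Le (toward ξ⁺ u * away η⁺ v) m
    product-unback {u} {v} p = Le-resp
      (*-cong (toward-cong ξ⁺ (step-back a u)) (away-cong η⁺ (step-back a v))) (product-step p)

    Deg-toward-step : ∀ {u m} → Deg (toward ξ u) m → Deg (toward ξ⁺ (step a u)) (m ℤ.+ + 1)
    Deg-toward-step {u} {m} p = Deg-resp (sym (toward-step u))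
      (Deg-cast (ℤₚ.+-comm (+ 1) m) (Deg-* (Deg-neg ξ-denominator) p))

    Deg-away-step : ∀ {u m} → Deg (away η u) m → Deg (away η⁺ (step a u)) (m ℤ.- + 1)
    Deg-away-step {u} {m} p = Deg-resp (sym (away-step u))
      (Deg-cast (ℤₚ.+-comm -1ℤ m) (Deg-* Deg-η⁺ p))

    Le-toward-step : ∀ {u m} → Le (toward ξ u) m → Le (toward ξ⁺ (step a u)) (m ℤ.+ + 1)
    Le-toward-step {u} {m} p = Le-resp (sym (toward-step u))
      (Le-cast (ℤₚ.+-comm (+ 1) m) (Le-* (Le-neg (proj₁ ξ-denominator)) p))

    Le-toward-unstep : ∀ {u m} → Le (toward ξ⁺ (step a u)) m → Le (toward ξ u) (m ℤ.- + 1)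
    Le-toward-unstep {u} {m} p = Le-resp (sym (toward-unstep u))
      (Le-cast (ℤₚ.+-comm -1ℤ m) (Le-* (Le-neg (proj₁ Deg-ξ)) p))

    Deg-toward-back : ∀ {u m} → Deg (toward ξ⁺ u) m → Deg (toward ξ (back a u)) (m ℤ.- + 1)
    Deg-toward-back {u} {m} p = Deg-resp
      (sym (trans (toward-unstep (back a u)) (*-congˡ (toward-cong ξ⁺ (step-back a u)))))
      (Deg-cast (ℤₚ.+-comm -1ℤ m) (Deg-* (Deg-neg Deg-ξ) p))

    Deg-away-back : ∀ {u m} → Deg (away η⁺ u) m → Deg (away η (back a u)) (m ℤ.+ + 1)
    Deg-away-back {u} {m} p = Deg-resp
      (sym (trans (away-unstep (back a u)) (*-congˡ (away-cong η⁺ (step-back a u)))))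
      (Deg-cast (ℤₚ.+-comm (+ 1) m) (Deg-* η-denominator p))

  two-below : ∀ m k → m ℤ.- + 2 ≡ m ℤ.- (+ 1 ℤ.+ k) ℤ.- (+ 1 ℤ.+ k) ℤ.+ (k ℤ.+ k)
  two-below = ring-ℤ

  one-letter-less : ∀ m k → m ℤ.- (+ 1 ℤ.+ k) ℤ.- (+ 1 ℤ.+ k) ℤ.+ + 1 ≡ m ℤ.- + 1 ℤ.- k ℤ.- k
  one-letter-less = ring-ℤ

  record Mat : Set where
    field
      p q r s : Carrier
      Poly-p  : Poly p
      Poly-q  : Poly q
      Poly-r  : Poly r
      Poly-s  : Poly s
      det     : Carrier
      Deg-det : Deg det (+ 0)
      det-eq  : p * s - q * r ≈ det

    col : Point
    col = p , r

    act : Carrier → Point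
    act f = p * f + q , r * f + s

    det-act : ∀ f → proj₁ (act f) * r - proj₂ (act f) * p ≈ - det
    det-act f = trans (lem p q r s f) (-‿cong det-eq)
      where
      lem : ∀ p q r s f → (p * f + q) * r - (r * f + s) * p ≈ - (p * s - q * r)
      lem = solve 5 (λ p q r s f → (p :* f :+ q) :* r :- (r :* f :+ s) :* p := :- (p :* s :- q :* r)) refl

  open Mat

  stepᴹ : ∀ a → Poly a → Mat → Mat
  stepᴹ a Pa M = record
    { p = r M ; q = s M ; r = p M - a * r M ; s = q M - a * s M
    ; Poly-p = Poly-r M ; Poly-q = Poly-s M
    ; Poly-r = Poly-sub (Poly-p M) (Poly-* Pa (Poly-r M))
    ; Poly-s = Poly-sub (Poly-q M) (Poly-* Pa (Poly-s M))
    ; det = - det M ; Deg-det = Deg-neg (Deg-det M)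
    ; det-eq = trans (lem a (p M) (q M) (r M) (s M)) (-‿cong (det-eq M)) }
    where
    lem : ∀ a p q r s → r * (q - a * s) - s * (p - a * r) ≈ - (p * s - q * r)
    lem = solve 5 (λ a p q r s → r :* (q :- a :* s) :- s :* (p :- a :* r) := :- (p :* s :- q :* r)) refl

  backᴹ : ∀ a → Poly a → Mat → Mat
  backᴹ a Pa M = record
    { p = a * p M + r M ; q = a * q M + s M ; r = p M ; s = q M
    ; Poly-p = Poly-+ (Poly-* Pa (Poly-p M)) (Poly-r M)
    ; Poly-q = Poly-+ (Poly-* Pa (Poly-q M)) (Poly-s M)
    ; Poly-r = Poly-p M ; Poly-s = Poly-q M
    ; det = - det M ; Deg-det = Deg-neg (Deg-det M)
    ; det-eq = trans (lem a (p M) (q M) (r M) (s M)) (-‿cong (det-eq M)) }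
    where
    lem : ∀ a p q r s → (a * p + r) * q - (a * q + s) * p ≈ - (p * s - q * r)
    lem = solve 5 (λ a p q r s → (a :* p :+ r) :* q :- (a :* q :+ s) :* p := :- (p :* s :- q :* r)) refl

  translate : ∀ c → Poly c → Mat → Mat
  translate c Pc M = record
    { p = p M - c * r M ; q = q M - c * s M ; r = r M ; s = s M
    ; Poly-p = Poly-sub (Poly-p M) (Poly-* Pc (Poly-r M))
    ; Poly-q = Poly-sub (Poly-q M) (Poly-* Pc (Poly-s M))
    ; Poly-r = Poly-r M ; Poly-s = Poly-s M
    ; det = det M ; Deg-det = Deg-det M
    ; det-eq = trans (lem c (p M) (q M) (r M) (s M)) (det-eq M) }
    where
    lem : ∀ a p q r s → (p - a * r) * s - (q - a * s) * r ≈ p * s - q * r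
    lem = solve 5 (λ a p q r s → (p :- a :* r) :* s :- (q :- a :* s) :* r := p :* s :- q :* r) refl

  row-difference : ∀ a p q r s f → (p - a * r) * f + (q - a * s) ≈ p * f + q - a * (r * f + s)
  row-difference = solve 6 (λ a p q r s f → (p :- a :* r) :* f :+ (q :- a :* s) := p :* f :+ q :- a :* (r :* f :+ s)) refl

  act-step : ∀ a Pa M f → act (stepᴹ a Pa M) f ≈ₚ step a (act M f)
  act-step a Pa M f = refl , row-difference a (p M) (q M) (r M) (s M) f

  act-back : ∀ a Pa M f → act (backᴹ a Pa M) f ≈ₚ back a (act M f)
  act-back a Pa M f = lem a (p M) (q M) (r M) (s M) f , refl
    where
    lem : ∀ a p q r s f → (a * p + r) * f + (a * q + s) ≈ a * (p * f + q) + (r * f + s)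
    lem = solve 6 (λ a p q r s f → (a :* p :+ r) :* f :+ (a :* q :+ s) := a :* (p :* f :+ q) :+ (r :* f :+ s)) refl

  act-translate : ∀ c Pc M f → proj₁ (act (translate c Pc M) f) ≈ proj₁ (act M f) - c * proj₂ (act M f)
  act-translate c Pc M f = row-difference c (p M) (q M) (r M) (s M) f

  -- If 1/ξ - (-η) has absolute value q and β, β^σ are the preimages under M of 1/ξ and -η,
  -- then |error| = |f - β| / |β - β^σ| and |height| = 1 / |β - β^σ|.
  error : Mat → Carrier → Carrier → Carrier → Carrier
  error M ξ η f = toward ξ (act M f) * away η (col M)

  height : Mat → Carrier → Carrier → Carrier
  height M ξ η = toward ξ (col M) * away η (col M)

  module _ {a ξ η ξ⁺ η⁺ : Carrier} (l : Link a ξ η ξ⁺ η⁺) where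
    open Link l

    error-step : ∀ M f {m} → Le (error M ξ η f) m → Le (error (stepᴹ a Poly-a M) ξ⁺ η⁺ f) m
    error-step M f p = Le-resp (*-congʳ (sym (toward-cong ξ⁺ (act-step a Poly-a M f))))
      (product-step l {act M f} {col M} p)

    height-unstep : ∀ M {m} → Le (height (stepᴹ a Poly-a M) ξ⁺ η⁺) m → Le (height M ξ η) m
    height-unstep M = product-unstep l {col M} {col M}

    error-back : ∀ M f {m} → Le (error M ξ⁺ η⁺ f) m → Le (error (backᴹ a Poly-a M) ξ η f) m
    error-back M f p = Le-resp (*-congʳ (sym (toward-cong ξ (act-back a Poly-a M f))))
      (product-back l {act M f} {col M} p)

    height-unback : ∀ M {m} → Le (height (backᴹ a Poly-a M) ξ η) m → Le (height M ξ⁺ η⁺) m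
    height-unback M = product-unback l {col M} {col M}

  -- A bi-infinite word of partial quotients of degree 1 together with its
  -- right tails ξ = [0; aᵢ, aᵢ₊₁, …] and left tails η = [0; aᵢ₋₁, aᵢ₋₂, …].
  record Line : Set₁ where
    field
      Idx       : Set
      next prev : Idx → Idx
      aR aL     : Idx → Carrier
      ξ η       : Idx → Carrier
      linkR     : ∀ i → Link (aR i) (ξ i) (η i) (ξ (next i)) (η (next i))
      linkL     : ∀ i → Link (aL i) (ξ (prev i)) (η (prev i)) (ξ i) (η i)
      ξ-irrational : ∀ i {p r} → Poly p → Poly r → p * ξ i ≈ r → p ≈ 0#
      η-irrational : ∀ i {p r} → Poly p → Poly r → p * η i ≈ r → p ≈ 0#

    nexts : ℕ → Idx → Idx
    nexts zero i    = i
    nexts (suc n) i = nexts n (next i)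

    Deg-ξ : ∀ i → Deg (ξ i) -1ℤ
    Deg-ξ i = Link.Deg-ξ (linkR i)

    Deg-η : ∀ i → Deg (η i) -1ℤ
    Deg-η i = Link.Deg-η⁺ (linkL i)

  -- The origin has been moved along the line to where ∞ projects. As a letter of degree 1 takes two
  -- edges, the projection is the base vertex or the vertex before it, whence the two cases of
  -- `Deg-away`.
  record Located (L : Line) (M : Mat) (i : Line.Idx L) : Set where
    open Line L
    field
      M′       : Mat
      i′       : Idx
      v        : ℤ
      Deg-toward : Deg (toward (ξ i′) (col M′)) v
      Deg-away   : Deg (away (η i′) (col M′)) v ⊎ Deg (away (η i′) (col M′)) (v ℤ.- + 1)
      error-≤  : ∀ f {m} → Le (error M (ξ i) (η i) f) m → Le (error M′ (ξ i′) (η i′) f) m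
      height-≥ : ∀ {m} → Le (height M′ (ξ i′) (η i′)) m → Le (height M (ξ i) (η i)) m

  module _ (L : Line) where
    open Line L

    private
      stay : ∀ M i {v y} → Deg (toward (ξ i) (col M)) v → Deg (away (η i) (col M)) y →
             (y ≡ v ⊎ y ≡ v ℤ.- + 1) → Located L M i
      stay M i {v} dv dy c = record
        { M′ = M ; i′ = i ; v = v ; Deg-toward = dv ; Deg-away = choose c
        ; error-≤ = λ f le → le ; height-≥ = λ le → le }
        where
        choose : (_ ⊎ _) → Deg (away (η i) (col M)) v ⊎ Deg (away (η i) (col M)) (v ℤ.- + 1)
        choose (inj₁ ≡.refl) = inj₁ dy
        choose (inj₂ ≡.refl) = inj₂ dy

      after-step : ∀ M i → Located L (stepᴹ (aR i) (Link.Poly-a (linkR i)) M) (next i) → Located L M i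
      after-step M i ℓ = record
        { M′ = M′ ; i′ = i′ ; v = v ; Deg-toward = Deg-toward ; Deg-away = Deg-away
        ; error-≤ = λ f le → error-≤ f (error-step (linkR i) M f le)
        ; height-≥ = λ le → height-unstep (linkR i) M (height-≥ le) }
        where open Located ℓ

      after-back : ∀ M i → Located L (backᴹ (aL i) (Link.Poly-a (linkL i)) M) (prev i) → Located L M i
      after-back M i ℓ = record
        { M′ = M′ ; i′ = i′ ; v = v ; Deg-toward = Deg-toward ; Deg-away = Deg-away
        ; error-≤ = λ f le → error-≤ f (error-back (linkL i) M f le)
        ; height-≥ = λ le → height-unback (linkL i) M (height-≥ le) }
        where open Located ℓ

    -- Walking along the line moves the projection of ∞ onto it by 2 at each step.
    locate-right : ∀ n M i {v} → Deg (toward (ξ i) (col M)) v → Deg (away (η i) (col M)) (v ℤ.+ + n) →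
                   Located L M i
    locate-right zero M i {v} dv dy    = stay M i dv dy (inj₁ (ℤₚ.+-identityʳ v))
    -- Steps of length 2 cannot close an odd distance, so the last one overshoots into the case v -
    -- 1.
    locate-right (suc zero) M i {v} dv dy = after-step M i (stay _ (next i)
      (Deg-toward-step (linkR i) dv) (Deg-away-step (linkR i) dy) (inj₂ ≡.refl))
    locate-right (suc (suc n)) M i {v} dv dy = after-step M i (locate-right n _ (next i)
      (Deg-toward-step (linkR i) dv) (Deg-cast (lem v (+ n)) (Deg-away-step (linkR i) dy)))
      where
      lem : ∀ v n → v ℤ.+ (+ 2 ℤ.+ n) ℤ.- + 1 ≡ v ℤ.+ + 1 ℤ.+ n
      lem = ring-ℤ

    locate-left : ∀ n M i {v} → Deg (toward (ξ i) (col M)) v → Deg (away (η i) (col M)) (v ℤ.- + n) →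
                  Located L M i
    locate-left zero M i {v} dv dy       = stay M i dv dy (inj₁ (ℤₚ.+-identityʳ v))
    locate-left (suc zero) M i {v} dv dy = stay M i dv dy (inj₂ ≡.refl)
    locate-left (suc (suc n)) M i {v} dv dy = after-back M i (locate-left n _ (prev i)
      (Deg-toward-back (linkL i) dv) (Deg-cast (lem v (+ n)) (Deg-away-back (linkL i) dy)))
      where
      lem : ∀ v n → v ℤ.- (+ 2 ℤ.+ n) ℤ.+ + 1 ≡ v ℤ.- + 1 ℤ.- n
      lem = ring-ℤ

    locate : ∀ M i {v y} → Deg (toward (ξ i) (col M)) v → Deg (away (η i) (col M)) y → Located L M i
    locate M i {v} {y} dv dy with ≤-or-> v y
    ... | inj₁ (n , ≡.refl) = locate-right n M i dv dy
    ... | inj₂ (n , eq)     = locate-left (suc n) M i dv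
            (Deg-cast (transpose eq) dy)

  Deg-1+small : ∀ {x y} → Le x -1ℤ → Le y -1ℤ → Deg (1# + x * y) (+ 0)
  Deg-1+small p q = Deg-+ Deg-1 (Le-mono (ℤ.-≤- ℕ.z≤n) (Le-* p q))

  module _ {ξ η : Carrier} (ξ≤ : Le ξ -1ℤ) (η≤ : Le η -1ℤ) (u : Point) {v : ℤ}
           (dv : Deg (toward ξ u) v) where

    -- The linear forms `toward ξ` and `away η` have determinant 1 + ξ η, of degree 0, so bounds on
    -- their values give bounds on the coordinates.
    Deg-second : Le (away η u) v → Deg (proj₂ u) v
    Deg-second le = Deg-cancel (Deg-1+small ξ≤ η≤) (Deg-cast (≡.sym (ℤₚ.+-identityʳ v))
      (Deg-resp (lem (proj₁ u) (proj₂ u) ξ η)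
        (Deg-neg (Deg-sub dv (Le-pred-* ξ≤ le)))))
      where
      lem : ∀ x y ξ η → - (x * ξ - y - ξ * (x + y * η)) ≈ y * (1# + ξ * η)
      lem = solve 4 (λ x y ξ η → :- (x :* ξ :- y :- ξ :* (x :+ y :* η)) := y :* (con (+ 1) :+ ξ :* η)) refl

    Le-first : ∀ {w} → v ℤ.- + 1 ℤ.≤ w → Le (away η u) w → Le (proj₁ u) w
    Le-first {w} v≤w le = Le-cancel (Deg-1+small ξ≤ η≤) (Le-cast (≡.sym (ℤₚ.+-identityʳ w))
      (Le-resp (lem (proj₁ u) (proj₂ u) ξ η) (Le-+ le (Le-mono v≤w (Le-pred-* η≤ (proj₁ dv))))))
      where
      lem : ∀ x y ξ η → x + y * η + η * (x * ξ - y) ≈ x * (1# + ξ * η)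
      lem = solve 4 (λ x y ξ η → x :+ y :* η :+ η :* (x :* ξ :- y) := x :* (con (+ 1) :+ ξ :* η)) refl

  -- The determinant of M is X₁ times `toward ξ (col M)` minus p times `toward ξ (act M f)`, where
  -- X₁ is the first coordinate of `act M f`. The last product is small, so the first has degree 0.
  Deg-act-first : ∀ M ξ f {v} → Deg (toward ξ (col M)) v → Le (p M) v →
                  Le (toward ξ (act M f)) (ℤ.- v ℤ.- + 1) → Deg (proj₁ (act M f)) (ℤ.- v)
  Deg-act-first M ξ f {v} dv pv D≤ = Deg-cancel dv (Deg-cast (≡.sym (ℤₚ.+-inverseˡ v))
    (Deg-resp (trans (lem (p M) (r M) (proj₁ (act M f)) (proj₂ (act M f)) ξ (det M)) (modulo 1# (det-act M f)))
      (Deg-+ (Deg-det M) (Le-cast (lem′ v) (Le-* D≤ pv)))))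
    where
    lem : ∀ p r x y ξ d → d + (x * ξ - y) * p ≈ x * (p * ξ - r) + 1# * (x * r - y * p - (- d))
    lem = solve 6 (λ p r x y ξ d → d :+ (x :* ξ :- y) :* p :=
            x :* (p :* ξ :- r) :+ con (+ 1) :* (x :* r :- y :* p :- (:- d))) refl
    lem′ : ∀ v → ℤ.- v ℤ.- + 1 ℤ.+ v ≡ + 0 ℤ.- + 1
    lem′ = ring-ℤ

  Deg-second-from-toward : ∀ {ξ x y m} → Deg ξ -1ℤ → Deg x m → Le (toward ξ (x , y)) (m ℤ.- + 2) →
                           Deg y (m ℤ.- + 1)
  Deg-second-from-toward {ξ} {x} {y} {m} dξ dx le = Deg-resp (x-[x-y]≈y (x * ξ) y)
    (Deg-sub (Deg-* dx dξ) (Le-cast (lem m) le))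
    where
    lem : ∀ m → m ℤ.- + 2 ≡ m ℤ.- + 1 ℤ.- + 1
    lem = ring-ℤ

  second-small : ∀ {ξ x y m} → Deg ξ -1ℤ → Deg x m → Le (toward ξ (x , y)) (m ℤ.- + 1) → Le y (m ℤ.- + 1)
  second-small {ξ} {x} {y} dξ dx le = Le-resp (x-[x-y]≈y (x * ξ) y) (Le-sub (proj₁ (Deg-* dx dξ)) le)

  difference : ∀ {a a′ x x′ y y′} → x * (a + x′) ≈ 1# → y * (a′ + y′) ≈ 1# →
               x - y ≈ x * y * ((a′ - a) + (y′ - x′))
  difference {a} {a′} {x} {x′} {y} {y′} ex ey = trans (lem a a′ x x′ y y′) (trans (modulo y ex) (modulo (- x) ey))
    where
    lem : ∀ a a′ x x′ y y′ → x - y ≈ x * y * ((a′ - a) + (y′ - x′)) + (- x) * (y * (a′ + y′) - 1#) + y * (x * (a + x′) - 1#)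
    lem = solve 6 (λ a a′ x x′ y y′ → x :- y := x :* y :* ((a′ :- a) :+ (y′ :- x′))
            :+ (:- x) :* (y :* (a′ :+ y′) :- con (+ 1)) :+ y :* (x :* (a :+ x′) :- con (+ 1))) refl

  -- Finding the leading coefficient would be an unbounded search. But if no degree existed, every
  -- bound could be lowered and x would vanish.
  Deg-exists : ∀ {x} → ¬ x ≈ 0# → ¬ ¬ ∃ λ m → Deg x m
  Deg-exists {x} x≉0 none with Le-bounded x
  ... | B , x≤B = x≉0 (Le-zero′ {m = B} go)
    where
    lem : ∀ b n → b ℤ.- n ℤ.- + 1 ≡ b ℤ.- (+ 1 ℤ.+ n)
    lem = ring-ℤ
    go : ∀ n → Le x (B ℤ.- + n)
    go zero    = Le-cast (≡.sym (ℤₚ.+-identityʳ B)) x≤B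
    go (suc n) = Le-cast (lem B (+ n)) (Le-stable λ q → none (_ , go n , q))

  module _ (M : Mat) where
    private
      col-nonzero : ¬ (p M ≈ 0# × r M ≈ 0#)
      col-nonzero (p≈0 , r≈0) = ¬Deg-0 (Deg-resp (trans (sym (det-eq M))
        (trans (lem (p M) (q M) (r M) (s M)) (trans (modulo _ r≈0) (modulo _ p≈0)))) (Deg-det M))
        where
        lem : ∀ p q r s → p * s - q * r ≈ 0# + s * (p - 0#) + (- q) * (r - 0#)
        lem = solve 4 (λ p q r s → p :* s :- q :* r := con (+ 0) :+ s :* (p :- con (+ 0)) :+ (:- q) :* (r :- con (+ 0))) refl

    toward-nonzero : ∀ {ξ} → (∀ {p r} → Poly p → Poly r → p * ξ ≈ r → p ≈ 0#) → ¬ toward ξ (col M) ≈ 0#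
    toward-nonzero {ξ} irr e = col-nonzero (p≈0 , trans (lem₂ (p M) (r M) ξ) (trans (modulo _ e) (modulo _ p≈0)))
      where
      lem₁ : ∀ p r ξ → p * ξ ≈ r + 1# * (p * ξ - r - 0#)
      lem₁ = solve 3 (λ p r ξ → p :* ξ := r :+ con (+ 1) :* (p :* ξ :- r :- con (+ 0))) refl
      p≈0 = irr (Poly-p M) (Poly-r M) (trans (lem₁ (p M) (r M) ξ) (modulo _ e))
      lem₂ : ∀ p r ξ → r ≈ 0# + ξ * (p - 0#) + (- 1#) * (p * ξ - r - 0#)
      lem₂ = solve 3 (λ p r ξ → r := con (+ 0) :+ ξ :* (p :- con (+ 0)) :+ (:- con (+ 1)) :* (p :* ξ :- r :- con (+ 0))) refl

    away-nonzero : ∀ {η} → (∀ {p r} → Poly p → Poly r → p * η ≈ r → p ≈ 0#) → ¬ away η (col M) ≈ 0#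
    away-nonzero {η} irr e = col-nonzero (trans (lem₂ (p M) (r M) η) (trans (modulo _ e) (modulo _ r≈0)) , r≈0)
      where
      lem₁ : ∀ p r η → r * η ≈ - p + 1# * (p + r * η - 0#)
      lem₁ = solve 3 (λ p r η → r :* η := :- p :+ con (+ 1) :* (p :+ r :* η :- con (+ 0))) refl
      r≈0 = irr (Poly-r M) (Poly-neg (Poly-p M)) (trans (lem₁ (p M) (r M) η) (modulo _ e))
      lem₂ : ∀ p r η → p ≈ 0# + (- η) * (r - 0#) + 1# * (p + r * η - 0#)
      lem₂ = solve 3 (λ p r η → p := con (+ 0) :+ (:- η) :* (r :- con (+ 0)) :+ con (+ 1) :* (p :+ r :* η :- con (+ 0))) refl

  -- Irrationality of the two ends keeps both linear forms from vanishing at `col M`; their degrees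
  -- then exist up to double negation.
  locate-¬¬ : ∀ L M i → ¬ ¬ Located L M i
  locate-¬¬ L M i none =
    Deg-exists (toward-nonzero M (ξ-irrational i)) λ (_ , dv) →
    Deg-exists (away-nonzero M (η-irrational i)) λ (_ , dy) → none (locate L M i dv dy)
    where open Line L

  module Vertex {L : Line} {M : Mat} {i : Line.Idx L} (loc : Located L M i) where
    open Line L
    open Located loc public

    ξ≤ : Le (ξ i′) -1ℤ
    ξ≤ = proj₁ (Deg-ξ i′)

    η≤ : Le (η i′) -1ℤ
    η≤ = proj₁ (Deg-η i′)

    away≤ : Le (away (η i′) (col M′)) v
    away≤ with Deg-away
    ... | inj₁ dy = proj₁ dy
    ... | inj₂ dy = Le-mono (pred-≤ v) (proj₁ dy)

    Deg-r : Deg (r M′) v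
    Deg-r = Deg-second ξ≤ η≤ (col M′) Deg-toward away≤

    p≤ : Le (p M′) v
    p≤ = Le-first ξ≤ η≤ (col M′) Deg-toward (pred-≤ v) away≤

    height≤ : Le (height M′ (ξ i′) (η i′)) (v ℤ.+ v)
    height≤ = Le-* (proj₁ Deg-toward) away≤

    -- The path from ∞ meets the line at the base vertex, or one step before it.
    cases : ∀ f {m} → Le (error M (ξ i) (η i) f) m →
      Le (toward (ξ i′) (act M′ f)) (m ℤ.- v) ⊎
      (Le (p M′) (v ℤ.- + 1) × Le (toward (ξ i′) (act M′ f)) (m ℤ.- v ℤ.+ + 1))
    cases f {m} le with Deg-away
    ... | inj₁ dy = inj₁ (Le-cancel dy (Le-cast (lem m v) (error-≤ f le)))
      where
      lem : ∀ m v → m ≡ m ℤ.- v ℤ.+ v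
      lem = ring-ℤ
    ... | inj₂ dy = inj₂ (Le-first ξ≤ η≤ (col M′) Deg-toward ℤₚ.≤-refl (proj₁ dy) ,
                          Le-cancel dy (Le-cast (lem m v) (error-≤ f le)))
      where
      lem : ∀ m v → m ≡ m ℤ.- v ℤ.+ + 1 ℤ.+ (v ℤ.- + 1)
      lem = ring-ℤ

    weak-case : ∀ f {m} → Le (error M (ξ i) (η i) f) m → Le (toward (ξ i′) (act M′ f)) (m ℤ.- v ℤ.+ + 1)
    weak-case f le with cases f le
    ... | inj₁ le′       = Le-by 1 ≡.refl le′
    ... | inj₂ (_ , le′) = le′

-- Degrees and irrationality of continued fractions

module Tails (V : ValuedRing) {I : Set} (next : I → I)
  (b : I → ValuedRing.Carrier V) (d : I → ℕ)
  (Poly-b : ∀ i → ValuedRing.Poly V (b i))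
  (Deg-b : ∀ i → ValuedRing.Deg V (b i) (+ suc (d i))) where
  open ValuedRing V
  open Degree V
  open ContinuedFraction V next b d Deg-b public
    using () renaming (x to ζ; x≤ to ζ≤; x-equation to ζ-eq)

  Deg-denominator : ∀ j → Deg (b j + ζ (next j)) (+ suc (d j))
  Deg-denominator j = Deg-+ (Deg-b j) (Le-mono ℤ.-≤+ (ζ≤ (next j)))

  Deg-ζ : ∀ j → Deg (ζ j) (ℤ.- + suc (d j))
  Deg-ζ j = Deg-cancel (Deg-denominator j)
    (Deg-cast (≡.sym (ℤₚ.+-inverseˡ (+ suc (d j)))) (Deg-resp (sym (ζ-eq j)) Deg-1))

  -- Euclid's algorithm on p and p ζ.
  ζ-irrational : ∀ j {p r} → Poly p → Poly r → p * ζ j ≈ r → p ≈ 0#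
  ζ-irrational j {p} {r} Pp Pr e with Le-bounded p
  ... | B , p≤B = go ℤ.∣ B ∣ j Pp Pr (Le-mono (i≤∣i∣ B) p≤B) e
    where
    go : ∀ n j {p r} → Poly p → Poly r → Le p (+ n) → p * ζ j ≈ r → p ≈ 0#
    expand : ∀ j {p r} → p * ζ j ≈ r → p ≈ r * (b j + ζ (next j))
    expand j {p} {r} e = sym (trans (*-congʳ (sym e)) (trans (*-assoc _ _ _) (trans (*-congˡ (ζ-eq j)) (*-identityʳ p))))
    r≤ : ∀ n j {p r} → Le p (+ n) → p * ζ j ≈ r → Le r (+ n ℤ.- + 1)
    r≤ n j pn e = Le-resp (trans (*-comm _ _) e) (Le-pred-* (ζ≤ j) pn)
    go zero j Pp Pr pn e = trans (expand j e) (trans (*-congʳ (Poly-zero Pr (r≤ 0 j pn e))) (zeroˡ _))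
    go (suc n) j {p} {r} Pp Pr pn e = trans (expand j e) (trans (*-congʳ r≈0) (zeroˡ _))
      where
      lem : ∀ r b z → r * z ≈ r * (b + z) - b * r
      lem = solve 3 (λ r b z → r :* z := r :* (b :+ z) :- b :* r) refl
      r≈0 : r ≈ 0#
      r≈0 = go n (next j) Pr (Poly-sub Pp (Poly-* (Poly-b j) Pr)) (r≤ (suc n) j pn e)
        (trans (lem r (b j) (ζ (next j))) (+-congʳ (sym (expand j e))))

-- Recovering partial quotients from a polynomial matrix

module Expansion (V : ValuedRing)
  (b : ℕ → ValuedRing.Carrier V) (d : ℕ → ℕ)
  (Poly-b : ∀ i → ValuedRing.Poly V (b i))
  (Deg-b : ∀ i → ValuedRing.Deg V (b i) (+ suc (d i))) where
  open ValuedRing V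
  open Degree V
  open Geodesic V
  open Mat
  open Tails V suc b d Poly-b Deg-b public

  Unit : Carrier → Set
  Unit u = Poly u × Deg u (+ 0)

  -- The matrices are determined only up to constants, so a tail is recovered up to a unit; along
  -- the expansion this unit is alternately `u` and its inverse.
  Tail : Point → ℕ → Set
  Tail (x , y) j = ∃ λ u → Unit u × y ≈ u * (x * ζ j)

  -- The product of `M` with the matrix of rows (0, 1) and (1, b j), which sends ζ (j + 1) to ζ j.
  absorb : Mat → ℕ → Mat
  absorb M j = record
    { p = q M ; q = p M + q M * b j ; r = s M ; s = r M + s M * b j
    ; Poly-p = Poly-q M ; Poly-q = Poly-+ (Poly-p M) (Poly-* (Poly-q M) (Poly-b j))
    ; Poly-r = Poly-s M ; Poly-s = Poly-+ (Poly-r M) (Poly-* (Poly-s M) (Poly-b j))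
    ; det = - det M ; Deg-det = Deg-neg (Deg-det M)
    ; det-eq = trans (lem (b j) (p M) (q M) (r M) (s M)) (-‿cong (det-eq M)) }
    where
    lem : ∀ b p q r s → q * (r + s * b) - (p + q * b) * s ≈ - (p * s - q * r)
    lem = solve 5 (λ b p q r s → q :* (r :+ s :* b) :- (p :+ q :* b) :* s := :- (p :* s :- q :* r)) refl

  private
    act-absorb : ∀ p q j → q * ζ (suc j) + (p + q * b j) ≈ (p * ζ j + q) * (b j + ζ (suc j))
    act-absorb p q j = sym (trans (lem p q (b j) (ζ j) (ζ (suc j))) (modulo p (ζ-eq j)))
      where
      lem : ∀ p q b z z′ → (p * z + q) * (b + z′) ≈ q * z′ + (p + q * b) + p * (z * (b + z′) - 1#)
      lem = solve 5 (λ p q b z z′ → (p :* z :+ q) :* (b :+ z′) :=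
              q :* z′ :+ (p :+ q :* b) :+ p :* (z :* (b :+ z′) :- con (+ 1))) refl

  -- A polynomial matrix that puts the path from ∞ to ζ j through the base vertex
  -- is, up to a unit, a product of elementary matrices of the expansion of ζ j.
  aligned⇒tail : ∀ M j {v} → Deg (r M) v → Le (p M) (v ℤ.- + 1) → Le (proj₂ (act M (ζ j))) (ℤ.- v ℤ.- + 1) →
                 ∃ λ k → Tail (act M (ζ j)) k
  aligned⇒tail M j {v} dr pv X₂≤ with ≤⇒+ (Poly-Deg-≥0 (Poly-r M) dr)
  ... | n , eq = go n M j (ℤₚ.≤-reflexive (≡.trans eq (ℤₚ.+-identityˡ (+ n)))) dr pv X₂≤
    where
    go : ∀ n M j {v} → v ℤ.≤ + n → Deg (r M) v → Le (p M) (v ℤ.- + 1) →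
         Le (proj₂ (act M (ζ j))) (ℤ.- v ℤ.- + 1) → ∃ λ k → Tail (act M (ζ j)) k
    go n M j {v} v≤n dr pv X₂≤ with ≤-or-> (+ 0) (v ℤ.- + suc (d j)) | Poly-Deg-≥0 (Poly-r M) dr
    -- End of the recursion: r ζ j has negative degree, so the polynomial s is small, hence zero.
    -- The determinant then makes q and r units, and p vanishes.
    ... | inj₂ (k , eq) | 0≤v = j , r M * w , (Poly-* (Poly-r M) Pw , Deg-* (Deg-cast v≡0 dr) dw) , X₂-eq
      where
      open Relation.Binary.Reasoning.Setoid setoid
      lem₂ : ∀ v → ℤ.- + 1 ℤ.+ + 0 ≡ ℤ.- v ℤ.- + 1 ℤ.+ v ℤ.+ + 0
      lem₂ = ring-ℤ
      lem₃ : ∀ d k → ℤ.- + 1 ℤ.+ (d ℤ.+ (+ 1 ℤ.+ k)) ≡ d ℤ.+ k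
      lem₃ = ring-ℤ
      rζ≤ : v ℤ.- + suc (d j) ℤ.≤ ℤ.- + 1
      rζ≤ = ≤-by k (≡.trans (≡.sym (ℤₚ.+-identityʳ -1ℤ))
              (≡.trans (≡.cong (λ z → ℤ.- + 1 ℤ.+ z) eq) (lem₃ (v ℤ.- + suc (d j)) (+ k))))
      s≈0 : s M ≈ 0#
      s≈0 = Poly-zero (Poly-s M) (Le-resp (x+y-x≈y (r M * ζ j) (s M))
        (Le-sub (Le-mono (lin₁ 0 0≤v (lem₂ v)) X₂≤) (Le-mono rζ≤ (proj₁ (Deg-* dr (Deg-ζ j))))))
      lem₄ : ∀ p q r s → - (p * s - q * r) ≈ q * r + (- p) * (s - 0#)
      lem₄ = solve 4 (λ p q r s → :- (p :* s :- q :* r) := q :* r :+ (:- p) :* (s :- con (+ 0))) refl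
      dq : Deg (q M) (ℤ.- v)
      dq = Deg-cancel dr (Deg-cast (≡.sym (ℤₚ.+-inverseˡ v)) (Deg-resp
        (trans (-‿cong (sym (det-eq M))) (trans (lem₄ (p M) (q M) (r M) (s M)) (modulo (- p M) s≈0)))
        (Deg-neg (Deg-det M))))
      v≡0 : v ≡ + 0
      v≡0 = ℤₚ.≤-antisym (ℤₚ.neg-cancel-≤ (Poly-Deg-≥0 (Poly-q M) dq)) 0≤v
      p≈0 : p M ≈ 0#
      p≈0 = Poly-zero (Poly-p M) (Le-cast (≡.cong (ℤ._- + 1) v≡0) pv)
      inv = unit (Poly-q M) (Deg-cast (≡.cong ℤ.-_ v≡0) dq)
      w = proj₁ inv
      Pw = proj₁ (proj₂ inv)
      dw = proj₁ (proj₂ (proj₂ inv))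
      qw = proj₂ (proj₂ (proj₂ inv))
      lem₅ : ∀ p q r s w z → r * z + s ≈ r * w * ((p * z + q) * z) + 1# * (s - 0#)
             + (- (r * w * z * z)) * (p - 0#) + (- (r * z)) * (q * w - 1#)
      lem₅ = solve 6 (λ p q r s w z → r :* z :+ s := r :* w :* ((p :* z :+ q) :* z) :+ con (+ 1) :* (s :- con (+ 0))
             :+ (:- (r :* w :* z :* z)) :* (p :- con (+ 0)) :+ (:- (r :* z)) :* (q :* w :- con (+ 1))) refl
      X₂-eq : proj₂ (act M (ζ j)) ≈ r M * w * (proj₁ (act M (ζ j)) * ζ j)
      X₂-eq = trans (lem₅ (p M) (q M) (r M) (s M) w (ζ j))
        (trans (modulo _ qw) (trans (modulo _ p≈0) (modulo 1# s≈0)))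
    go zero M j {v} v≤n dr pv X₂≤ | inj₁ (k , eq) | 0≤v = ⊥-elim (1≰0 (ℤₚ.≤-trans v≡ v≤n))
      where
      lem : ∀ v e k → v ℤ.+ + 0 ≡ + 1 ℤ.+ (v ℤ.- (+ 1 ℤ.+ e)) ℤ.+ e
      lem = ring-ℤ
      v≡ : + 1 ℤ.≤ v
      v≡ = lin₁ (d j) (≤-by k eq) (lem v (+ d j) (+ k))
    -- Since r ζ j + s is small, s has the degree of r ζ j. Thus `absorb` lowers the degree of r by
    -- that of b j, and the determinant bounds the new p.
    go (suc n) M j {v} v≤n dr pv X₂≤ | inj₁ (k , eq) | 0≤v = result (go n (absorb M j) (suc j) smaller ds qs X₂′≤)
      where
      0≤ds = ≤-by {+ 0} k eq
      lem₂ : ∀ v d → v ℤ.- (+ 1 ℤ.+ d) ℤ.- + 1 ℤ.+ (+ 0 ℤ.+ + 0) ≡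
                     ℤ.- v ℤ.- + 1 ℤ.+ (v ℤ.+ (v ℤ.- (+ 1 ℤ.+ d))) ℤ.+ + 0
      lem₂ = ring-ℤ
      ds : Deg (s M) (v ℤ.- + suc (d j))
      ds = Deg-resp (x+y-x≈y (r M * ζ j) (s M)) (Deg-resp (+-comm _ _) (Deg-+ (Deg-neg (Deg-* dr (Deg-ζ j)))
        (Le-mono (lin₂ 0 0≤v 0≤ds (lem₂ v (+ d j))) X₂≤)))
      lem₃ : ∀ n v d → n ℤ.+ v ≡ v ℤ.- (+ 1 ℤ.+ d) ℤ.+ (+ 1 ℤ.+ n) ℤ.+ d
      lem₃ = ring-ℤ
      smaller : v ℤ.- + suc (d j) ℤ.≤ + n
      smaller = lin₁ (d j) v≤n (lem₃ (+ n) v (+ d j))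
      lem₄ : ∀ v d → v ℤ.- (+ 1 ℤ.+ d) ℤ.- + 1 ℤ.+ v ℤ.+ (+ 0 ℤ.+ + 0) ≡
                   + 0 ℤ.+ ((v ℤ.- (+ 1 ℤ.+ d)) ℤ.+ (v ℤ.- (+ 1 ℤ.+ d))) ℤ.+ d
      lem₄ = ring-ℤ
      lem₅ : ∀ v s → v ℤ.- + 1 ℤ.+ s ≡ s ℤ.- + 1 ℤ.+ v
      lem₅ = ring-ℤ
      lem₆ : ∀ p q r s d → p * s - d ≈ q * r + 1# * (p * s - q * r - d)
      lem₆ = solve 5 (λ p q r s d → p :* s :- d := q :* r :+ con (+ 1) :* (p :* s :- q :* r :- d)) refl
      qs : Le (q M) (v ℤ.- + suc (d j) ℤ.- + 1)
      qs = Le-cancel dr (Le-resp (trans (lem₆ (p M) (q M) (r M) (s M) (det M)) (modulo 1# (det-eq M)))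
        (Le-sub (Le-cast (lem₅ v (v ℤ.- + suc (d j))) (Le-* pv (proj₁ ds)))
                (Le-mono (lin₂ (d j) 0≤ds 0≤ds (lem₄ v (+ d j))) (proj₁ (Deg-det M)))))
      lem₇ : ∀ v d → ℤ.- v ℤ.- + 1 ℤ.+ (+ 1 ℤ.+ d) ≡ ℤ.- (v ℤ.- (+ 1 ℤ.+ d)) ℤ.- + 1
      lem₇ = ring-ℤ
      X₂′≤ : Le (proj₂ (act (absorb M j) (ζ (suc j)))) (ℤ.- (v ℤ.- + suc (d j)) ℤ.- + 1)
      X₂′≤ = Le-resp (sym (act-absorb (r M) (s M) j))
        (Le-cast (lem₇ v (+ d j)) (Le-* X₂≤ (proj₁ (Deg-denominator j))))
      lem₈ : ∀ x y u z c → (y - u * (x * z)) * c ≈ y * c - u * (x * c * z)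
      lem₈ = solve 5 (λ x y u z c → (y :- u :* (x :* z)) :* c := y :* c :- u :* (x :* c :* z)) refl
      lem₉ : ∀ x y → x ≈ y + 1# * (x - y - 0#)
      lem₉ = solve 2 (λ x y → x := y :+ con (+ 1) :* (x :- y :- con (+ 0))) refl
      result : ∃ (λ k → Tail (act (absorb M j) (ζ (suc j))) k) → ∃ λ k → Tail (act M (ζ j)) k
      result (k , u , Uu , e) = k , u , Uu , trans (lem₉ _ _) (modulo 1# (*-cancel (Deg-denominator j)
        (trans (lem₈ (proj₁ (act M (ζ j))) (proj₂ (act M (ζ j))) u (ζ k) (b j + ζ (suc j)))
          (trans (+-cong (trans (sym (act-absorb (r M) (s M) j)) e)
                         (-‿cong (*-congˡ (*-congʳ (sym (act-absorb (p M) (q M) j))))))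
                 (-‿inverseʳ _)))))

  tail-letter-degree : ∀ {x y c m} j → Deg x m → Deg y (m ℤ.- + 1) → Poly c → Le c (+ 0) →
                       Tail (x - c * y , y) j → d j ≡ 0
  tail-letter-degree {x} {y} {c} {m} j dx dy Pc c≤ (u , (Pu , du) , e) =
    ℕₚ.+-cancelˡ-≡ 1 _ _ (ℤₚ.+-injective (ℤₚ.neg-injective (ℤᵍ.∙-cancelˡ m _ _
      (≡.trans (≡.sym (ℤₚ.+-identityˡ _)) (Deg-unique
        (Deg-* du (Deg-* (Deg-sub dx (Le-0-* c≤ (proj₁ dy))) (Deg-ζ j))) (Deg-resp e dy))))))

  -- The polynomials b j and u (a - c) are both the polynomial part of the same quotient: their
  -- difference has negative degree.
  tail-step : ∀ {x y c a m} j → Poly c → Poly a → Deg y m → Le (x - a * y) (m ℤ.- + 1) →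
              ((u , _) : Tail (x - c * y , y) j) →
              Tail (y , x - a * y) (suc j) × b j ≈ u * (a - c)
  tail-step {x} {y} {c} {a} {m} j Pc Pa dy le (u , (Pu , du) , e) =
    (w , (Pw , dw) , second) , trans (lem₅ (b j) _) (modulo 1# h≈0)
    where
    h = b j - u * (a - c)
    inv = unit Pu du
    w = proj₁ inv
    Pw = proj₁ (proj₂ inv)
    dw = proj₁ (proj₂ (proj₂ inv))
    uw = proj₂ (proj₂ (proj₂ inv))
    lem₁ : ∀ x y c a u b z z′ → y * (b - u * (a - c) + z′) ≈ u * (x - a * y)
           + (b + z′) * (y - u * ((x - c * y) * z)) + u * (x - c * y) * (z * (b + z′) - 1#)
    lem₁ = solve 8 (λ x y c a u b z z′ → y :* (b :- u :* (a :- c) :+ z′) := u :* (x :- a :* y)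
           :+ (b :+ z′) :* (y :- u :* ((x :- c :* y) :* z)) :+ u :* (x :- c :* y) :* (z :* (b :+ z′) :- con (+ 1))) refl
    key : y * (h + ζ (suc j)) ≈ u * (x - a * y)
    key = trans (lem₁ x y c a u (b j) (ζ j) (ζ (suc j))) (trans (modulo _ (ζ-eq j)) (modulo _ e))
    lem₂ : ∀ y h z → y * (h + z) - y * z ≈ h * y
    lem₂ = solve 3 (λ y h z → y :* (h :+ z) :- y :* z := h :* y) refl
    lem₃ : ∀ m → m ℤ.- + 1 ≡ ℤ.- + 1 ℤ.+ m
    lem₃ = ring-ℤ
    h≈0 : h ≈ 0#
    h≈0 = Poly-zero (Poly-sub (Poly-b j) (Poly-* Pu (Poly-sub Pa Pc))) (Le-cancel dy (Le-cast (lem₃ m)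
      (Le-resp (lem₂ y h (ζ (suc j))) (Le-sub (Le-resp (sym key) (Le-0-* (proj₁ du) le))
        (Le-* (proj₁ dy) (ζ≤ (suc j)))))))
    lem₄ : ∀ x y u w h z → x ≈ w * (y * z) + (- w) * (y * (h + z) - u * x) + w * y * (h - 0#) + (- x) * (u * w - 1#)
    lem₄ = solve 6 (λ x y u w h z → x := w :* (y :* z) :+ (:- w) :* (y :* (h :+ z) :- u :* x)
             :+ w :* y :* (h :- con (+ 0)) :+ (:- x) :* (u :* w :- con (+ 1))) refl
    second : x - a * y ≈ w * (y * ζ (suc j))
    second = trans (lem₄ (x - a * y) y u w h (ζ (suc j))) (trans (modulo _ uw) (trans (modulo _ h≈0) (modulo _ key)))
    lem₅ : ∀ b c → b ≈ c + 1# * (b - c - 0#)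
    lem₅ = solve 2 (λ b c → b := c :+ con (+ 1) :* (b :- c :- con (+ 0))) refl

  module Along (L : Line) where
    open Line L

    Tail-minus-0 : ∀ {x y j} → Tail (x , y) j → Tail (x - 0# * y , y) j
    Tail-minus-0 {x} {y} {j} (u , Uu , e) = u , Uu , trans e (lem x y u (ζ j))
      where
      lem : ∀ x y u z → u * (x * z) ≈ u * ((x - 0# * y) * z)
      lem = solve 4 (λ x y u z → u :* (x :* z) := u :* ((x :- con (+ 0) :* y) :* z)) refl

    -- The constant `c` changes only the first letter, and not its degree; the recursive calls have
    -- c = 0.
    common-letters-linear : ∀ k {x y c m} i j → Deg x m → Poly c → Le c (+ 0) →
      Le (toward (ξ i) (x , y)) (m ℤ.- + suc k ℤ.- + suc k) → Tail (x - c * y , y) j →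
      ∀ t → t ℕ.≤ k → d (j ℕ.+ t) ≡ 0
    common-letters-linear k {x} {y} {c} {m} i j dx Pc c≤ le τ zero t≤k =
      ≡.subst (λ z → d z ≡ 0) (≡.sym (ℕₚ.+-identityʳ j)) (tail-letter-degree j dx
        (Deg-second-from-toward (Deg-ξ i) dx (Le-by (k ℕ.+ k) (two-below m (+ k)) le)) Pc c≤ τ)
    common-letters-linear (suc k) {x} {y} {c} {m} i j dx Pc c≤ le τ (suc t) (ℕ.s≤s t≤k) =
      ≡.subst (λ z → d z ≡ 0) (≡.sym (ℕₚ.+-suc j t))
        (common-letters-linear k (next i) (suc j) dy Poly-0 Le-0 le′ (Tail-minus-0 τ′) t t≤k)
      where
      l = linkR i
      dy : Deg y (m ℤ.- + 1)
      dy = Deg-second-from-toward (Deg-ξ i) dx (Le-by (suc k ℕ.+ suc k) (two-below m (+ suc k)) le)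
      le′ : Le (toward (ξ (next i)) (step (aR i) (x , y))) (m ℤ.- + 1 ℤ.- + suc k ℤ.- + suc k)
      le′ = Le-cast (one-letter-less m (+ suc k)) (Le-toward-step l le)
      τ′ = proj₁ (tail-step j Pc (Link.Poly-a l) dy
        (proj₁ (Deg-second-from-toward (Deg-ξ (next i)) dy (Le-by (k ℕ.+ k) (two-below (m ℤ.- + 1) (+ k)) le′))) τ)

    common-letters : ∀ k {x y m} i j → Deg x m →
      Le (toward (ξ i) (x , y)) (m ℤ.- + k ℤ.- + k ℤ.- + 1) → Tail (x , y) j →
      ∀ t → t ℕ.< k → ∃ λ u → Unit u × b (j ℕ.+ t) ≈ u * aR (nexts t i)
    common-letters (suc k) {x} {y} {m} i j dx le τ = λ where
        zero t<k            → proj₁ τ , proj₁ (proj₂ τ) ,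
                              ≡.subst (λ z → b z ≈ proj₁ τ * aR i) (≡.sym (ℕₚ.+-identityʳ j)) (trans (proj₂ τ′) (*-congˡ (x-0≈x (aR i))))
        (suc t) (ℕ.s≤s t<k) → ≡.subst (λ z → ∃ λ u → Unit u × b z ≈ u * aR (nexts t (next i))) (≡.sym (ℕₚ.+-suc j t))
                              (common-letters k (next i) (suc j) dy le′ (proj₁ τ′) t t<k)
      where
      l = linkR i
      lem₁ : ∀ m k → m ℤ.- + 2 ≡ m ℤ.- (+ 1 ℤ.+ k) ℤ.- (+ 1 ℤ.+ k) ℤ.- + 1 ℤ.+ (k ℤ.+ (k ℤ.+ + 1))
      lem₁ = ring-ℤ
      lem₂ : ∀ m k → m ℤ.- (+ 1 ℤ.+ k) ℤ.- (+ 1 ℤ.+ k) ℤ.- + 1 ℤ.+ + 1 ≡ m ℤ.- + 1 ℤ.- k ℤ.- k ℤ.- + 1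
      lem₂ = ring-ℤ
      lem₃ : ∀ m k → m ℤ.- + 1 ≡ m ℤ.- k ℤ.- k ℤ.- + 1 ℤ.+ (k ℤ.+ k)
      lem₃ = ring-ℤ
      dy : Deg y (m ℤ.- + 1)
      dy = Deg-second-from-toward (Deg-ξ i) dx (Le-by (k ℕ.+ (k ℕ.+ 1)) (lem₁ m (+ k)) le)
      le′ : Le (toward (ξ (next i)) (step (aR i) (x , y))) (m ℤ.- + 1 ℤ.- + k ℤ.- + k ℤ.- + 1)
      le′ = Le-cast (lem₂ m (+ k)) (Le-toward-step l le)
      τ′ = tail-step j Poly-0 (Link.Poly-a l) dy
        (second-small (Deg-ξ (next i)) dy (Le-by (k ℕ.+ k) (lem₃ (m ℤ.- + 1) (+ k)) le′)) (Tail-minus-0 τ)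

-- Upper bounds for overlaps

module UpperBounds (V : ValuedRing)
  (b : ℕ → ValuedRing.Carrier V) (d : ℕ → ℕ)
  (Poly-b : ∀ i → ValuedRing.Poly V (b i))
  (Deg-b : ∀ i → ValuedRing.Deg V (b i) (+ suc (d i)))
  (L : Geodesic.Line V) where
  open ValuedRing V
  open Degree V
  open Geodesic V
  open Mat
  open Expansion V b d Poly-b Deg-b
  open Line L
  open Along L

  private
    f = ζ 0

  Tail-cong : ∀ {x x′ y j} → x ≈ x′ → Tail (x , y) j → Tail (x′ , y) j
  Tail-cong e (u , Uu , e′) = u , Uu , trans e′ (*-congˡ (*-congʳ e))

  -- Translation by the constant `c` fixes the base vertex and turns the edge by which the path from
  -- ∞ arrives into the one that `aligned⇒tail` demands.
  linear-run : ∀ k M i {v} → Deg (toward (ξ i) (col M)) v → Deg (r M) v → Le (p M) v →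
    Le (toward (ξ i) (act M f)) (ℤ.- v ℤ.- + suc k ℤ.- + suc k) → ∃ λ j → ∀ t → t ℕ.≤ k → d (j ℕ.+ t) ≡ 0
  linear-run k M i {v} dv dr p≤v le = _ ,
    common-letters-linear k i _ dX₁ Pc c≤ le (Tail-cong (act-translate c Pc M f) (proj₂ tail))
    where
    lem₁ : ∀ v k → ℤ.- v ℤ.- + 1 ≡ ℤ.- v ℤ.- (+ 1 ℤ.+ k) ℤ.- (+ 1 ℤ.+ k) ℤ.+ (k ℤ.+ (k ℤ.+ + 1))
    lem₁ = ring-ℤ
    lem₂ : ∀ v k → ℤ.- v ℤ.- + 2 ≡ ℤ.- v ℤ.- (+ 1 ℤ.+ k) ℤ.- (+ 1 ℤ.+ k) ℤ.+ (k ℤ.+ k)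
    lem₂ = ring-ℤ
    dX₁ : Deg (proj₁ (act M f)) (ℤ.- v)
    dX₁ = Deg-act-first M (ξ i) f dv p≤v (Le-by (k ℕ.+ (k ℕ.+ 1)) (lem₁ v (+ k)) le)
    dX₂ : Deg (proj₂ (act M f)) (ℤ.- v ℤ.- + 1)
    dX₂ = Deg-second-from-toward (Deg-ξ i) dX₁ (Le-by (k ℕ.+ k) (lem₂ v (+ k)) le)
    res = residue dr p≤v
    c = proj₁ res
    Pc = proj₁ (proj₂ res)
    c≤ = proj₁ (proj₂ (proj₂ res))
    tail = aligned⇒tail (translate c Pc M) 0 dr (proj₂ (proj₂ (proj₂ res))) (proj₁ dX₂)

  -- An overlap longer than 2T + 2 would spell T + 1 consecutive linear partial quotients of f,
  -- whichever of its two possible positions it has.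
  error-even : ∀ T → (∀ j → ∃ λ t → t ℕ.≤ T × ¬ d (j ℕ.+ t) ≡ 0) →
               ∀ M i → ¬ Le (error M (ξ i) (η i) f) (ℤ.- + suc T ℤ.- + suc T ℤ.- + 1)
  error-even T big M i le = locate-¬¬ L M i λ loc →
    let open Vertex loc
        (j , linear) = linear-run T M′ i′ Deg-toward Deg-r p≤ (Le-cast (lem v (+ T)) (weak-case f le))
        (t , t≤T , d≢0) = big j
    in d≢0 (linear t t≤T)
    where
    lem : ∀ v T → ℤ.- (+ 1 ℤ.+ T) ℤ.- (+ 1 ℤ.+ T) ℤ.- + 1 ℤ.- v ℤ.+ + 1 ≡ ℤ.- v ℤ.- (+ 1 ℤ.+ T) ℤ.- (+ 1 ℤ.+ T)
    lem = ring-ℤ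

  -- Let the overlap have length at least 2T + 2. If ∞ projects to the base vertex, it spells T + 1
  -- linear quotients. If ∞ projects to the vertex before, the arriving edge is already aligned, and
  -- T quotients agree with the line up to units, without any change by constants.
  error-odd : ∀ T → (∀ j → ∃ λ t → t ℕ.≤ T × ¬ d (j ℕ.+ t) ≡ 0) →
              (∀ j i → ¬ (∀ t → t ℕ.< T → d (j ℕ.+ t) ≡ 0 × ∃ λ u → Unit u × b (j ℕ.+ t) ≈ u * aR (nexts t i))) →
              ∀ M i → ¬ Le (error M (ξ i) (η i) f) (ℤ.- + suc T ℤ.- + suc T)
  error-odd T big mismatch M i le = locate-¬¬ L M i go
    where
    lem₁ : ∀ v T → ℤ.- (+ 1 ℤ.+ T) ℤ.- (+ 1 ℤ.+ T) ℤ.- v ≡ ℤ.- v ℤ.- (+ 1 ℤ.+ T) ℤ.- (+ 1 ℤ.+ T)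
    lem₁ = ring-ℤ
    lem₂ : ∀ v T → ℤ.- (+ 1 ℤ.+ T) ℤ.- (+ 1 ℤ.+ T) ℤ.- v ℤ.+ + 1 ≡ ℤ.- v ℤ.- T ℤ.- T ℤ.- + 1
    lem₂ = ring-ℤ
    lem₃ : ∀ v T → ℤ.- v ℤ.- + 1 ≡ ℤ.- v ℤ.- T ℤ.- T ℤ.- + 1 ℤ.+ (T ℤ.+ T)
    lem₃ = ring-ℤ
    go : ¬ Located L M i
    go loc = case (cases f le)
      where
      open Vertex loc
      case : ¬ (Le (toward (ξ i′) (act M′ f)) _ ⊎ (Le (p M′) (v ℤ.- + 1) × Le (toward (ξ i′) (act M′ f)) _))
      case (inj₁ le′) =
        let (j , linear) = linear-run T M′ i′ Deg-toward Deg-r p≤ (Le-cast (lem₁ v (+ T)) le′)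
            (t , t≤T , d≢0) = big j
        in d≢0 (linear t t≤T)
      case (inj₂ (p< , le′)) = mismatch j i′ λ t t<T →
        let (u , (Pu , du) , e) = common-letters T i′ j dX₁ le″ τ t t<T
        in ℕₚ.suc-injective (ℤₚ.+-injective (Deg-unique (Deg-b (j ℕ.+ t))
             (Deg-resp (sym e) (Deg-* du (Link.Deg-a (linkR (nexts t i′))))))) , u , (Pu , du) , e
        where
        le″ : Le (toward (ξ i′) (act M′ f)) (ℤ.- v ℤ.- + T ℤ.- + T ℤ.- + 1)
        le″ = Le-cast (lem₂ v (+ T)) le′
        D≤ : Le (toward (ξ i′) (act M′ f)) (ℤ.- v ℤ.- + 1)
        D≤ = Le-by (T ℕ.+ T) (lem₃ v (+ T)) le″
        dX₁ = Deg-act-first M′ (ξ i′) f Deg-toward p≤ D≤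
        tail = aligned⇒tail M′ 0 Deg-r p< (second-small (Deg-ξ i′) dX₁ D≤)
        j = proj₁ tail
        τ = proj₂ tail

-- Prolonging odd overlaps, and the maximum of the spectrum

module Gap (V : ValuedRing) where
  open ValuedRing V
  open Degree V
  open Geodesic V
  open Mat

  run : List Carrier → Point → Point
  run [] u       = u
  run (b ∷ bs) u = run bs (step b u)

  run-cong : ∀ bs {u u′} → u ≈ₚ u′ → run bs u ≈ₚ run bs u′
  run-cong [] e             = e
  run-cong (b ∷ bs) (e , e′) = run-cong bs (e′ , +-cong e (-‿cong (*-congˡ e′)))

  Linear : List Carrier → Set
  Linear []       = ⊤
  Linear (b ∷ bs) = (Poly b × Deg b (+ 1)) × Linear bs

  module Spelling (L : Line) where
    open Line L

    Spells : List Carrier → Idx → Set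
    Spells [] i       = ⊤
    Spells (b ∷ bs) i = b ≈ aR i × Spells bs (next i)

    toward-run : ∀ bs i {x y w} → Spells bs i → Le (proj₁ (run bs (x , y))) w →
      Le (proj₂ (run bs (x , y))) (w ℤ.- + 1) → Le (toward (ξ i) (x , y)) (w ℤ.- + 1 ℤ.- + length bs)
    toward-run [] i {w = w} _ P≤ Q≤ = Le-cast (≡.sym (ℤₚ.+-identityʳ _))
      (Le-sub (Le-* P≤ (proj₁ (Deg-ξ i))) Q≤)
    toward-run (b ∷ bs) i {x} {y} {w} (b≈a , sp) P≤ Q≤ = Le-cast (lem w (+ length bs))
      (Le-toward-unstep (linkR i) (Le-resp (toward-cong (ξ (next i)) {step b (x , y)} {step (aR i) (x , y)}
        (refl , +-congˡ (-‿cong (*-congʳ b≈a)))) (toward-run bs (next i) sp P≤ Q≤)))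
      where
      lem : ∀ w n → w ℤ.- + 1 ℤ.- n ℤ.- + 1 ≡ w ℤ.- + 1 ℤ.- (+ 1 ℤ.+ n)
      lem = ring-ℤ

    -- Every short word occurs in two places with different pasts, so that a path
    -- from ∞ cannot follow the line for long before the word in both places.
    Rich : ℕ → Set
    Rich n = ∀ bs → length bs ℕ.≤ n → Linear bs →
             ∃₂ λ j₁ j₂ → Spells bs j₁ × Spells bs j₂ × Deg (η j₁ - η j₂) (ℤ.- + 4)

    -- If both heights were small, so would be p + r η at both places, but these values differ by r
    -- (η j₁ - η j₂), of degree v - 4.
    height-split : ∀ M {v h j₁ j₂} → Deg (r M) v → Le (p M) (v ℤ.- + 1) → Deg (η j₁ - η j₂) (ℤ.- + 4) →
      Le (height M (ξ j₁) (η j₁)) h → Le (height M (ξ j₂) (η j₂)) h → v ℤ.+ v ℤ.≤ h ℤ.+ + 4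
    height-split M {v} {h} {j₁} {j₂} dr p< dη h₁ h₂ = lin₁ 0
      (Deg-≤ (Deg-* dr dη) (Le-resp (lem₁ (p M) (r M) (η j₁) (η j₂)) (Le-sub (away≤ j₁ h₁) (away≤ j₂ h₂)))) (lem₂ v h)
      where
      lem₁ : ∀ p r x y → p + r * x - (p + r * y) ≈ r * (x - y)
      lem₁ = solve 4 (λ p r x y → p :+ r :* x :- (p :+ r :* y) := r :* (x :- y)) refl
      lem₂ : ∀ v h → h ℤ.+ + 4 ℤ.+ (v ℤ.+ ℤ.- + 4) ≡ v ℤ.+ v ℤ.+ (h ℤ.- v) ℤ.+ + 0
      lem₂ = ring-ℤ
      lem₄ : ∀ h v → h ≡ h ℤ.- v ℤ.+ v
      lem₄ = ring-ℤ
      lem₅ : ∀ v → v ℤ.- + 1 ≡ v ℤ.- + 1 ℤ.+ ℤ.- + 1 ℤ.+ + 1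
      lem₅ = ring-ℤ
      Deg-V : ∀ j → Deg (toward (ξ j) (col M)) v
      Deg-V j = Deg-resp (+-comm _ _) (Deg-+ (Deg-neg dr) (Le-by 1 (lem₅ v) (Le-* p< (proj₁ (Deg-ξ j)))))
      away≤ : ∀ j → Le (height M (ξ j) (η j)) h → Le (away (η j) (col M)) (h ℤ.- v)
      away≤ j le = Le-cancel (Deg-V j) (Le-cast (lem₄ h v) (Le-resp (*-comm _ _) le))

    -- Either occurrence of `bs` can be laid along the path from ∞ to f, starting at the base
    -- vertex. The overlap is 2k for the letters and one edge at each end, as all directions are
    -- aligned. If both geodesics are shallow, v is bounded.
    place : ∀ {n} → Rich n → ∀ f {h} bs k → length bs ≡ k → k ℕ.≤ n → Linear bs →
      ∀ M {v} → Deg (r M) v → Le (p M) (v ℤ.- + 1) →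
      Le (proj₁ (run bs (act M f))) (ℤ.- v ℤ.- + k) → Le (proj₂ (run bs (act M f))) (ℤ.- v ℤ.- + k ℤ.- + 1) →
      (∀ N j → Le (error N (ξ j) (η j) f) (ℤ.- + k ℤ.- + k ℤ.- + 2) → Le (height N (ξ j) (η j)) h) →
      v ℤ.+ v ℤ.≤ h ℤ.+ + 4
    place rich f bs k ≡.refl len lin M {v} dr p< P≤ Q≤ shallow =
      let (j₁ , j₂ , sp₁ , sp₂ , dη) = rich bs len lin
      in height-split M dr p< dη (shallow M j₁ (error≤ j₁ sp₁)) (shallow M j₂ (error≤ j₂ sp₂))
      where
      lem : ∀ v n → ℤ.- v ℤ.- n ℤ.- + 1 ℤ.- n ℤ.+ (v ℤ.- + 1) ≡ ℤ.- n ℤ.- n ℤ.- + 2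
      lem = ring-ℤ
      error≤ : ∀ j → Spells bs j → Le (error M (ξ j) (η j) f) (ℤ.- + k ℤ.- + k ℤ.- + 2)
      error≤ j sp = Le-cast (lem v (+ k)) (Le-* (toward-run bs j sp P≤ Q≤)
        (Le-+ p< (Le-resp (*-comm _ _) (Le-cast (ℤₚ.+-comm -1ℤ v) (Le-* (proj₁ (Deg-η j)) (proj₁ dr))))))

    place-translated : ∀ {n} → Rich n → ∀ f {h} bs k → length bs ≡ k → k ℕ.≤ n → Linear bs →
      ∀ M {v} c → Poly c → Deg (r M) v → Le (p M - c * r M) (v ℤ.- + 1) →
      let X₁ = proj₁ (act M f); X₂ = proj₂ (act M f) in
      Le (proj₁ (run bs (X₁ - c * X₂ , X₂))) (ℤ.- v ℤ.- + k) →
      Le (proj₂ (run bs (X₁ - c * X₂ , X₂))) (ℤ.- v ℤ.- + k ℤ.- + 1) →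
      (∀ N j → Le (error N (ξ j) (η j) f) (ℤ.- + k ℤ.- + k ℤ.- + 2) → Le (height N (ξ j) (η j)) h) →
      v ℤ.+ v ℤ.≤ h ℤ.+ + 4
    place-translated rich f bs k len k≤n lin M c Pc dr p< P≤ Q≤ =
      place rich f bs k len k≤n lin (translate c Pc M) dr p<
        (Le-resp (sym (proj₁ same)) P≤) (Le-resp (sym (proj₂ same)) Q≤)
      where
      same : run bs (act (translate c Pc M) f) ≈ₚ run bs (proj₁ (act M f) - c * proj₂ (act M f) , proj₂ (act M f))
      same = run-cong bs (act-translate c Pc M f , refl)

  module Collecting (L : Line) where
    open Line L

    -- A stretch of the line that the path to x / y follows spells a word of linear
    -- polynomials for x / y; where the two paths part, the end letters change by constants.
    collect : ∀ k {x y c m} i → Deg x m → Poly c → Le c (+ 0) →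
      Le (toward (ξ i) (x , y)) (m ℤ.- + suc k ℤ.- + suc k) →
      ∃ λ bs → length bs ≡ suc k × Linear bs ×
        Le (proj₁ (run bs (x - c * y , y))) (m ℤ.- + suc k) × Le (proj₂ (run bs (x - c * y , y))) (m ℤ.- + suc k ℤ.- + 1)
    collect zero {x} {y} {c} {m} i dx Pc c≤ le =
      a - c + z ∷ [] , ≡.refl , ((Poly-+ (Poly-sub Pa Pc) Pz , Deg-+ (Deg-sub Da c≤) z≤) , tt) ,
      proj₁ dy , Le-resp (lem₁ x y a c z) xz≤
      where
      l = linkR i
      a = aR i
      Pa = Link.Poly-a l
      Da = Link.Deg-a l
      lem : ∀ m → m ℤ.- + 2 ≡ m ℤ.- + 1 ℤ.- + 1
      lem = ring-ℤ
      lem′ : ∀ m → m ℤ.- + 1 ℤ.- + 1 ℤ.+ + 1 ≡ m ℤ.- + 1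
      lem′ = ring-ℤ
      dy : Deg y (m ℤ.- + 1)
      dy = Deg-second-from-toward (Deg-ξ i) dx (Le-cast (≡.sym (lem m)) le)
      x′≤ : Le (x - a * y) (m ℤ.- + 1)
      x′≤ = Le-resp (x-[x-y]≈y (y * ξ (next i)) (x - a * y))
        (Le-sub (Le-mono (pred-≤ _) (Le-* (proj₁ dy) (proj₁ (Deg-ξ (next i)))))
                (Le-cast (lem′ m) (Le-toward-step l le)))
      res = residue dy x′≤
      z = proj₁ res
      Pz = proj₁ (proj₂ res)
      z≤ = proj₁ (proj₂ (proj₂ res))
      xz≤ = proj₂ (proj₂ (proj₂ res))
      lem₁ : ∀ x y a c z → x - a * y - z * y ≈ x - c * y - (a - c + z) * y
      lem₁ = solve 5 (λ x y a c z → x :- a :* y :- z :* y := x :- c :* y :- (a :- c :+ z) :* y) refl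
    collect (suc k) {x} {y} {c} {m} i dx Pc c≤ le =
      let (bs , len , lin , P≤ , Q≤) = collect k (next i) dy Poly-0 Le-0 le′
          (eP , eQ) = run-cong bs (lem₂ x y (aR i) , lem₁ x y (aR i) c)
      in aR i - c ∷ bs , ≡.cong suc len , ((Poly-sub Pa Pc , Deg-sub Da c≤) , lin) ,
         Le-resp eP (Le-cast (lem₃ m (+ suc k)) P≤) , Le-resp eQ (Le-cast (≡.cong (ℤ._- + 1) (lem₃ m (+ suc k))) Q≤)
      where
      l = linkR i
      Pa = Link.Poly-a l
      Da = Link.Deg-a l
      lem₃ : ∀ m k → m ℤ.- + 1 ℤ.- k ≡ m ℤ.- (+ 1 ℤ.+ k)
      lem₃ = ring-ℤ
      dy : Deg y (m ℤ.- + 1)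
      dy = Deg-second-from-toward (Deg-ξ i) dx (Le-by (suc k ℕ.+ suc k) (two-below m (+ suc k)) le)
      le′ : Le (toward (ξ (next i)) (step (aR i) (x , y))) (m ℤ.- + 1 ℤ.- + suc k ℤ.- + suc k)
      le′ = Le-cast (one-letter-less m (+ suc k)) (Le-toward-step l le)
      lem₁ : ∀ x y a c → x - a * y ≈ x - c * y - (a - c) * y
      lem₁ = solve 4 (λ x y a c → x :- a :* y := x :- c :* y :- (a :- c) :* y) refl
      lem₂ : ∀ x y a → y - 0# * (x - a * y) ≈ y
      lem₂ = solve 3 (λ x y a → y :- con (+ 0) :* (x :- a :* y) := y) refl

  -- A match of odd length 2k + 1 is part of a match of length 2k + 2 with another geodesic
  -- of the orbit, since the word of k letters that it spells occurs elsewhere on the line.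
  gap : ∀ {n} (L′ L : Line) → Spelling.Rich L n → ∀ f {h} k → suc k ℕ.≤ n → ∀ M i →
    Le (error M (Line.ξ L′ i) (Line.η L′ i) f) (ℤ.- + suc k ℤ.- + suc k ℤ.- + 1) →
    ¬ Le (height M (Line.ξ L′ i) (Line.η L′ i)) (h ℤ.+ + 4) →
    ¬ (∀ N j → Le (error N (Line.ξ L j) (Line.η L j) f) (ℤ.- + suc k ℤ.- + suc k ℤ.- + 2) →
               Le (height N (Line.ξ L j) (Line.η L j)) h)
  gap {n} L′ L rich f {h} k k<n M i le deep shallow = locate-¬¬ L′ M i go
    where
    open Line L′
    open Collecting L′
    lem₁ : ∀ v k → ℤ.- (+ 1 ℤ.+ k) ℤ.- (+ 1 ℤ.+ k) ℤ.- + 1 ℤ.- v ℤ.+ + 1 ≡ ℤ.- v ℤ.- (+ 1 ℤ.+ k) ℤ.- (+ 1 ℤ.+ k)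
    lem₁ = ring-ℤ
    lem₂ : ∀ v k → ℤ.- v ℤ.- + 1 ≡ ℤ.- v ℤ.- (+ 1 ℤ.+ k) ℤ.- (+ 1 ℤ.+ k) ℤ.+ (k ℤ.+ (k ℤ.+ + 1))
    lem₂ = ring-ℤ
    go : ¬ Located L′ M i
    go loc = deep (height-≥ (Le-mono v+v≤ height≤))
      where
      open Vertex loc
      D≤ : Le (toward (ξ i′) (act M′ f)) (ℤ.- v ℤ.- + suc k ℤ.- + suc k)
      D≤ = Le-cast (lem₁ v (+ k)) (weak-case f le)
      dX₁ : Deg (proj₁ (act M′ f)) (ℤ.- v)
      dX₁ = Deg-act-first M′ (ξ i′) f Deg-toward p≤ (Le-by (k ℕ.+ (k ℕ.+ 1)) (lem₂ v (+ k)) D≤)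
      v+v≤ : v ℤ.+ v ℤ.≤ h ℤ.+ + 4
      v+v≤ =
        let (c , Pc , c≤ , p<) = residue Deg-r p≤
            (bs , len , lin , P≤ , Q≤) = collect k i′ dX₁ Pc c≤ D≤
        in Spelling.place-translated L rich f bs (suc k) len k<n lin M′ c Pc Deg-r p< P≤ Q≤ shallow

  division : ∀ {x y n} → Deg y n → ∃ λ a → Poly a × Le (x - a * y) (n ℤ.- + 1)
  division {x} {y} {n} dy with Le-bounded x
  ... | B , x≤B with common-upper B n
  ... | d , e , eq = go e x (Le-mono (ℤₚ.≤-trans (ℤₚ.i≤i+j B (+ d)) (ℤₚ.≤-reflexive eq)) x≤B)
    where
    lem : ∀ x c z y a → x - c * (z * y) - a * y ≈ x - (c * z + a) * y
    lem = solve 5 (λ x c z y a → x :- c :* (z :* y) :- a :* y := x :- (c :* z :+ a) :* y) refl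
    lem₂ : ∀ n e → (+ 1 ℤ.+ e) ℤ.+ n ℤ.- + 1 ≡ n ℤ.+ e
    lem₂ = ring-ℤ
    go : ∀ e x → Le x (n ℤ.+ + e) → ∃ λ a → Poly a × Le (x - a * y) (n ℤ.- + 1)
    go zero x x≤ with residue dy (Le-cast (ℤₚ.+-identityʳ n) x≤)
    ... | c , Pc , _ , le = c , Pc , le
    go (suc e) x x≤ with residue (Deg-* (Deg-Y^ (suc e)) dy) (Le-cast (ℤₚ.+-comm n (+ suc e)) x≤)
    ... | c , Pc , _ , le with go e (x - c * (Y^ (suc e) * y)) (Le-cast (lem₂ n (+ e)) le)
    ... | a , Pa , le′ = c * Y^ (suc e) + a , Poly-+ (Poly-* Pc (Poly-Y^ (suc e))) Pa ,
                         Le-resp (lem x c (Y^ (suc e)) y a) le′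

  -- In classical terms -s/r is a convergent of f whose denominator has degree v, and -q/p is the
  -- preceding one.
  record Convergent (f : Carrier) (n : ℕ) : Set where
    field
      M      : Mat
      v      : ℤ
      v≥     : + n ℤ.≤ v
      Deg-r  : Deg (r M) v
      p<     : Le (p M) (v ℤ.- + 1)
      Deg-X₁ : Deg (proj₁ (act M f)) (ℤ.- v)
      X₂≤    : Le (proj₂ (act M f)) (ℤ.- v ℤ.- + 1)

  module _ (f : Carrier) (irrational : ∀ {p r} → Poly p → Poly r → p * f ≈ r → p ≈ 0#) where

    convergents : ∀ n → ¬ ¬ Convergent f n
    convergents zero none = none (record
      { M = record
        { p = 0# ; q = 1# ; r = 1# ; s = - a
        ; Poly-p = Poly-0 ; Poly-q = Poly-1 ; Poly-r = Poly-1 ; Poly-s = Poly-neg Pa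
        ; det = - 1# ; Deg-det = Deg-neg Deg-1
        ; det-eq = lem₁ a }
      ; v = + 0 ; v≥ = ℤₚ.≤-refl ; Deg-r = Deg-1 ; p< = Le-0
      ; Deg-X₁ = Deg-resp (lem₂ f) Deg-1
      ; X₂≤ = Le-resp (lem₃ f a) (proj₂ (proj₂ quot)) })
      where
      quot = division {f} Deg-1
      a = proj₁ quot
      Pa = proj₁ (proj₂ quot)
      lem₁ : ∀ a → 0# * - a - 1# * 1# ≈ - 1#
      lem₁ = solve 1 (λ a → con (+ 0) :* (:- a) :- con (+ 1) :* con (+ 1) := :- con (+ 1)) refl
      lem₂ : ∀ f → 1# ≈ 0# * f + 1#
      lem₂ = solve 1 (λ f → con (+ 1) := con (+ 0) :* f :+ con (+ 1)) refl
      lem₃ : ∀ f a → f - a * 1# ≈ 1# * f + - a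
      lem₃ = solve 2 (λ f a → f :- a :* con (+ 1) := con (+ 1) :* f :+ (:- a)) refl
    -- The next partial quotient is the polynomial part of X₁ / X₂. Irrationality of f keeps X₂
    -- nonzero, and its degree, required for the division, exists up to double negation.
    convergents (suc n) none = convergents n λ C → Deg-exists (X₂≉0 C) λ (_ , dX₂) → none (improve C dX₂)
      where
      X₂≉0 : (C : Convergent f n) → ¬ proj₂ (act (Convergent.M C) f) ≈ 0#
      X₂≉0 C e = ¬Deg-0 (Deg-resp (irrational (Poly-r M) (Poly-neg (Poly-s M))
          (trans (lem (r M) (s M) f) (modulo 1# e))) Deg-r)
        where
        open Convergent C
        lem : ∀ r s f → r * f ≈ - s + 1# * (r * f + s - 0#)
        lem = solve 3 (λ r s f → r :* f := :- s :+ con (+ 1) :* (r :* f :+ s :- con (+ 0))) refl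
      improve : (C : Convergent f n) → ∀ {x} → Deg (proj₂ (act (Convergent.M C) f)) x → Convergent f (suc n)
      improve C {x} dX₂ = record
        { M = stepᴹ a Pa M ; v = ℤ.- x
        ; v≥ = ℤₚ.≤-trans (ℤₚ.+-monoʳ-≤ (+ 1) v≥) v<
        ; Deg-r = Deg-resp (+-comm _ _) (Deg-+ (Deg-neg (Deg-cast (lem₂ v x) (Deg-* Da Deg-r)))
                    (Le-mono (lin₁ 1 v< (lem₅ v x)) p<))
        ; p< = Le-mono (lin₁ 0 v< (lem₁ v x)) (proj₁ Deg-r)
        ; Deg-X₁ = Deg-cast (≡.sym (ℤₚ.neg-involutive x)) dX₂
        ; X₂≤ = Le-resp (sym (proj₂ (act-step a Pa M f)))
                  (Le-cast (≡.cong (ℤ._- + 1) (≡.sym (ℤₚ.neg-involutive x))) le) }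
        where
        open Convergent C
        X₁ = proj₁ (act M f)
        X₂ = proj₂ (act M f)
        quot = division {X₁} dX₂
        a = proj₁ quot
        Pa = proj₁ (proj₂ quot)
        le = proj₂ (proj₂ quot)
        lem₀ : ∀ v x → ℤ.- x ℤ.+ x ≡ + 1 ℤ.+ v ℤ.+ (ℤ.- v ℤ.- + 1) ℤ.+ + 0
        lem₀ = ring-ℤ
        v< : + 1 ℤ.+ v ℤ.≤ ℤ.- x
        v< = lin₁ 0 (Deg-≤ dX₂ X₂≤) (lem₀ v x)
        lem₁ : ∀ v x → ℤ.- x ℤ.- + 1 ℤ.+ (+ 1 ℤ.+ v) ≡ v ℤ.+ (ℤ.- x) ℤ.+ + 0
        lem₁ = ring-ℤ
        lem₂ : ∀ v x → ℤ.- v ℤ.- x ℤ.+ v ≡ ℤ.- x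
        lem₂ = ring-ℤ
        lem₃ : ∀ v x → ℤ.- v ℤ.- + 1 ℤ.+ (+ 1 ℤ.+ v) ≡ x ℤ.- + 1 ℤ.+ (ℤ.- x) ℤ.+ + 1
        lem₃ = ring-ℤ
        lem₄ : ∀ v x → ℤ.- v ≡ ℤ.- v ℤ.- x ℤ.+ x
        lem₄ = ring-ℤ
        lem₅ : ∀ v x → ℤ.- x ℤ.- + 1 ℤ.+ (+ 1 ℤ.+ v) ≡ v ℤ.- + 1 ℤ.+ (ℤ.- x) ℤ.+ + 1
        lem₅ = ring-ℤ
        Da : Deg a (ℤ.- v ℤ.- x)
        Da = Deg-cancel dX₂ (Deg-resp (x-[x-y]≈y X₁ (a * X₂))
          (Deg-cast (lem₄ v x) (Deg-sub Deg-X₁ (Le-mono (lin₁ 1 v< (lem₃ v x)) le))))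

    -- Each convergent is a vertex of level 0 on the path to f. Laying the empty word there already
    -- gives overlaps of length 2, while v tends to infinity.
    minimum : ∀ {n} (L : Line) → Spelling.Rich L n → ∀ {h} →
      ¬ (∀ N j → Le (error N (Line.ξ L j) (Line.η L j) f) (ℤ.- + 2) → Le (height N (Line.ξ L j) (Line.η L j)) h)
    minimum L rich {h} shallow = convergents (suc ℤ.∣ h ℤ.+ + 4 ∣) λ C →
      let open Convergent C
      in ℤₚ.<⇒≱ (too-large v≥) (Spelling.place L rich f [] 0 ≡.refl ℕ.z≤n tt M Deg-r p<
           (Le-cast (≡.sym (ℤₚ.+-identityʳ _)) (proj₁ Deg-X₁))
           (Le-cast (≡.cong (ℤ._- + 1) (≡.sym (ℤₚ.+-identityʳ (ℤ.- v)))) X₂≤) shallow)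
      where
      too-large : ∀ {v} → + suc ℤ.∣ h ℤ.+ + 4 ∣ ℤ.≤ v → h ℤ.+ + 4 ℤ.< v ℤ.+ v
      too-large {v} v≥ = ℤₚ.≤-<-trans (i≤∣i∣ (h ℤ.+ + 4)) (ℤₚ.<-≤-trans (ℤ.+<+ (ℕₚ.n<1+n _))
        (ℤₚ.≤-trans v≥ (ℤₚ.≤-trans (ℤₚ.≤-reflexive (≡.sym (ℤₚ.+-identityʳ v)))
          (ℤₚ.+-monoʳ-≤ v (ℤₚ.≤-trans (ℤ.+≤+ ℕ.z≤n) v≥)))))

-- Exchanging the two ends of a geodesic

module Reversal (V : ValuedRing) where
  open ValuedRing V
  open Degree V
  open Geodesic V
  open Mat

  reverse : Line → Line
  reverse L = record
    { Idx = Idx ; next = prev ; prev = next ; aR = aL ; aL = aR ; ξ = η ; η = ξ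
    ; linkR = λ i → flip (linkL i) (proj₁ (Deg-η (prev i))) (proj₁ (Deg-ξ i))
    ; linkL = λ i → flip (linkR i) (proj₁ (Deg-η i)) (proj₁ (Deg-ξ (next i)))
    ; ξ-irrational = η-irrational ; η-irrational = ξ-irrational }
    where
    open Line L
    flip : ∀ {a ξ η ξ⁺ η⁺} → Link a ξ η ξ⁺ η⁺ → Le η -1ℤ → Le ξ⁺ -1ℤ → Link a η⁺ ξ⁺ η ξ
    flip l η≤ ξ⁺≤ = record { Poly-a = Link.Poly-a l ; Deg-a = Link.Deg-a l ; ξ⁺≤ = η≤ ; η≤ = ξ⁺≤
                           ; ξ-eq = Link.η-eq l ; η-eq = Link.ξ-eq l }

  -- z ↦ -1/z exchanges the roles of the ends 1/ξ and -η.
  turn : Mat → Mat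
  turn M = record
    { p = r M ; q = s M ; r = - p M ; s = - q M
    ; Poly-p = Poly-r M ; Poly-q = Poly-s M ; Poly-r = Poly-neg (Poly-p M) ; Poly-s = Poly-neg (Poly-q M)
    ; det = det M ; Deg-det = Deg-det M
    ; det-eq = trans (lem (p M) (q M) (r M) (s M)) (det-eq M) }
    where
    lem : ∀ p q r s → r * - q - s * - p ≈ p * s - q * r
    lem = solve 4 (λ p q r s → r :* (:- q) :- s :* (:- p) := p :* s :- q :* r) refl

-- Periodic words and quadratic irrationals

module PeriodicLine (V : ValuedRing)
  (b : ℕ → ValuedRing.Carrier V) (Poly-b : ∀ i → ValuedRing.Poly V (b i))
  (Deg-b : ∀ i → ValuedRing.Deg V (b i) (+ 1)) (ϖ : ℕ) where
  open ValuedRing V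
  open Degree V
  open Geodesic V
  open Mat

  period : ℕ
  period = suc ϖ

  infixl 7 _%_
  _%_ : (m n : ℕ) .{{_ : ℕ.NonZero n}} → ℕ
  _%_ = ℕᵈ._%_

  rot : ℕ → ℕ
  rot i = (i ℕ.+ ϖ) % period

  module Right = Tails V (λ i → suc i % period) b (λ _ → 0) Poly-b Deg-b
  module Left = Tails V rot (λ i → b (rot i)) (λ _ → 0) (λ i → Poly-b (rot i)) (λ i → Deg-b (rot i))

  -- The tails are constructed over residues modulo the period. Periodicity thus comes from equality
  -- of indices instead of a uniqueness theorem for continued fractions.
  ξ η aR : ℕ → Carrier
  ξ i = Right.ζ (i % period)
  η i = Left.ζ (i % period)
  aR i = b (i % period)

  +-% : ∀ i k → (i % period ℕ.+ k) % period ≡ (i ℕ.+ k) % period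
  +-% i k = ≡.trans (ℕᵈ.%-distribˡ-+ (i % period) k period)
    (≡.trans (≡.cong (λ z → (z ℕ.+ k % period) % period) (ℕᵈ.m%n%n≡m%n i period))
             (≡.sym (ℕᵈ.%-distribˡ-+ i k period)))

  full-turn : ∀ i → (suc i ℕ.+ ϖ) % period ≡ i % period
  full-turn i = ≡.trans (≡.cong (_% period) (≡.sym (ℕₚ.+-suc i ϖ))) (ℕᵈ.[m+n]%n≡m%n i period)

  suc-% : ∀ i → suc (i % period) % period ≡ suc i % period
  suc-% i = ≡.trans (≡.cong (_% period) (ℕₚ.+-comm 1 (i % period)))
    (≡.trans (+-% i 1) (≡.cong (_% period) (ℕₚ.+-comm i 1)))

  rot-suc : ∀ i → rot (suc i % period) ≡ i % period
  rot-suc i = ≡.trans (+-% (suc i) ϖ) (full-turn i)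

  ξ-next : ∀ i → ξ i * (aR i + ξ (suc i)) ≈ 1#
  ξ-next i = ≡.subst (λ z → ξ i * (aR i + Right.ζ z) ≈ 1#) (suc-% i) (Right.ζ-eq (i % period))

  η-next : ∀ i → η (suc i) * (aR i + η i) ≈ 1#
  η-next i = ≡.subst (λ z → η (suc i) * (b z + Left.ζ z) ≈ 1#) (rot-suc i) (Left.ζ-eq (suc i % period))

  linkR : ∀ i → Link (aR i) (ξ i) (η i) (ξ (suc i)) (η (suc i))
  linkR i = record { Poly-a = Poly-b _ ; Deg-a = Deg-b _ ; ξ⁺≤ = Right.ζ≤ _ ; η≤ = Left.ζ≤ _
                   ; ξ-eq = ξ-next i ; η-eq = η-next i }

  line : Line
  line = record
    { Idx = ℕ ; next = suc ; prev = ℕ._+ ϖ ; aR = aR ; aL = λ i → aR (i ℕ.+ ϖ) ; ξ = ξ ; η = η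
    ; linkR = linkR
    ; linkL = λ i → ≡.subst₂ (λ x y → Link (aR (i ℕ.+ ϖ)) (ξ (i ℕ.+ ϖ)) (η (i ℕ.+ ϖ)) (Right.ζ x) (Left.ζ y))
                      (full-turn i) (full-turn i) (linkR (i ℕ.+ ϖ))
    ; ξ-irrational = λ i → Right.ζ-irrational (i % period)
    ; η-irrational = λ i → Left.ζ-irrational (i % period) }

  aR-periodic : ∀ i k → aR (i ℕ.+ k ℕ.* period) ≡ aR i
  aR-periodic i k = ≡.cong b (ℕᵈ.[m+kn]%n≡m%n i k period)

  nexts-+ : ∀ t i → Line.nexts line t i ≡ i ℕ.+ t
  nexts-+ zero i    = ≡.sym (ℕₚ.+-identityʳ i)
  nexts-+ (suc t) i = ≡.trans (nexts-+ t (suc i)) (≡.sym (ℕₚ.+-suc i t))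

  -- A step along the line is itself a polynomial matrix of unit determinant, so all positions
  -- describe the same orbit and may be referred to position 0.
  to-origin : ∀ j N → ∃ λ N₀ → (∀ f {m} → Le (error N (ξ j) (η j) f) m → Le (error N₀ (ξ 0) (η 0) f) m) ×
                                (∀ {m} → Le (height N₀ (ξ 0) (η 0)) m → Le (height N (ξ j) (η j)) m)
  to-origin zero N    = N , (λ f le → le) , (λ le → le)
  to-origin (suc j) N =
    let (N₀ , e , h) = to-origin j (backᴹ (aR j) (Link.Poly-a (linkR j)) N)
    in N₀ , (λ f le → e f (error-back (linkR j) N f le)) , (λ le → height-unback (linkR j) N (h le))

  -- Here α is 1 / ξ 0, with purely periodic expansion; by Galois' theorem its conjugate is the
  -- negative of the continued fraction read backwards.
  α ασ : Carrier
  α  = aR 0 + ξ 1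
  ασ = - η 0

  -- After a full period, `M` fixes α and ασ, which yields a quadratic equation with coefficients
  -- from its entries. The degrees serve to show that the leading coefficient r is nonzero.
  record Walked (n : ℕ) : Set where
    field
      M         : Mat
      fixes-α   : toward (ξ n) (act M α) ≈ 0#
      fixes-ασ  : away (η n) (act M ασ) ≈ 0#
      Deg-toward : Deg (toward (ξ n) (col M)) (+ n ℤ.- + 1)
      Deg-away   : Deg (away (η n) (col M)) (ℤ.- + n)

  walked : ∀ n → Walked n
  walked zero = record
    { M = record { p = 1# ; q = 0# ; r = 0# ; s = 1# ; Poly-p = Poly-1 ; Poly-q = Poly-0 ; Poly-r = Poly-0
                 ; Poly-s = Poly-1 ; det = 1# ; Deg-det = Deg-1 ; det-eq = lem₀ }
    ; fixes-α = trans (lem₁ (ξ 0) α) (modulo 1# (ξ-next 0))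
    ; fixes-ασ = lem₂ (η 0)
    ; Deg-toward = Deg-resp (lem₃ (ξ 0)) (Link.Deg-ξ (linkR 0))
    ; Deg-away = Deg-resp (lem₄ (η 0)) Deg-1 }
    where
    lem₀ : 1# * 1# - 0# * 0# ≈ 1#
    lem₀ = solve 0 (con (+ 1) :* con (+ 1) :- con (+ 0) :* con (+ 0) := con (+ 1)) refl
    lem₁ : ∀ x a → (1# * a + 0#) * x - (0# * a + 1#) ≈ 0# + 1# * (x * a - 1#)
    lem₁ = solve 2 (λ x a → (con (+ 1) :* a :+ con (+ 0)) :* x :- (con (+ 0) :* a :+ con (+ 1)) :=
             con (+ 0) :+ con (+ 1) :* (x :* a :- con (+ 1))) refl
    lem₂ : ∀ y → 1# * - y + 0# + (0# * - y + 1#) * y ≈ 0#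
    lem₂ = solve 1 (λ y → con (+ 1) :* (:- y) :+ con (+ 0) :+ (con (+ 0) :* (:- y) :+ con (+ 1)) :* y := con (+ 0)) refl
    lem₃ : ∀ x → x ≈ 1# * x - 0#
    lem₃ = solve 1 (λ x → x := con (+ 1) :* x :- con (+ 0)) refl
    lem₄ : ∀ y → 1# ≈ 1# + 0# * y
    lem₄ = solve 1 (λ y → con (+ 1) := con (+ 1) :+ con (+ 0) :* y) refl
  walked (suc n) = record
    { M = M′
    ; fixes-α = trans (toward-cong (ξ (suc n)) (act-step a Pa M α))
        (trans (toward-step l (act M α)) (trans (*-congˡ fixes-α) (zeroʳ _)))
    ; fixes-ασ = trans (away-cong (η (suc n)) (act-step a Pa M ασ))
        (trans (away-step l (act M ασ)) (trans (*-congˡ fixes-ασ) (zeroʳ _)))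
    ; Deg-toward = Deg-cast (lem₁ (+ n)) (Deg-toward-step l Deg-toward)
    ; Deg-away = Deg-cast (lem₂ (+ n)) (Deg-away-step l Deg-away) }
    where
    open Walked (walked n)
    l = linkR n
    a = aR n
    Pa = Link.Poly-a l
    M′ = stepᴹ a Pa M
    lem₁ : ∀ n → n ℤ.- + 1 ℤ.+ + 1 ≡ + 1 ℤ.+ n ℤ.- + 1
    lem₁ = ring-ℤ
    lem₂ : ∀ n → ℤ.- n ℤ.- + 1 ≡ ℤ.- (+ 1 ℤ.+ n)
    lem₂ = ring-ℤ

  private
    module P = Walked (walked period)

  A B C : Carrier
  A = r P.M
  B = s P.M - p P.M
  C = - q P.M

  Poly-A : Poly A
  Poly-A = Poly-r P.M

  Poly-B : Poly B
  Poly-B = Poly-sub (Poly-s P.M) (Poly-p P.M)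

  Poly-C : Poly C
  Poly-C = Poly-neg (Poly-q P.M)

  A≉0 : ¬ A ≈ 0#
  A≉0 e = ¬Deg-0 (Deg-resp e (Deg-second (Right.ζ≤ _) (Left.ζ≤ _) (col P.M) P.Deg-toward
    (Le-mono (ℤₚ.≤-trans ℤ.-≤+ (ℤₚ.≤-reflexive (lem (+ ϖ)))) (proj₁ P.Deg-away))))
    where
    lem : ∀ n → n ≡ + 1 ℤ.+ n ℤ.- + 1
    lem = ring-ℤ

  private
    wrap : period % period ≡ 0
    wrap = ℕᵈ.n%n≡0 period

  α-root : A * (α * α) + (B * α + C) ≈ 0#
  α-root = trans (lem (p P.M) (q P.M) (r P.M) (s P.M) α (ξ 0))
    (trans (modulo _ (ξ-next 0)) (modulo _ fixed))
    where
    fixed : toward (ξ 0) (act P.M α) ≈ 0#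
    fixed = ≡.subst (λ z → toward (Right.ζ z) (act P.M α) ≈ 0#) wrap P.fixes-α
    lem : ∀ p q r s a x → r * (a * a) + ((s - p) * a + - q) ≈
          0# + (- a) * ((p * a + q) * x - (r * a + s) - 0#) + (p * a + q) * (x * a - 1#)
    lem = solve 6 (λ p q r s a x → r :* (a :* a) :+ ((s :- p) :* a :+ (:- q)) :=
          con (+ 0) :+ (:- a) :* ((p :* a :+ q) :* x :- (r :* a :+ s) :- con (+ 0)) :+ (p :* a :+ q) :* (x :* a :- con (+ 1))) refl

  ασ-root : A * (ασ * ασ) + (B * ασ + C) ≈ 0#
  ασ-root = trans (lem (p P.M) (q P.M) (r P.M) (s P.M) (η 0)) (modulo _ fixed)
    where
    fixed : away (η 0) (act P.M ασ) ≈ 0#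
    fixed = ≡.subst (λ z → away (Left.ζ z) (act P.M ασ) ≈ 0#) wrap P.fixes-ασ
    lem : ∀ p q r s y → r * (- y * - y) + ((s - p) * - y + - q) ≈
          0# + (- 1#) * ((p * - y + q) + (r * - y + s) * y - 0#)
    lem = solve 5 (λ p q r s y → r :* ((:- y) :* (:- y)) :+ ((s :- p) :* (:- y) :+ (:- q)) :=
          con (+ 0) :+ (:- con (+ 1)) :* ((p :* (:- y) :+ q) :+ (r :* (:- y) :+ s) :* y :- con (+ 0))) refl

-- Deep overlaps from common words

module LowerBounds (V : ValuedRing)
  (b : ℕ → ValuedRing.Carrier V) (d : ℕ → ℕ)
  (Poly-b : ∀ i → ValuedRing.Poly V (b i))
  (Deg-b : ∀ i → ValuedRing.Deg V (b i) (+ suc (d i))) where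
  open ValuedRing V
  open Degree V
  open Geodesic V
  open Mat
  open Expansion V b d Poly-b Deg-b

  private
    f = ζ 0

  record Elementary (J : ℕ) : Set where
    field
      M     : Mat
      v     : ℤ
      v≥    : + J ℤ.≤ v
      Deg-r : Deg (r M) v
      κ     : Carrier
      κ≤    : Le κ (ℤ.- v)
      act-f : act M f ≈ₚ (κ , κ * ζ J)
      p≤    : Le (p M) (v ℤ.- + 1)

  elementary : ∀ J → Elementary J
  -- The sharper bound on p remembers the degree of the last quotient read; it tells a preceding
  -- quotient of degree 1 from a longer one.
  elementary-suc : ∀ J → Σ (Elementary (suc J)) λ E → Le (p (Elementary.M E)) (Elementary.v E ℤ.- + suc (d J))
  elementary zero = record
    { M = record { p = 0# ; q = 1# ; r = 1# ; s = 0# ; Poly-p = Poly-0 ; Poly-q = Poly-1 ; Poly-r = Poly-1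
                 ; Poly-s = Poly-0 ; det = - 1# ; Deg-det = Deg-neg Deg-1 ; det-eq = lem₀ }
    ; v = + 0 ; v≥ = ℤₚ.≤-refl ; Deg-r = Deg-1 ; κ = 1# ; κ≤ = proj₁ Deg-1
    ; act-f = lem₁ f , lem₂ f ; p≤ = Le-0 }
    where
    lem₀ : 0# * 0# - 1# * 1# ≈ - 1#
    lem₀ = solve 0 (con (+ 0) :* con (+ 0) :- con (+ 1) :* con (+ 1) := :- con (+ 1)) refl
    lem₁ : ∀ f → 0# * f + 1# ≈ 1#
    lem₁ = solve 1 (λ f → con (+ 0) :* f :+ con (+ 1) := con (+ 1)) refl
    lem₂ : ∀ f → 1# * f + 0# ≈ 1# * f
    lem₂ = solve 1 (λ f → con (+ 1) :* f :+ con (+ 0) := con (+ 1) :* f) refl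
  elementary (suc J) = proj₁ (elementary-suc J)
  elementary-suc J = record
    { M = stepᴹ (b J) (Poly-b J) M
    ; v = v ℤ.+ + suc (d J)
    ; v≥ = lin₁ (d J) v≥ (lem₁ (+ J) v (+ d J))
    ; Deg-r = Deg-resp (+-comm _ _) (Deg-+ (Deg-neg (Deg-cast (ℤₚ.+-comm _ v) (Deg-* (Deg-b J) Deg-r)))
        (Le-by (suc (d J)) (lem₂ v (+ d J)) p≤))
    ; κ = κ * ζ J
    ; κ≤ = Le-cast (lem₃ v (+ d J)) (Le-* κ≤ (proj₁ (Deg-ζ J)))
    ; act-f = trans (proj₁ (act-step (b J) (Poly-b J) M f)) (proj₂ act-f) ,
              trans (proj₂ (act-step (b J) (Poly-b J) M f)) second
    ; p≤ = Le-by (d J) (lem₄ v (+ d J)) (proj₁ Deg-r) } ,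
    Le-cast (lem₅ v (+ suc (d J))) (proj₁ Deg-r)
    where
    open Elementary (elementary J)
    lem₁ : ∀ J v d → v ℤ.+ (+ 1 ℤ.+ d) ℤ.+ J ≡ + 1 ℤ.+ J ℤ.+ v ℤ.+ d
    lem₁ = ring-ℤ
    lem₂ : ∀ v d → v ℤ.+ (+ 1 ℤ.+ d) ℤ.- + 1 ≡ v ℤ.- + 1 ℤ.+ (+ 1 ℤ.+ d)
    lem₂ = ring-ℤ
    lem₃ : ∀ v d → ℤ.- v ℤ.- (+ 1 ℤ.+ d) ≡ ℤ.- (v ℤ.+ (+ 1 ℤ.+ d))
    lem₃ = ring-ℤ
    lem₄ : ∀ v d → v ℤ.+ (+ 1 ℤ.+ d) ℤ.- + 1 ≡ v ℤ.+ d
    lem₄ = ring-ℤ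
    lem₅ : ∀ v d → v ≡ v ℤ.+ d ℤ.- d
    lem₅ = ring-ℤ
    lem₆ : ∀ k b z z′ → k - b * (k * z) ≈ k * z * z′ + (- k) * (z * (b + z′) - 1#)
    lem₆ = solve 4 (λ k b z z′ → k :- b :* (k :* z) := k :* z :* z′ :+ (:- k) :* (z :* (b :+ z′) :- con (+ 1))) refl
    second : proj₁ (act M f) - b J * proj₂ (act M f) ≈ κ * ζ J * ζ (suc J)
    second = trans (+-cong (proj₁ act-f) (-‿cong (*-congˡ (proj₂ act-f))))
      (trans (lem₆ κ (b J) (ζ J) (ζ (suc J))) (modulo (- κ) (ζ-eq J)))

  module Approximation (L : Line) where
    open Line L

    difference-≤ : ∀ i j {m} → Le (b j - aR i) m → Le (ζ (suc j) - ξ (next i)) m → Le (ξ i - ζ j) (m ℤ.- + 2)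
    difference-≤ i j {m} p q = Le-resp (sym (difference (Link.ξ-eq (linkR i)) (ζ-eq j)))
      (Le-cast (ℤₚ.+-comm (ℤ.- + 2) m) (Le-* (Le-* (proj₁ (Deg-ξ i)) (ζ≤ j)) (Le-+ p q)))

    Le-flip : ∀ {x y m} → Le (x - y) m → Le (y - x) m
    Le-flip {x} {y} le = Le-resp (-[x-y]≈y-x x y) (Le-neg le)

    -- By `difference-≤`, each common letter multiplies the difference of the tails by two factors
    -- of absolute value at most 1/q.
    agreement : ∀ k i j {m} → (∀ t → t ℕ.< k → b (j ℕ.+ t) ≈ aR (nexts t i)) →
      Le (ξ (nexts k i) - ζ (j ℕ.+ k)) m → Le (ξ i - ζ j) (m ℤ.- + k ℤ.- + k)
    agreement zero i j {m} same le = Le-cast (lem m) (≡.subst (λ z → Le (ξ i - ζ z) m) (ℕₚ.+-identityʳ j) le)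
      where
      lem : ∀ m → m ≡ m ℤ.- + 0 ℤ.- + 0
      lem = ring-ℤ
    agreement (suc k) i j {m} same le = Le-cast (lem m (+ k)) (difference-≤ i j
      (Le-resp (sym b≈a) Le-0)
      (Le-flip (agreement k (next i) (suc j)
        (λ t t<k → ≡.subst (λ z → b z ≈ aR (nexts t (next i))) (ℕₚ.+-suc j t) (same (suc t) (ℕ.s≤s t<k)))
        (≡.subst (λ z → Le (ξ (nexts k (next i)) - ζ z) m) (ℕₚ.+-suc j k) le))))
      where
      lem : ∀ m k → m ℤ.- k ℤ.- k ℤ.- + 2 ≡ m ℤ.- (+ 1 ℤ.+ k) ℤ.- (+ 1 ℤ.+ k)
      lem = ring-ℤ
      b≈a : b j - aR i ≈ 0#
      b≈a = trans (+-congʳ (≡.subst (λ z → b z ≈ aR i) (ℕₚ.+-identityʳ j) (same 0 (ℕ.s≤s ℕ.z≤n)))) (-‿inverseʳ _)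

    -- A partial quotient of degree ≥ 2 just before the common word makes the path from ∞
    -- join the line exactly one step before the word.
    approximation : ∀ i J {m} → ¬ d J ≡ 0 → Le (ξ i - ζ (suc J)) m →
      ∃ λ M → Le (error M (ξ i) (η i) f) (m ℤ.- + 1) × ∃ λ w → + J ℤ.≤ w × Deg (height M (ξ i) (η i)) w
    approximation i J {m} d≢0 le = M , error≤ , v ℤ.+ (v ℤ.- + 1) , w≥ , Deg-* dV dY
      where
      E = elementary-suc J
      open Elementary (proj₁ E)
      p≤′ : ∀ n → ¬ n ≡ 0 → Le (p M) (v ℤ.- + suc n) → Le (p M) (v ℤ.- + 1 ℤ.- + 1)
      p≤′ zero n≢0 _     = ⊥-elim (n≢0 ≡.refl)
      p≤′ (suc n) _ p≤n = Le-by n (lem v (+ n)) p≤n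
        where
        lem : ∀ v n → v ℤ.- + 1 ℤ.- + 1 ≡ v ℤ.- (+ 2 ℤ.+ n) ℤ.+ n
        lem = ring-ℤ
      dV : Deg (toward (ξ i) (col M)) v
      dV = Deg-resp (+-comm _ _) (Deg-+ (Deg-neg Deg-r) (Le-mono (pred-≤ _) (Le-* p≤ (proj₁ (Deg-ξ i)))))
      dY : Deg (away (η i) (col M)) (v ℤ.- + 1)
      dY = Deg-resp (+-comm _ _) (Deg-+ (Deg-* Deg-r (Deg-η i)) (p≤′ (d J) d≢0 (proj₂ E)))
      lem₁ : ∀ k x z → k * x - k * z ≈ k * (x - z)
      lem₁ = solve 3 (λ k x z → k :* x :- k :* z := k :* (x :- z)) refl
      lem₂ : ∀ v m → ℤ.- v ℤ.+ m ℤ.+ (v ℤ.- + 1) ≡ m ℤ.- + 1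
      lem₂ = ring-ℤ
      error≤ : Le (error M (ξ i) (η i) f) (m ℤ.- + 1)
      error≤ = Le-cast (lem₂ v m) (Le-* (Le-resp (sym (trans (toward-cong (ξ i) act-f) (lem₁ κ (ξ i) (ζ (suc J)))))
        (Le-* κ≤ le)) (proj₁ dY))
      lem₃ : ∀ v J → v ℤ.+ (v ℤ.- + 1) ℤ.+ (+ 1 ℤ.+ J ℤ.+ (+ 1 ℤ.+ J)) ≡ J ℤ.+ (v ℤ.+ v) ℤ.+ (+ 1 ℤ.+ J)
      lem₃ = ring-ℤ
      w≥ : + J ℤ.≤ v ℤ.+ (v ℤ.- + 1)
      w≥ = lin₂ (suc J) v≥ v≥ (lem₃ v (+ J))

-- Positions modulo a block length

module Residues where
  open ℕᵈ using (_%_)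

  last-residue : ∀ m j → (j ℕ.+ (m ℕ.∸ j % suc m)) % suc m ≡ m
  last-residue m j = begin
    (j ℕ.+ (m ℕ.∸ r)) % suc m                      ≡⟨ ≡.cong (λ z → (z ℕ.+ (m ℕ.∸ r)) % suc m) (ℕᵈ.m≡m%n+[m/n]*n j (suc m)) ⟩
    (r ℕ.+ k ℕ.* suc m ℕ.+ (m ℕ.∸ r)) % suc m      ≡⟨ ≡.cong (_% suc m) (lem r (k ℕ.* suc m) (m ℕ.∸ r)) ⟩
    (r ℕ.+ (m ℕ.∸ r) ℕ.+ k ℕ.* suc m) % suc m      ≡⟨ ℕᵈ.[m+kn]%n≡m%n (r ℕ.+ (m ℕ.∸ r)) k (suc m) ⟩
    (r ℕ.+ (m ℕ.∸ r)) % suc m                      ≡⟨ ≡.cong (_% suc m) (ℕₚ.m+[n∸m]≡n (ℕₚ.≤-pred (ℕᵈ.m%n<n j (suc m)))) ⟩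
    m % suc m                                      ≡⟨ ℕᵈ.m≤n⇒m%n≡m ℕₚ.≤-refl ⟩
    m                                              ∎
    where
    open ≡.≡-Reasoning
    r = j % suc m
    k = j ℕᵈ./ suc m
    lem : ∀ r k t → r ℕ.+ k ℕ.+ t ≡ r ℕ.+ t ℕ.+ k
    lem = ring-ℕ

  residue-shift : ∀ m j t → j % suc m ≡ 0 → t ℕ.≤ m → (j ℕ.+ t) % suc m ≡ t
  residue-shift m j t e t≤m = ≡.trans (ℕᵈ.%-distribˡ-+ j t (suc m))
    (≡.trans (≡.cong (λ z → (z ℕ.+ t % suc m) % suc m) e)
      (≡.trans (ℕᵈ.m%n%n≡m%n t (suc m)) (ℕᵈ.m≤n⇒m%n≡m t≤m)))

open Residues

-- The periodic word and the values that are attained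

-- upperʳ concerns the elements of the orbit for which 1/ξ and -η are exchanged.
record Attained (V : ValuedRing) (ξ η : ValuedRing.Carrier V) (m : ℤ) : Set where
  open ValuedRing V
  open Geodesic V
  field
    f          : Carrier
    irrational : ∀ {p r} → Poly p → Poly r → p * f ≈ r → p ≈ 0#
    upper      : ∀ M → ¬ Le (error M ξ η f) (ℤ.- m ℤ.- + 1)
    upperʳ     : ∀ M → ¬ Le (error M η ξ f) (ℤ.- m ℤ.- + 1)
    lower      : ∀ h → ∃ λ M → Le (error M ξ η f) (ℤ.- m) × ¬ Le (height M ξ η) h

module Alphabet (V : ValuedRing) (κ : ℕ) (letter : Fin κ → ValuedRing.Carrier V)
  (Poly-letter : ∀ i → ValuedRing.Poly V (letter i))
  (Deg-letter : ∀ i → ValuedRing.Deg V (letter i) (+ 1))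
  (letter-surjective : ∀ {x} → ValuedRing.Poly V x → ValuedRing.Deg V x (+ 1) →
                       ∃ λ i → ValuedRing._≈_ V (letter i) x)
  (n : ℕ) where
  open ValuedRing V
  open Degree V
  open Geodesic V
  open Reversal V
  open ℕᵈ using (_%_)

  -- A block of length g = 2s has room for a past of s letters and a word of ℓ letters, each closed
  -- by a separator; W counts the words of length g. The form of ϖ makes `suc ϖ` reduce to
  -- `suc W ℕ.* g`.
  ℓ s g W ϖ : ℕ
  ℓ = suc n
  s = suc ℓ
  g = s ℕ.+ s
  W = κ ℕ.^ g
  ϖ = ℓ ℕ.+ s ℕ.+ W ℕ.* g

  separator : Carrier
  separator = Y + 1#

  Poly-separator : Poly separator
  Poly-separator = Poly-+ Poly-Y Poly-1

  Deg-separator : Deg separator (+ 1)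
  Deg-separator = Deg-+ Deg-Y (proj₁ Deg-1)

  -- Positions congruent to ℓ modulo ℓ + 1 carry the separator. The blocks of length g
  -- run through all words of length g, except that the separators overwrite two letters.
  block : Fin (suc W) → Fin g → Fin κ
  -- An extra block of letters Y makes the number of blocks a successor and hence the period visibly
  -- nonzero.
  block zero    _ = proj₁ (letter-surjective Poly-Y Deg-Y)
  block (suc w) t = Fin.finToFun w t

  at : ℕ → Fin κ → Carrier
  at i k with i % s ℕ.≟ ℓ
  ... | yes _ = separator
  ... | no _  = letter k

  Poly-at : ∀ i k → Poly (at i k)
  Poly-at i k with i % s ℕ.≟ ℓ
  ... | yes _ = Poly-separator
  ... | no _  = Poly-letter k

  Deg-at : ∀ i k → Deg (at i k) (+ 1)
  Deg-at i k with i % s ℕ.≟ ℓ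
  ... | yes _ = Deg-separator
  ... | no _  = Deg-letter k

  at-separator : ∀ i k → i % s ≡ ℓ → at i k ≡ separator
  at-separator i k e with i % s ℕ.≟ ℓ
  ... | yes _ = ≡.refl
  ... | no ≢  = ⊥-elim (≢ e)

  at-letter : ∀ i k → ¬ i % s ≡ ℓ → at i k ≡ letter k
  at-letter i k ≢ with i % s ℕ.≟ ℓ
  ... | yes e = ⊥-elim (≢ e)
  ... | no _  = ≡.refl

  at-cong : ∀ i j k → i % s ≡ j % s → at i k ≡ at j k
  at-cong i j k e with i % s ℕ.≟ ℓ
  ... | yes e′ = ≡.sym (at-separator j k (≡.trans (≡.sym e) e′))
  ... | no ≢   = ≡.sym (at-letter j k (λ e′ → ≢ (≡.trans e e′)))

  digit : ℕ → Fin κ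
  digit i = let (q , t) = Fin.remQuot {suc W} g (i ℕᵈ.mod (suc W ℕ.* g)) in block q t

  open PeriodicLine V (λ i → at i (digit i)) (λ i → Poly-at i _) (λ i → Deg-at i _) ϖ public hiding (_%_)

  private
    mod-toℕ : ∀ {m} (i : Fin (suc m)) → toℕ i ℕᵈ.mod suc m ≡ i
    mod-toℕ {m} i = Finₚ.toℕ-injective (≡.trans (Finₚ.toℕ-fromℕ< (ℕᵈ.m%n<n (toℕ i) (suc m)))
      (ℕᵈ.m<n⇒m%n≡m (Finₚ.toℕ<n i)))

  aR-separator : ∀ i → i % s ≡ ℓ → aR i ≡ separator
  aR-separator i e = at-separator (i % period) _
    (≡.trans (ℕᵈ.m∣n⇒o%n%m≡o%m s period i (divides (2 ℕ.* suc W) (lem s (suc W)))) e)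
    where
    lem : ∀ s W → W ℕ.* (s ℕ.+ s) ≡ 2 ℕ.* W ℕ.* s
    lem = ring-ℕ

  find-block : ∀ (D : ℕ → Fin κ) → ∃ λ i → i % s ≡ 0 × ∀ t → t ℕ.< g → aR (i ℕ.+ t) ≡ at t (D t)
  find-block D = g ℕ.* toℕ (suc w) , start , λ t t<g → letters t t<g
    where
    w : Fin W
    w = Fin.funToFin {g} {κ} (λ t → D (toℕ t))
    lem : ∀ s x → (s ℕ.+ s) ℕ.* x ≡ 2 ℕ.* x ℕ.* s
    lem = ring-ℕ
    start : (g ℕ.* toℕ (suc w)) % s ≡ 0
    start = ≡.trans (≡.cong (_% s) (lem s (toℕ (suc w)))) (ℕᵈ.[m+kn]%n≡m%n 0 (2 ℕ.* toℕ (suc w)) s)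
    letters : ∀ t → t ℕ.< g → aR (g ℕ.* toℕ (suc w) ℕ.+ t) ≡ at t (D t)
    letters t t<g = begin
      aR (g ℕ.* toℕ (suc w) ℕ.+ t)   ≡⟨ ≡.cong aR (≡.trans (≡.cong (g ℕ.* toℕ (suc w) ℕ.+_) (≡.sym toℕ-t)) (≡.sym (Finₚ.toℕ-combine (suc w) t′))) ⟩
      aR (toℕ x)                     ≡⟨ ≡.cong (λ i → at i (digit i)) (ℕᵈ.m<n⇒m%n≡m (Finₚ.toℕ<n x)) ⟩
      at (toℕ x) (digit (toℕ x))     ≡⟨ ≡.cong (λ z → at (toℕ x) (block (proj₁ z) (proj₂ z)))
                                          (≡.trans (≡.cong (Fin.remQuot {suc W} g) (mod-toℕ x)) (Finₚ.remQuot-combine {suc W} (suc w) t′)) ⟩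
      at (toℕ x) (Fin.finToFun w t′) ≡⟨ ≡.cong (at (toℕ x)) (≡.trans (Finₚ.finToFun-funToFin {g} {κ} (λ t → D (toℕ t)) t′) (≡.cong D toℕ-t)) ⟩
      at (toℕ x) (D t)               ≡⟨ at-cong (toℕ x) t (D t) x%s ⟩
      at t (D t)                     ∎
      where
      open ≡.≡-Reasoning
      t′ = Fin.fromℕ< t<g
      toℕ-t : toℕ t′ ≡ t
      toℕ-t = Finₚ.toℕ-fromℕ< t<g
      x : Fin (suc W ℕ.* g)
      x = Fin.combine (suc w) t′
      x%s : toℕ x % s ≡ t % s
      x%s = ≡.trans (≡.cong (_% s) (≡.trans (Finₚ.toℕ-combine (suc w) t′)
              (≡.trans (≡.cong₂ ℕ._+_ (lem s (toℕ (suc w))) toℕ-t) (ℕₚ.+-comm (2 ℕ.* toℕ (suc w) ℕ.* s) t))))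
            (ℕᵈ.[m+kn]%n≡m%n t (2 ℕ.* toℕ (suc w)) s)

  open Gap V using (Linear; module Spelling)
  open Spelling line using (Spells; Rich)

  indices : ∀ bs → Linear bs → ℕ → Fin κ
  indices [] _ _                             = proj₁ (letter-surjective Poly-Y Deg-Y)
  indices (b ∷ bs) ((Pb , db) , lin) zero    = proj₁ (letter-surjective Pb db)
  indices (b ∷ bs) ((Pb , db) , lin) (suc u) = indices bs lin u

  spells : ∀ bs (lin : Linear bs) j → (∀ u → u ℕ.< length bs → aR (j ℕ.+ u) ≡ letter (indices bs lin u)) → Spells bs j
  spells [] lin j p                       = tt
  spells (b ∷ bs) ((Pb , db) , lin) j p =
    trans (sym (proj₂ (letter-surjective Pb db)))
      (reflexive (≡.trans (≡.sym (p 0 (ℕ.s≤s ℕ.z≤n))) (≡.cong aR (ℕₚ.+-identityʳ j)))) ,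
    spells bs lin (suc j) (λ u u< → ≡.trans (≡.cong aR (≡.sym (ℕₚ.+-suc j u))) (p (suc u) (ℕ.s≤s u<)))

  private
    past-then : Fin κ → (ℕ → Fin κ) → ℕ → Fin κ
    past-then c D t with t ℕ.<? s
    ... | yes _ = c
    ... | no _  = D (t ℕ.∸ s)

    past-then-< : ∀ c D t → t ℕ.< s → past-then c D t ≡ c
    past-then-< c D t t<s with t ℕ.<? s
    ... | yes _  = ≡.refl
    ... | no t≮s = ⊥-elim (t≮s t<s)

    past-then-≥ : ∀ c D u → past-then c D (s ℕ.+ u) ≡ D u
    past-then-≥ c D u with s ℕ.+ u ℕ.<? s
    ... | yes lt = ⊥-elim (ℕₚ.m+n≮m s u lt)
    ... | no _   = ≡.cong D (ℕₚ.m+n∸m≡n s u)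

  -- Counted from the start of a block, x stands at ℓ - 1, a separator at ℓ and the word from ℓ + 1
  -- on; with at most ℓ letters it ends before the next separator.
  record Occurrence (bs : List Carrier) (x : Carrier) : Set where
    field
      i      : ℕ
      i%s    : i % s ≡ 0
      before : aR (i ℕ.+ n) ≈ x
      here   : Spells bs (2 ℕ.+ (i ℕ.+ n))

  occurrence : ∀ bs → length bs ℕ.≤ ℓ → Linear bs → ∀ {x} → Poly x → Deg x (+ 1) → Occurrence bs x
  occurrence bs len lin {x} Px dx = record
    { i = i
    ; i%s = i%s
    ; before = trans (reflexive (≡.trans (letters n n<g)
        (≡.trans (at-letter n _ n%s≢ℓ) (≡.cong letter (past-then-< c D n n<s))))) (proj₂ (letter-surjective Px dx))
    ; here = spells bs lin _ λ u u< → ≡.trans (≡.cong aR (lem i n u))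
        (≡.trans (letters (s ℕ.+ u) (ℕₚ.+-monoʳ-< s (u<s u u<)))
          (≡.trans (at-letter (s ℕ.+ u) _ (λ e → ℕₚ.<⇒≢ (ℕₚ.<-≤-trans u< len)
                     (≡.trans (≡.sym (residue-shift ℓ s u (ℕᵈ.n%n≡0 s) (ℕₚ.≤-pred (u<s u u<)))) e)))
                   (≡.cong letter (past-then-≥ c D u)))) }
    where
    c = proj₁ (letter-surjective Px dx)
    D = indices bs lin
    found = find-block (past-then c D)
    i = proj₁ found
    i%s = proj₁ (proj₂ found)
    letters = proj₂ (proj₂ found)
    n<s : n ℕ.< s
    n<s = ℕₚ.m≤n⇒m≤1+n ℕₚ.≤-refl
    n<g : n ℕ.< g
    n<g = ℕₚ.<-≤-trans n<s (ℕₚ.m≤m+n s s)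
    n%s≢ℓ : ¬ n % s ≡ ℓ
    n%s≢ℓ e = ℕₚ.1+n≢n (≡.sym (≡.trans (≡.sym (ℕᵈ.m≤n⇒m%n≡m (ℕₚ.n≤1+n n))) e))
    u<s : ∀ u → u ℕ.< length bs → u ℕ.< s
    u<s u u< = ℕₚ.m≤n⇒m≤1+n (ℕₚ.<-≤-trans u< len)
    lem : ∀ i n u → 2 ℕ.+ (i ℕ.+ n) ℕ.+ u ≡ i ℕ.+ (2 ℕ.+ n ℕ.+ u)
    lem = ring-ℕ

  separator-at : ∀ {bs x} (o : Occurrence bs x) → aR (suc (Occurrence.i o ℕ.+ n)) ≡ separator
  separator-at o = aR-separator (suc (i ℕ.+ n)) (≡.trans (≡.cong (_% s) (≡.sym (ℕₚ.+-suc i n)))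
    (residue-shift ℓ i ℓ i%s ℕₚ.≤-refl))
    where open Occurrence o

  -- The pasts are Y and Y + 1, followed by the same separator. The two letters differ by a
  -- constant, and the two inversions between them and the word each lower the degree of the
  -- difference by 2: this is the constant 4.
  rich : Rich ℓ
  rich bs len lin = _ , _ , Occurrence.here o₁ , Occurrence.here o₂ ,
    Deg-resp (sym (difference (η-next (suc j₁)) (η-next (suc j₂))))
      (Deg-* (Deg-* (dη (suc (suc j₁))) (dη (suc (suc j₂)))) (Deg-resp (trans (sym (+-identityˡ _)) (+-congʳ (sym separators)))
        (Deg-resp (sym (difference (η-next j₂) (η-next j₁)))
          (Deg-* (Deg-* (dη (suc j₂)) (dη (suc j₁))) (Deg-+ (Deg-resp (sym letters) (Deg-neg Deg-1))
            (Le-sub (proj₁ (dη j₁)) (proj₁ (dη j₂))))))))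
    where
    o₁ = occurrence bs len lin Poly-Y Deg-Y
    o₂ = occurrence bs len lin Poly-separator Deg-separator
    j₁ = Occurrence.i o₁ ℕ.+ n
    j₂ = Occurrence.i o₂ ℕ.+ n
    dη : ∀ i → Deg (η i) -1ℤ
    dη = Line.Deg-η line
    separators : aR (suc j₂) - aR (suc j₁) ≈ 0#
    separators = trans (+-cong (reflexive (separator-at o₂)) (-‿cong (reflexive (separator-at o₁)))) (-‿inverseʳ _)
    lem : ∀ y → y - (y + 1#) ≈ - 1#
    lem = solve 1 (λ y → y :- (y :+ con (+ 1)) := :- con (+ 1)) refl
    letters : aR j₁ - aR j₂ ≈ - 1#
    letters = trans (+-cong (Occurrence.before o₁) (-‿cong (Occurrence.before o₂))) (lem Y)

  module Word (T : ℕ) (w : ℕ → Carrier) (Poly-w : ∀ t → Poly (w t)) (Deg-w : ∀ t → Deg (w t) (+ 1)) where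

    -- The partial quotients w 0, …, w (T - 1), Y² repeated for ever.
    quotient : ℕ → Carrier
    quotient j with j % suc T ℕ.≟ T
    ... | yes _ = Y * Y
    ... | no _  = w (j % suc T)

    excess : ℕ → ℕ
    excess j with j % suc T ℕ.≟ T
    ... | yes _ = 1
    ... | no _  = 0

    Poly-quotient : ∀ j → Poly (quotient j)
    Poly-quotient j with j % suc T ℕ.≟ T
    ... | yes _ = Poly-* Poly-Y Poly-Y
    ... | no _  = Poly-w _

    Deg-quotient : ∀ j → Deg (quotient j) (+ suc (excess j))
    Deg-quotient j with j % suc T ℕ.≟ T
    ... | yes _ = Deg-* Deg-Y Deg-Y
    ... | no _  = Deg-w _

    excess-last : ∀ j → j % suc T ≡ T → ¬ excess j ≡ 0
    excess-last j e with j % suc T ℕ.≟ T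
    ... | yes _ = λ ()
    ... | no ≢  = ⊥-elim (≢ e)

    quotient-word : ∀ j t → j % suc T ≡ 0 → t ℕ.< T → quotient (j ℕ.+ t) ≡ w t
    quotient-word j t e t<T with (j ℕ.+ t) % suc T ℕ.≟ T
    ... | yes e′ = ⊥-elim (ℕₚ.<⇒≢ t<T (≡.trans (≡.sym (residue-shift T j t e (ℕₚ.<⇒≤ t<T))) e′))
    ... | no _   = ≡.cong w (residue-shift T j t e (ℕₚ.<⇒≤ t<T))

    window : ∀ j → ∃ λ t → t ℕ.≤ T × ¬ excess (j ℕ.+ t) ≡ 0
    window j = T ℕ.∸ j % suc T , ℕₚ.m∸n≤m T (j % suc T) , excess-last _ (last-residue T j)

    -- The quotient Y² recurs every T + 1 positions, so T linear quotients in a row fill exactly one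
    -- block.
    linear-run-start : ∀ j → (∀ t → t ℕ.< T → excess (j ℕ.+ t) ≡ 0) → j % suc T ≡ 0
    linear-run-start j linear with j % suc T ℕ.≟ 0
    ... | yes e = e
    ... | no ≢0 = ⊥-elim (excess-last _ (last-residue T j) (linear _
            (ℕₚ.∸-monoʳ-< (ℕₚ.n≢0⇒n>0 ≢0) (ℕₚ.≤-pred (ℕᵈ.m%n<n j (suc T))))))

    open Expansion V quotient excess Poly-quotient Deg-quotient public using (ζ; ζ-irrational)
    open UpperBounds V quotient excess Poly-quotient Deg-quotient public using (error-even; error-odd)
    open LowerBounds V quotient excess Poly-quotient Deg-quotient
    open Approximation line public using (agreement; difference-≤)
    open Approximation line using (approximation)

    word-start : ∀ m → suc (T ℕ.+ m ℕ.* suc T) % suc T ≡ 0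
    word-start m = ℕᵈ.[m+kn]%n≡m%n 0 (suc m) (suc T)

    approximations : ∀ i {e} → (∀ J → J % suc T ≡ 0 → Le (ξ i - ζ J) e) → ∀ h →
      ∃ λ M → Le (error M (ξ 0) (η 0) (ζ 0)) (e ℤ.- + 1) × ¬ Le (height M (ξ 0) (η 0)) h
    approximations i {e} close h =
      -- A position of Y² so far out that the height, of degree at least J, exceeds h.
      let J = T ℕ.+ suc ℤ.∣ h ∣ ℕ.* suc T
          (M , err , w , J≤w , dw) = approximation i J (excess-last J (≡.trans (ℕᵈ.[m+kn]%n≡m%n T (suc ℤ.∣ h ∣) (suc T)) (ℕᵈ.m≤n⇒m%n≡m ℕₚ.≤-refl)))
                                       (close (suc J) (word-start (suc ℤ.∣ h ∣)))
          (M₀ , err₀ , height₀) = to-origin i M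
      in M₀ , err₀ (ζ 0) err , λ low → ℤₚ.<⇒≱ (ℤₚ.<-≤-trans h<J J≤w) (Deg-≤ dw (height₀ low))
      where
      h<J : h ℤ.< + (T ℕ.+ suc ℤ.∣ h ∣ ℕ.* suc T)
      h<J = ℤₚ.≤-<-trans (i≤∣i∣ h) (ℤ.+<+ (ℕₚ.≤-trans (ℕₚ.m≤m*n (suc ℤ.∣ h ∣) (suc T)) (ℕₚ.m≤n+m _ T)))

  attained-even : ∀ K → Attained V (ξ 0) (η 0) (+ suc K ℤ.+ + suc K)
  attained-even K = record
    { f = ζ 0
    ; irrational = ζ-irrational 0
    ; upper  = λ M le → error-even line K window M 0 (Le-cast (lem₁ (+ suc K)) le)
    ; upperʳ = λ M le → error-even (reverse line) K window M 0 (Le-cast (lem₁ (+ suc K)) le)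
    ; lower = λ h → let (M , le , high) = approximations 0 close h in M , Le-cast (lem₂ (+ K)) le , high }
    where
    open Word K aR (λ t → Link.Poly-a (linkR t)) (λ t → Link.Deg-a (linkR t))
    lem₁ : ∀ k → ℤ.- (k ℤ.+ k) ℤ.- + 1 ≡ ℤ.- k ℤ.- k ℤ.- + 1
    lem₁ = ring-ℤ
    lem₂ : ∀ k → ℤ.- + 1 ℤ.- k ℤ.- k ℤ.- + 1 ≡ ℤ.- (+ 1 ℤ.+ k ℤ.+ (+ 1 ℤ.+ k))
    lem₂ = ring-ℤ
    -- The summand -1 comes from the tails after the block, both of absolute value at most 1/q: one
    -- common edge beyond the K letters.
    close : ∀ J → J % suc K ≡ 0 → Le (ξ 0 - ζ J) (ℤ.- + 1 ℤ.- + K ℤ.- + K)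
    close J e = agreement K 0 J
      (λ t t<K → reflexive (≡.trans (quotient-word J t e t<K) (≡.cong aR (≡.sym (nexts-+ t 0)))))
      (Le-sub (Right.ζ≤ _) (Expansion.ζ≤ V quotient excess Poly-quotient Deg-quotient _))

  nexts-concat : ∀ (L : Line) a b i → Line.nexts L (a ℕ.+ b) i ≡ Line.nexts L b (Line.nexts L a i)
  nexts-concat L zero b i    = ≡.refl
  nexts-concat L (suc a) b i = nexts-concat L a b (Line.next L i)

  -- Otherwise (1 - v) Y = v, and the polynomial 1 - v would have degree -1.
  Y-not-multiple : ∀ {v} → Poly v → Deg v (+ 0) → ¬ Y ≈ v * separator
  Y-not-multiple {v} Pv dv e = absurd (Poly-Deg-≥0 (Poly-sub Poly-1 Pv) (Deg-cancel {m = ℤ.- + 1} Deg-Y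
    (Deg-resp (sym (trans (lem v Y) (modulo 1# e))) dv)))
    where
    lem : ∀ v y → (1# - v) * y ≈ v + 1# * (y - v * (y + 1#))
    lem = solve 2 (λ v y → (con (+ 1) :- v) :* y := v :+ con (+ 1) :* (y :- v :* (y :+ con (+ 1)))) refl
    absurd : ¬ (+ 0 ℤ.≤ ℤ.- + 1)
    absurd ()

  Separated : Line → Set
  Separated L = ∀ i → ∃ λ u → u ℕ.≤ ℓ × Line.aR L (Line.nexts L u i) ≈ separator

  line-separated : Separated line
  line-separated i = ℓ ℕ.∸ i % s , ℕₚ.m∸n≤m ℓ (i % s) ,
    reflexive (≡.trans (≡.cong aR (nexts-+ (ℓ ℕ.∸ i % s) i)) (aR-separator (i ℕ.+ (ℓ ℕ.∸ i % s)) (last-residue ℓ i)))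

  -- Going back adds ϖ, which is -1 modulo s. So `i % s` steps back lead to a multiple of s, and the
  -- letter before it is a separator.
  reverse-separated : Separated (reverse line)
  reverse-separated i = u , ℕₚ.≤-pred (ℕᵈ.m%n<n i s) ,
    reflexive (≡.trans (≡.cong (λ z → aR (z ℕ.+ ϖ)) (nexts-prev u i)) (aR-separator (i ℕ.+ u ℕ.* ϖ ℕ.+ ϖ) (≡.trans
      (≡.cong (_% s) (≡.trans (≡.cong (λ z → z ℕ.+ u ℕ.* ϖ ℕ.+ ϖ) (ℕᵈ.m≡m%n+[m/n]*n i s)) (lem n W u (i ℕᵈ./ s))))
      (≡.trans (ℕᵈ.[m+kn]%n≡m%n ℓ (1 ℕ.+ 2 ℕ.* W ℕ.+ i ℕᵈ./ s ℕ.+ u ℕ.* 2 ℕ.* (1 ℕ.+ W)) s) (ℕᵈ.m≤n⇒m%n≡m ℕₚ.≤-refl)))))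
    where
    u = i % s
    nexts-prev : ∀ t i → Line.nexts (reverse line) t i ≡ i ℕ.+ t ℕ.* ϖ
    nexts-prev zero i    = ≡.sym (ℕₚ.+-identityʳ i)
    nexts-prev (suc t) i = ≡.trans (nexts-prev t (i ℕ.+ ϖ)) (ℕₚ.+-assoc i ϖ (t ℕ.* ϖ))
    lem : ∀ n W u q → u ℕ.+ q ℕ.* (2 ℕ.+ n) ℕ.+ u ℕ.* (1 ℕ.+ n ℕ.+ (2 ℕ.+ n) ℕ.+ W ℕ.* (2 ℕ.+ n ℕ.+ (2 ℕ.+ n)))
            ℕ.+ (1 ℕ.+ n ℕ.+ (2 ℕ.+ n) ℕ.+ W ℕ.* (2 ℕ.+ n ℕ.+ (2 ℕ.+ n))) ≡
          1 ℕ.+ n ℕ.+ (1 ℕ.+ 2 ℕ.* W ℕ.+ q ℕ.+ u ℕ.* 2 ℕ.* (1 ℕ.+ W)) ℕ.* (2 ℕ.+ n)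
    lem = ring-ℕ

  -- The word aᵢ … aᵢ₊ₖ₋₁ Y, where aᵢ … aᵢ₊ₖ₋₁ ends with ℓ letters Y and is followed by a
  -- separator on the line: ℓ + 1 consecutive letters Y occur nowhere, even up to units.
  module Odd (K : ℕ) (ℓ≤K : ℓ ℕ.≤ K) where

    Ys : List Carrier
    Ys = replicate ℓ Y

    Linear-Ys : ∀ m → Linear (replicate m Y)
    Linear-Ys zero    = tt
    Linear-Ys (suc m) = (Poly-Y , Deg-Y) , Linear-Ys m

    spelled : ∀ m j → Spells (replicate m Y) j → ∀ u → u ℕ.< m → Y ≈ aR (j ℕ.+ u)
    spelled (suc m) j (e , sp) zero _             = trans e (reflexive (≡.cong aR (≡.sym (ℕₚ.+-identityʳ j))))
    spelled (suc m) j (e , sp) (suc u) (ℕ.s≤s u<m) =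
      trans (spelled m (suc j) sp u u<m) (reflexive (≡.cong aR (≡.sym (ℕₚ.+-suc j u))))

    occ : Occurrence Ys Y
    occ = occurrence Ys (ℕₚ.≤-reflexive (Listₚ.length-replicate ℓ)) (Linear-Ys ℓ) Poly-Y Deg-Y

    j₀ end start : ℕ
    j₀ = 2 ℕ.+ (Occurrence.i occ ℕ.+ n)
    -- The K extra periods keep the subtraction in `start` from being truncated.
    end = j₀ ℕ.+ ℓ ℕ.+ K ℕ.* period
    start = end ℕ.∸ K

    start+K : start ℕ.+ K ≡ end
    start+K = ℕₚ.m∸n+n≡m (ℕₚ.≤-trans (ℕₚ.m≤m*n K period) (ℕₚ.m≤n+m (K ℕ.* period) (j₀ ℕ.+ ℓ)))

    aR-Y : ∀ u → u ℕ.< ℓ → aR (start ℕ.+ (K ℕ.∸ ℓ ℕ.+ u)) ≈ Y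
    aR-Y u u<ℓ = sym (trans (spelled ℓ j₀ (Occurrence.here occ) u u<ℓ)
      (reflexive (≡.trans (≡.sym (aR-periodic (j₀ ℕ.+ u) K)) (≡.cong aR position))))
      where
      lem₁ : ∀ x k u ℓ → x ℕ.+ (k ℕ.+ u) ℕ.+ ℓ ≡ x ℕ.+ (k ℕ.+ ℓ) ℕ.+ u
      lem₁ = ring-ℕ
      lem₂ : ∀ j ℓ p u → j ℕ.+ ℓ ℕ.+ p ℕ.+ u ≡ j ℕ.+ u ℕ.+ p ℕ.+ ℓ
      lem₂ = ring-ℕ
      position : j₀ ℕ.+ u ℕ.+ K ℕ.* period ≡ start ℕ.+ (K ℕ.∸ ℓ ℕ.+ u)
      position = ℕₚ.+-cancelʳ-≡ ℓ _ _ (≡.sym (≡.trans (lem₁ start (K ℕ.∸ ℓ) u ℓ)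
        (≡.trans (≡.cong (λ z → start ℕ.+ z ℕ.+ u) (ℕₚ.m∸n+n≡m ℓ≤K))
          (≡.trans (≡.cong (ℕ._+ u) start+K) (lem₂ j₀ ℓ (K ℕ.* period) u)))))

    aR-end : aR end ≡ separator
    aR-end = ≡.trans (aR-periodic (j₀ ℕ.+ ℓ) K) (aR-separator (j₀ ℕ.+ ℓ)
      (≡.trans (≡.cong (_% s) (lem (Occurrence.i occ) n))
        (residue-shift ℓ (Occurrence.i occ ℕ.+ 1 ℕ.* s) ℓ
          (≡.trans (ℕᵈ.[m+kn]%n≡m%n (Occurrence.i occ) 1 s) (Occurrence.i%s occ)) ℕₚ.≤-refl)))
      where
      lem : ∀ i n → 2 ℕ.+ (i ℕ.+ n) ℕ.+ (1 ℕ.+ n) ≡ i ℕ.+ 1 ℕ.* (2 ℕ.+ n) ℕ.+ (1 ℕ.+ n)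
      lem = ring-ℕ

    w : ℕ → Carrier
    w t with t ℕ.<? K
    ... | yes _ = aR (start ℕ.+ t)
    ... | no _  = Y

    Poly-w : ∀ t → Poly (w t)
    Poly-w t with t ℕ.<? K
    ... | yes _ = Link.Poly-a (linkR (start ℕ.+ t))
    ... | no _  = Poly-Y

    Deg-w : ∀ t → Deg (w t) (+ 1)
    Deg-w t with t ℕ.<? K
    ... | yes _ = Link.Deg-a (linkR (start ℕ.+ t))
    ... | no _  = Deg-Y

    w-< : ∀ t → t ℕ.< K → w t ≡ aR (start ℕ.+ t)
    w-< t t<K with t ℕ.<? K
    ... | yes _  = ≡.refl
    ... | no t≮K = ⊥-elim (t≮K t<K)

    w-K : w K ≡ Y
    w-K with K ℕ.<? K
    ... | yes lt = ⊥-elim (ℕₚ.<-irrefl ≡.refl lt)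
    ... | no _   = ≡.refl

    w-Y : ∀ u → u ℕ.≤ ℓ → w (K ℕ.∸ ℓ ℕ.+ u) ≈ Y
    w-Y u u≤ℓ with u ℕ.≟ ℓ
    ... | yes ≡.refl = reflexive (≡.trans (≡.cong w (ℕₚ.m∸n+n≡m ℓ≤K)) w-K)
    ... | no u≢ℓ     = trans (reflexive (w-< _ (ℕₚ.<-≤-trans (ℕₚ.+-monoʳ-< (K ℕ.∸ ℓ) u<ℓ) (ℕₚ.≤-reflexive (ℕₚ.m∸n+n≡m ℓ≤K)))))
                             (aR-Y u u<ℓ)
      where u<ℓ = ℕₚ.≤∧≢⇒< u≤ℓ u≢ℓ

    open Word (suc K) w Poly-w Deg-w

    -- Among any ℓ + 1 consecutive letters of the line there is a separator; it would have to match
    -- one of the last ℓ + 1 letters of the block, which all equal Y.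
    mismatch : ∀ L → Separated L → ∀ j i → ¬ (∀ t → t ℕ.< suc K → excess (j ℕ.+ t) ≡ 0 ×
      ∃ λ v → (Poly v × Deg v (+ 0)) × quotient (j ℕ.+ t) ≈ v * Line.aR L (Line.nexts L t i))
    mismatch L sep j i match =
      let (u , u≤ℓ , e) = sep (Line.nexts L (K ℕ.∸ ℓ) i)
          t = K ℕ.∸ ℓ ℕ.+ u
          t<T = ℕ.s≤s (ℕₚ.≤-trans (ℕₚ.+-monoʳ-≤ (K ℕ.∸ ℓ) u≤ℓ) (ℕₚ.≤-reflexive (ℕₚ.m∸n+n≡m ℓ≤K)))
          (_ , v , (Pv , dv) , e′) = match t t<T
      in Y-not-multiple Pv dv (trans (sym (w-Y u u≤ℓ))
           (trans (reflexive (≡.sym (quotient-word j t (linear-run-start j (λ t t<T → proj₁ (match t t<T))) t<T)))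
             (trans e′ (*-congˡ (trans (reflexive (≡.cong (Line.aR L) (nexts-concat L (K ℕ.∸ ℓ) u i))) e)))))

    attained : Attained V (ξ 0) (η 0) (+ suc K ℤ.+ + suc K ℤ.+ + 1)
    attained = record
      { f = ζ 0
      ; irrational = ζ-irrational 0
      ; upper  = λ M le → error-odd line (suc K) window (mismatch line line-separated) M 0 (Le-cast (lem₁ (+ K)) le)
      ; upperʳ = λ M le → error-odd (reverse line) (suc K) window (mismatch (reverse line) reverse-separated) M 0
                            (Le-cast (lem₁ (+ K)) le)
      ; lower = λ h → let (M , le , high) = approximations start close h in M , Le-cast (lem₂ (+ K)) le , high }
      where
      lem₁ : ∀ k → ℤ.- (+ 1 ℤ.+ k ℤ.+ (+ 1 ℤ.+ k) ℤ.+ + 1) ℤ.- + 1 ≡ ℤ.- (+ 2 ℤ.+ k) ℤ.- (+ 2 ℤ.+ k)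
      lem₁ = ring-ℤ
      lem₂ : ∀ k → ℤ.- + 2 ℤ.- k ℤ.- k ℤ.- + 1 ≡ ℤ.- (+ 1 ℤ.+ k ℤ.+ (+ 1 ℤ.+ k) ℤ.+ + 1)
      lem₂ = ring-ℤ
      lem₃ : ∀ y → - 1# ≈ y - (y + 1#)
      lem₃ = solve 1 (λ y → :- con (+ 1) := y :- (y :+ con (+ 1))) refl
      -- After K common letters the block has Y and the line Y + 1. They differ by a constant, so
      -- the tails differ by at most q⁻²: two more edges where the even case has one.
      close : ∀ J → J % suc (suc K) ≡ 0 → Le (ξ start - ζ J) (ℤ.- + 2 ℤ.- + K ℤ.- + K)
      close J e = agreement K start J
        (λ t t<K → reflexive (≡.trans (quotient-word J t e (ℕₚ.m≤n⇒m≤1+n t<K))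
          (≡.trans (w-< t t<K) (≡.cong aR (≡.sym (nexts-+ t start))))))
        (≡.subst (λ z → Le (ξ z - ζ (J ℕ.+ K)) (ℤ.- + 2)) (≡.sym (≡.trans (nexts-+ K start) start+K))
          (difference-≤ end (J ℕ.+ K)
            (Le-resp (trans (lem₃ Y) (+-cong
                (reflexive (≡.sym (≡.trans (quotient-word J K e ℕₚ.≤-refl) w-K)))
                (-‿cong (reflexive (≡.sym aR-end)))))
              (Le-neg (proj₁ Deg-1)))
            (Le-mono ℤ.-≤+ (Le-sub (Expansion.ζ≤ V quotient excess Poly-quotient Deg-quotient _) (Right.ζ≤ _)))))

-- The properties of α from which its spectrum is computed

-- The two gap fields treat the two orientations of the given geodesic; the prolonging geodesic N
-- can be taken with the ends 1/ξ₀ and -η₀ in this order in both cases.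
record QuadraticSpectrum (V : ValuedRing) (ℓ : ℕ) : Set where
  open ValuedRing V
  open Geodesic V
  field
    α ξ₀ η₀ A B C : Carrier
    ξ₀α≈1        : ξ₀ * α ≈ 1#
    Deg-ξ₀       : Deg ξ₀ -1ℤ
    Deg-α-ασ     : Deg (α - (- η₀)) (+ 1)
    α-irrational : ∀ {p r} → Poly p → Poly r → p * α ≈ r → p ≈ 0#
    Poly-A       : Poly A
    Poly-B       : Poly B
    Poly-C       : Poly C
    A≉0          : ¬ A ≈ 0#
    α-root       : A * (α * α) + (B * α + C) ≈ 0#
    ασ-root      : A * (- η₀ * - η₀) + (B * - η₀ + C) ≈ 0#
    even         : ∀ K → Attained V ξ₀ η₀ (+ suc K ℤ.+ + suc K)
    odd          : ∀ K → ℓ ℕ.≤ K → Attained V ξ₀ η₀ (+ suc K ℤ.+ + suc K ℤ.+ + 1)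
    minimal      : ∀ f → (∀ {p r} → Poly p → Poly r → p * f ≈ r → p ≈ 0#) → ∀ h →
                   ¬ (∀ N → Le (error N ξ₀ η₀ f) (ℤ.- + 2) → Le (height N ξ₀ η₀) h)
    gap-right    : ∀ f h k → suc k ℕ.≤ ℓ → ∀ M → Le (error M ξ₀ η₀ f) (ℤ.- + suc k ℤ.- + suc k ℤ.- + 1) →
                   ¬ Le (height M ξ₀ η₀) (h ℤ.+ + 4) →
                   ¬ (∀ N → Le (error N ξ₀ η₀ f) (ℤ.- + suc k ℤ.- + suc k ℤ.- + 2) → Le (height N ξ₀ η₀) h)
    gap-left     : ∀ f h k → suc k ℕ.≤ ℓ → ∀ M → Le (error M η₀ ξ₀ f) (ℤ.- + suc k ℤ.- + suc k ℤ.- + 1) →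
                   ¬ Le (height M η₀ ξ₀) (h ℤ.+ + 4) →
                   ¬ (∀ N → Le (error N ξ₀ η₀ f) (ℤ.- + suc k ℤ.- + suc k ℤ.- + 2) → Le (height N ξ₀ η₀) h)

module _ (V : ValuedRing) (κ : ℕ) (letter : Fin κ → ValuedRing.Carrier V)
  (Poly-letter : ∀ i → ValuedRing.Poly V (letter i))
  (Deg-letter : ∀ i → ValuedRing.Deg V (letter i) (+ 1))
  (letter-surjective : ∀ {x} → ValuedRing.Poly V x → ValuedRing.Deg V x (+ 1) →
                       ∃ λ i → ValuedRing._≈_ V (letter i) x)
  (n : ℕ) where
  open ValuedRing V
  open Degree V
  open Geodesic V
  open Gap V using (minimum; gap)
  private
    module S = Alphabet V κ letter Poly-letter Deg-letter letter-surjective n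
    open S using (ξ; η; aR; line)

    from-origin : ∀ f {e h} → (∀ N → Le (error N (ξ 0) (η 0) f) e → Le (height N (ξ 0) (η 0)) h) →
                  ∀ N j → Le (error N (ξ j) (η j) f) e → Le (height N (ξ j) (η j)) h
    from-origin f shallow N j le = let (N₀ , e , h) = S.to-origin j N in h (shallow N₀ (e f le))

  spectrum : QuadraticSpectrum V (suc n)
  spectrum = record
    { α = S.α ; ξ₀ = ξ 0 ; η₀ = η 0 ; A = S.A ; B = S.B ; C = S.C
    ; ξ₀α≈1 = S.ξ-next 0
    ; Deg-ξ₀ = Line.Deg-ξ line 0
    ; Deg-α-ασ = Deg-resp (+-congˡ (double-neg (η 0)))
        (Deg-+ (Deg-+ (Link.Deg-a (S.linkR 0)) (Le-mono ℤ.-≤+ (S.Right.ζ≤ _))) (Le-mono ℤ.-≤+ (S.Left.ζ≤ _)))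
    ; α-irrational = λ {p} {r} Pp Pr e → Line.ξ-irrational line 1 Pp (Poly-sub Pr (Poly-* Pp (Link.Poly-a (S.linkR 0))))
        (trans (lem p (aR 0) (ξ 1)) (+-congʳ e))
    ; Poly-A = S.Poly-A ; Poly-B = S.Poly-B ; Poly-C = S.Poly-C ; A≉0 = S.A≉0
    ; α-root = S.α-root ; ασ-root = S.ασ-root
    ; even = S.attained-even
    ; odd = S.Odd.attained
    ; minimal = λ f irr h shallow → minimum f irr line S.rich (from-origin f shallow)
    ; gap-right = λ f h k k< M le deep shallow → gap line line S.rich f k k< M 0 le deep (from-origin f shallow)
    ; gap-left = λ f h k k< M le deep shallow →
        gap (Reversal.reverse V line) line S.rich f k k< M 0 le deep (from-origin f shallow) }
    where
    lem : ∀ p a x → p * x ≈ p * (a + x) - p * a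
    lem = solve 3 (λ p a x → p :* x := p :* (a :+ x) :- p :* a) refl

-- Comparison with the distances in the statement

-- The quantities of the statement, in terms of matrices acting on the line.
module Comparison (V : ValuedRing) where
  open ValuedRing V
  open Degree V
  open Geodesic V
  open Mat
  open Reversal V using (turn)

  distance : (a b c d f γ γ′ : Carrier) → Carrier
  distance a b c d f γ γ′ = (f * (c * γ + d) - (a * γ + b)) * (c * γ′ + d)

  norm : (c d γ γ′ : Carrier) → Carrier
  norm c d γ γ′ = (c * γ + d) * (c * γ′ + d)

  -- The statement describes β as an image of α, whereas `error` uses the matrix that takes β back;
  -- up to a unit, this inverse is the adjugate.
  record Inverts (M : Mat) (a b c d : Carrier) : Set where
    field
      p≈ : p M ≈ d
      q≈ : q M ≈ - b
      r≈ : r M ≈ - c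
      s≈ : s M ≈ a

  inverse-matrix : ∀ a b c d u → Poly a → Poly b → Poly c → Poly d → Deg u (+ 0) → a * d - b * c ≈ u →
                   Σ Mat λ M → Inverts M a b c d
  inverse-matrix a b c d u Pa Pb Pc Pd du e = record
    { p = d ; q = - b ; r = - c ; s = a ; Poly-p = Pd ; Poly-q = Poly-neg Pb ; Poly-r = Poly-neg Pc ; Poly-s = Pa
    ; det = u ; Deg-det = du ; det-eq = trans (lem a b c d) e } ,
    record { p≈ = refl ; q≈ = refl ; r≈ = refl ; s≈ = refl }
    where
    lem : ∀ a b c d → d * a - - b * - c ≈ a * d - b * c
    lem = solve 4 (λ a b c d → d :* a :- (:- b) :* (:- c) := a :* d :- b :* c) refl

  Poly-det : ∀ M → Poly (det M)
  Poly-det M = Poly-resp (det-eq M) (Poly-sub (Poly-* (Poly-p M) (Poly-s M)) (Poly-* (Poly-q M) (Poly-r M)))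

  inverts : ∀ M a b c d → a ≈ s M → b ≈ - q M → c ≈ - r M → d ≈ p M → Inverts M a b c d
  inverts M a b c d ea eb ec ed = record
    { p≈ = sym ed ; q≈ = trans (double-neg (q M)) (-‿cong (sym eb))
    ; r≈ = trans (double-neg (r M)) (-‿cong (sym ec)) ; s≈ = sym ea }

  inverse-det : ∀ M a b c d u → Inverts M a b c d → det M ≈ u → a * d - b * c ≈ u
  inverse-det M a b c d u inv e = trans (lem a b c d)
    (trans (sym (+-cong (*-cong p≈ s≈) (-‿cong (*-cong q≈ r≈)))) (trans (det-eq M) e))
    where
    open Inverts inv
    lem : ∀ a b c d → a * d - b * c ≈ d * a - - b * - c
    lem = solve 4 (λ a b c d → a :* d :- b :* c := d :* a :- (:- b) :* (:- c)) refl

  vanishing-difference : ∀ x y z → x ≈ y → (x - y) * z ≈ 0#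
  vanishing-difference x y z e = trans (*-congʳ (trans (+-congʳ e) (-‿inverseʳ y))) (zeroˡ z)

  same-value : ∀ x y z → x ≈ z → y ≈ z → ∀ {m} → (Le x m → Le y m) × (Le y m → Le x m)
  same-value x y z ex ey = Le-resp (trans ex (sym ey)) , Le-resp (trans ey (sym ex))

  module _ {M a b c d} (inv : Inverts M a b c d) where
    open Inverts inv

    act-inverse : ∀ f → act M f ≈ₚ (d * f + - b , - c * f + a)
    act-inverse f = +-cong (*-congʳ p≈) q≈ , +-cong (*-congʳ r≈) s≈

    error-right : ∀ f α ξ η → ξ * α ≈ 1# → error M ξ η f ≈ ξ * distance a b c d f α (- η)
    error-right f α ξ η e = trans
      (*-cong (toward-cong ξ (act-inverse f)) (away-cong η {col M} {d , - c} (p≈ , r≈)))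
      (trans (lem a b c d f α ξ η) (modulo _ e))
      where
      lem : ∀ a b c d f α ξ η → ((d * f + - b) * ξ - (- c * f + a)) * (d + - c * η) ≈
            ξ * ((f * (c * α + d) - (a * α + b)) * (c * - η + d)) + ((a - c * f) * (d - c * η)) * (ξ * α - 1#)
      lem = solve 8 (λ a b c d f α ξ η → ((d :* f :+ (:- b)) :* ξ :- ((:- c) :* f :+ a)) :* (d :+ (:- c) :* η) :=
            ξ :* ((f :* (c :* α :+ d) :- (a :* α :+ b)) :* (c :* (:- η) :+ d)) :+ ((a :- c :* f) :* (d :- c :* η)) :* (ξ :* α :- con (+ 1))) refl

    height-right : ∀ α ξ η → ξ * α ≈ 1# → height M ξ η ≈ ξ * norm c d α (- η)
    height-right α ξ η e = trans
      (*-cong (toward-cong ξ {col M} {d , - c} (p≈ , r≈)) (away-cong η {col M} {d , - c} (p≈ , r≈)))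
      (trans (lem c d α ξ η) (modulo _ e))
      where
      lem : ∀ c d α ξ η → (d * ξ - - c) * (d + - c * η) ≈ ξ * ((c * α + d) * (c * - η + d)) + (- (c * (d - c * η))) * (ξ * α - 1#)
      lem = solve 5 (λ c d α ξ η → (d :* ξ :- (:- c)) :* (d :+ (:- c) :* η) :=
            ξ :* ((c :* α :+ d) :* (c :* (:- η) :+ d)) :+ (:- (c :* (d :- c :* η))) :* (ξ :* α :- con (+ 1))) refl

    error-left : ∀ f α ξ η → ξ * α ≈ 1# → error (turn M) η ξ f ≈ - ξ * distance a b c d f (- η) α
    error-left f α ξ η e = trans
      (*-cong (toward-cong η {act (turn M) f} {(- c) * f + a , - (d * f + - b)} (proj₂ (act-inverse f) , second))
              (away-cong ξ {col (turn M)} {(- c) , - d} (r≈ , -‿cong p≈)))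
      (trans (lem a b c d f α ξ η) (modulo _ e))
      where
      second : - p M * f + - q M ≈ - (d * f + - b)
      second = trans (+-cong (*-congʳ (-‿cong p≈)) (-‿cong q≈)) (lem′ d b f)
        where
        lem′ : ∀ d b f → - d * f + - (- b) ≈ - (d * f + - b)
        lem′ = solve 3 (λ d b f → (:- d) :* f :+ (:- (:- b)) := :- (d :* f :+ (:- b))) refl
      lem : ∀ a b c d f α ξ η → ((- c * f + a) * η - - (d * f + - b)) * (- c + - d * ξ) ≈
            - ξ * ((f * (c * - η + d) - (a * - η + b)) * (c * α + d)) + (c * (f * (c * - η + d) - (a * - η + b))) * (ξ * α - 1#)
      lem = solve 8 (λ a b c d f α ξ η → (((:- c) :* f :+ a) :* η :- (:- (d :* f :+ (:- b)))) :* ((:- c) :+ (:- d) :* ξ) :=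
            (:- ξ) :* ((f :* (c :* (:- η) :+ d) :- (a :* (:- η) :+ b)) :* (c :* α :+ d))
            :+ (c :* (f :* (c :* (:- η) :+ d) :- (a :* (:- η) :+ b))) :* (ξ :* α :- con (+ 1))) refl

    height-left : ∀ α ξ η → ξ * α ≈ 1# → height (turn M) η ξ ≈ - ξ * norm c d (- η) α
    height-left α ξ η e = trans
      (*-cong (toward-cong η {col (turn M)} {(- c) , - d} (r≈ , -‿cong p≈)) (away-cong ξ {col (turn M)} {(- c) , - d} (r≈ , -‿cong p≈)))
      (trans (lem c d α ξ η) (modulo _ e))
      where
      lem : ∀ c d α ξ η → (- c * η - - d) * (- c + - d * ξ) ≈ - ξ * ((c * - η + d) * (c * α + d)) + (c * (c * - η + d)) * (ξ * α - 1#)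
      lem = solve 5 (λ c d α ξ η → ((:- c) :* η :- (:- d)) :* ((:- c) :+ (:- d) :* ξ) :=
            (:- ξ) :* ((c :* (:- η) :+ d) :* (c :* α :+ d)) :+ (c :* (c :* (:- η) :+ d)) :* (ξ :* α :- con (+ 1))) refl

  -- E is measured against δ with |δ| = q, and e is E scaled by |θ| = 1/q.
  module Scaled {e θ E δ} (Deg-θ : Deg θ -1ℤ) (Deg-δ : Deg δ (+ 1)) (e≈ : e ≈ θ * E) where

    scale : ∀ {m} → Le E (m ℤ.+ + 1) → Le e m
    scale {m} le = Le-resp (sym e≈) (Le-cast (lem m) (Le-* (proj₁ Deg-θ) le))
      where
      lem : ∀ m → ℤ.- + 1 ℤ.+ (m ℤ.+ + 1) ≡ m
      lem = ring-ℤ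

    unscale : ∀ {m} → Le e m → Le E (m ℤ.+ + 1)
    unscale {m} le = Le-cancel Deg-θ (Le-cast (lem m) (Le-resp (trans e≈ (*-comm θ E)) le))
      where
      lem : ∀ m → m ≡ m ℤ.+ + 1 ℤ.+ ℤ.- + 1
      lem = ring-ℤ

    upper⇒ : ∀ n → (∀ m → Le δ m → Le E (m ℤ.+ ℤ.- n)) → Le e (ℤ.- n)
    upper⇒ n p = scale (Le-cast (ℤₚ.+-comm (+ 1) (ℤ.- n)) (p (+ 1) (proj₁ Deg-δ)))

    upper⇐ : ∀ n → Le e (ℤ.- n) → ∀ m → Le δ m → Le E (m ℤ.+ ℤ.- n)
    upper⇐ n le m δ≤ = Le-mono (lin₁ 0 (Deg-≤ Deg-δ δ≤) (lem m n)) (unscale le)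
      where
      lem : ∀ m n → m ℤ.+ ℤ.- n ℤ.+ + 1 ≡ ℤ.- n ℤ.+ + 1 ℤ.+ m ℤ.+ + 0
      lem = ring-ℤ

    lower⇒ : ∀ n → (∀ m → Le E m → Le δ (m ℤ.+ n)) → ¬ Le e (ℤ.- n ℤ.- + 1)
    lower⇒ n p le = 1≰0 (Deg-≤ Deg-δ (Le-cast (lem n) (p _ (unscale le))))
      where
      lem : ∀ n → ℤ.- n ℤ.- + 1 ℤ.+ + 1 ℤ.+ n ≡ + 0
      lem = ring-ℤ

    lower⇐ : ∀ n → ¬ Le e (ℤ.- n ℤ.- + 1) → ∀ m → Le E m → Le δ (m ℤ.+ n)
    lower⇐ n ¬le m E≤ with ≤-or-> (+ 1) (m ℤ.+ n)
    ... | inj₁ (k , eq) = Le-by k eq (proj₁ Deg-δ)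
    ... | inj₂ (k , eq) = ⊥-elim (¬le (scale (Le-by k (≡.trans (lem₁ n) (≡.trans (≡.cong (λ z → z ℤ.- + 1 ℤ.- n) eq) (lem₂ m n (+ k)))) E≤)))
      where
      lem₁ : ∀ n → ℤ.- n ℤ.- + 1 ℤ.+ + 1 ≡ + 1 ℤ.- + 1 ℤ.- n
      lem₁ = ring-ℤ
      lem₂ : ∀ m n k → m ℤ.+ n ℤ.+ (+ 1 ℤ.+ k) ℤ.- + 1 ℤ.- n ≡ m ℤ.+ k
      lem₂ = ring-ℤ

  Deg-flip : ∀ x y {m} → Deg (x - y) m → Deg (y - x) m
  Deg-flip x y d = Deg-resp (-[x-y]≈y-x x y) (Deg-neg d)

  root-cong : ∀ a b c A B C x → a ≈ A → b ≈ B → c ≈ C → A * (x * x) + (B * x + C) ≈ 0# → a * (x * x) + (b * x + c) ≈ 0#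
  root-cong a b c A B C x ea eb ec = trans (+-cong (*-congʳ ea) (+-cong (*-congʳ eb) ec))

  irrational-cong : ∀ f p r P R → P ≈ p → R ≈ r → p * f ≈ r → (¬ P ≈ 0# → ¬ P * f ≈ R) → p ≈ 0#
  irrational-cong f p r P R eP eR e irr = ≈0-stable λ p≉0 →
    irr (λ z → p≉0 (trans (sym eP) z)) (trans (*-congʳ eP) (trans e (sym eR)))

-- Laurent series over a finite field as a valued ring

module SeriesValuation (F : FiniteField) where
  open FiniteField F
  open CommutativeRing ring hiding (ring)
  open Laurent F
  open Convolution ring
  open LaurentRing F
  open Algebra.Properties.Ring (CommutativeRing.ring ring) using (-0#≈0#)

  infix 4 _≈?_
  _≈?_ : ∀ x y → Dec (x ≈ y)
  x ≈? y with enum-surj x | enum-surj y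
  ... | i , ei | j , ej with i Fin.≟ j
  ... | yes ≡.refl = yes (trans (sym ei) ej)
  ... | no i≢j     = no λ x≈y → i≢j (enum-inj i j (trans ei (trans x≈y (sym ej))))

  nonzero-* : ∀ {x y} → ¬ x ≈ 0# → ¬ y ≈ 0# → ¬ x * y ≈ 0#
  nonzero-* {x} {y} x≉0 y≉0 xy≈0 with inverse x x≉0
  ... | z , xz≈1 = y≉0 (trans (sym (*-identityˡ y)) (trans (*-congʳ (trans (sym xz≈1) (*-comm x z)))
          (trans (*-assoc z x y) (trans (*-congˡ xy≈0) (zeroʳ z)))))

  LeS : Series → ℤ → Set
  LeS x m = AbsLe (proj₁ x) m

  -- Stated through coefficients, the property is compatible with equality of series; lists are
  -- produced only by `toPoly`.
  PolyS : Series → Set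
  PolyS x = ∀ k → coeff (proj₁ x) -[1+ k ] ≈ 0#

  DegS : Series → ℤ → Set
  DegS x m = LeS x m × ¬ LeS x (m ℤ.- + 1)

  LeS-pred : ∀ x {m} → LeS x m → coeff (proj₁ x) m ≈ 0# → LeS x (m ℤ.- + 1)
  LeS-pred x {m} le c≈0 i lt with <⇒+ lt
  ... | zero , eq  = trans (coeff-cong (proj₁ x) (≡.trans eq (lem m))) c≈0
    where
    lem : ∀ m → m ℤ.- + 1 ℤ.+ + 1 ≡ m
    lem = ring-ℤ
  ... | suc d , eq = le i (<-by d (≡.trans eq (lem m (+ d))))
    where
    lem : ∀ m d → m ℤ.- + 1 ℤ.+ (+ 2 ℤ.+ d) ≡ m ℤ.+ (+ 1 ℤ.+ d)
    lem = ring-ℤ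

  pred-< : ∀ m → m ℤ.- + 1 ℤ.< m
  pred-< m = <-by 0 (lem m)
    where
    lem : ∀ m → m ≡ m ℤ.- + 1 ℤ.+ + 1
    lem = ring-ℤ

  DegS⇒leading : ∀ x {m} → DegS x m → ¬ coeff (proj₁ x) m ≈ 0#
  DegS⇒leading x (le , ¬le) c≈0 = ¬le (LeS-pred x le c≈0)

  leading⇒DegS : ∀ x {m} → LeS x m → ¬ coeff (proj₁ x) m ≈ 0# → DegS x m
  leading⇒DegS x {m} le c≉0 = le , λ le′ → c≉0 (le′ m (pred-< m))

  *S-top : ∀ x y {m n} → LeS x m → LeS y n →
           coeff (proj₁ (x *S y)) (m ℤ.+ n) ≈ coeff (proj₁ x) m * coeff (proj₁ y) n
  *S-top (f , p) (g , q) {m} {n} f≤m g≤n = trans (coeff-cong (f *L g) (≡.sym (ℤₚ.+-identityʳ (m ℤ.+ n))))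
    (trans (*L-coeff f g m n p q f≤m g≤n 0)
      (*-cong (coeff-cong f (ℤₚ.+-identityʳ m)) (coeff-cong g (ℤₚ.+-identityʳ n))))

  LeS-* : ∀ x y {m n} → LeS x m → LeS y n → LeS (x *S y) (m ℤ.+ n)
  LeS-* (f , p) (g , q) {m} {n} = AbsLe-* f g m n p q

  DegS-* : ∀ x y {m n} → DegS x m → DegS y n → DegS (x *S y) (m ℤ.+ n)
  DegS-* x y dx dy = leading⇒DegS (x *S y) (LeS-* x y (proj₁ dx) (proj₁ dy))
    (nonzero-* (DegS⇒leading x dx) (DegS⇒leading y dy) ∘ trans (sym (*S-top x y (proj₁ dx) (proj₁ dy))))

  LeS-zero : ∀ x → (∀ n → LeS x (ℤ.- + n)) → x ≈S 0S
  LeS-zero x p i = p (suc ℤ.∣ i ∣) i (lem i)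
    where
    lem : ∀ i → ℤ.- + suc ℤ.∣ i ∣ ℤ.< i
    lem (+ n)    = ℤ.-<+
    lem -[1+ n ] = ℤ.-<- ℕₚ.≤-refl

  PolyS-* : ∀ x y → PolyS x → PolyS y → PolyS (x *S y)
  PolyS-* (f , p) (g , q) Px Py k with ≤-or-> -[1+ k ] (top f ℤ.+ top g)
  ... | inj₂ (d , eq) = *L-isLS f g -[1+ k ] (<-by d eq)
  ... | inj₁ (N , eq) = trans (coeff-cong (f *L g) at-N) (trans (*L-below-tops f g N) (conv-zero _ _ N vanish))
    where
    at-N : -[1+ k ] ≡ top f ℤ.+ top g ℤ.- + N
    at-N = transpose eq
    lem₂ : ∀ b c i j → b ℤ.+ c ℤ.- (i ℤ.+ j) ≡ b ℤ.- i ℤ.+ (c ℤ.- j)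
    lem₂ = ring-ℤ
    split : ∀ u v → -[1+ k ] ≡ u ℤ.+ v → coeff f u * coeff g v ≈ 0#
    split -[1+ a ] v e       = trans (*-congʳ (Px a)) (zeroˡ _)
    split (+ a) -[1+ b ] e   = trans (*-congˡ (Py b)) (zeroʳ _)
    split (+ a) (+ b) ()
    vanish : ∀ i j → i ℕ.+ j ≡ N → (f ↓ top f) i * (g ↓ top g) j ≈ 0#
    vanish i j ≡.refl = split _ _ (≡.trans at-N (lem₂ (top f) (top g) (+ i) (+ j)))

  PolyS-zero : ∀ x → PolyS x → LeS x -1ℤ → x ≈S 0S
  PolyS-zero x Px le -[1+ k ] = Px k
  PolyS-zero x Px le (+ n)    = le (+ n) ℤ.-<+

  constS : Carrier → Series
  constS c = polyS (constP c)

  embed-poly : ∀ P → PolyS (polyS P)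
  embed-poly P k = refl

  residueS : ∀ x y {n} → DegS y n → LeS x n →
             ∃ λ c → PolyS c × LeS c (+ 0) × LeS (x +S (-S (c *S y))) (n ℤ.- + 1)
  residueS x y {n} dy x≤n = constS c , embed-poly (constP c) , AbsLe-const c ,
    LeS-pred (x +S (-S (constS c *S y))) (AbsLe-+ (proj₁ x) (-L proj₁ (constS c *S y)) n x≤n (λ i lt → trans (-‿cong (cy≤n i lt)) -0#≈0#))
      (trans (+-congˡ (-‿cong at-n)) (-‿inverseʳ _))
    where
    a = coeff (proj₁ x) n
    b = coeff (proj₁ y) n
    z = proj₁ (inverse b (DegS⇒leading y dy))
    c = a * z
    cy≤n : LeS (constS c *S y) n
    cy≤n = ≡.subst (LeS (constS c *S y)) (ℤₚ.+-identityˡ n) (LeS-* (constS c) y (AbsLe-const c) (proj₁ dy))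
    at-n : coeff (proj₁ (constS c *S y)) n ≈ a
    at-n = trans (coeff-cong (proj₁ (constS c *S y)) (≡.sym (ℤₚ.+-identityˡ n)))
      (trans (*S-top (constS c) y (AbsLe-const c) (proj₁ dy))
        (trans (*-assoc a z b) (trans (*-congˡ (trans (*-comm z b) (proj₂ (inverse b (DegS⇒leading y dy))))) (*-identityʳ a))))

  linear : Carrier → Carrier → Series
  linear c v = polyS (v ∷ c ∷ [])

  linear≤ : ∀ c v → LeS (linear c v) (+ 1)
  linear≤ c v (+ suc (suc n)) _          = refl
  linear≤ c v (+ suc zero) (ℤ.+<+ (ℕ.s≤s ()))
  linear≤ c v (+ zero) (ℤ.+<+ ())

  Deg-linear : ∀ c v → ¬ c ≈ 0# → DegS (linear c v) (+ 1)
  Deg-linear c v = leading⇒DegS (linear c v) (linear≤ c v)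

  indeterminate : Series
  indeterminate = linear 1# 0#

  reciprocal-coeff : ℤ → Carrier
  reciprocal-coeff (+ _)          = 0#
  reciprocal-coeff -[1+ zero ]    = 1#
  reciprocal-coeff -[1+ suc _ ]   = 0#

  reciprocal : Series
  reciprocal = mkLS -1ℤ reciprocal-coeff , λ where
    (+ n) _                     → refl
    -[1+ n ] (ℤ.-<- ())

  reciprocal-inverse : (indeterminate *S reciprocal) ≈S 1S
  reciprocal-inverse = ≈L-below (proj₁ (indeterminate *S reciprocal)) (proj₁ 1S) (+ 0)
    (LeS-* indeterminate reciprocal (linear≤ 1# 0#) (proj₂ reciprocal)) (AbsLe-const 1#)
    (λ N → trans (*L-coeff (proj₁ indeterminate) (proj₁ reciprocal) (+ 1) -1ℤ (proj₂ indeterminate) (proj₂ reciprocal)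
                   (linear≤ 1# 0#) (proj₂ reciprocal) N)
             (trans (conv-identityˡ (proj₁ indeterminate ↓ (+ 1)) _ N refl tail) (agree N)))
    where
    tail : ∀ i → (proj₁ indeterminate ↓ (+ 1)) (suc i) ≈ 0#
    tail zero    = refl
    tail (suc i) = refl
    agree : ∀ N → reciprocal-coeff (ℤ.- + 1 ℤ.- + N) ≈ coeff (proj₁ 1S) (+ 0 ℤ.- + N)
    agree zero    = refl
    agree (suc N) = refl

  module Limit (x : ℕ → Series) (cauchy : ∀ n → LeS (x (suc n) +S (-S (x n))) (ℤ.- + suc n)) where

    stable : ∀ n d i → ℤ.- + suc n ℤ.< i → coeff (proj₁ (x (d ℕ.+ n))) i ≈ coeff (proj₁ (x n)) i
    stable n zero i lt    = refl
    stable n (suc d) i lt = trans (equal (cauchy (d ℕ.+ n) i (ℤₚ.≤-<-trans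
        (ℤₚ.neg-mono-≤ (ℤ.+≤+ (ℕ.s≤s (ℕₚ.m≤n+m n d)))) lt))) (stable n d i lt)
      where
      equal : ∀ {a b} → a + - b ≈ 0# → a ≈ b
      equal {a} {b} e = trans (sym (+-identityʳ a)) (trans (+-congˡ (sym (-‿inverseˡ b)))
        (trans (sym (+-assoc a (- b) b)) (trans (+-congʳ e) (+-identityˡ b))))

    -- An index from which the coefficient at the given exponent no longer changes: the n-th
    -- correction only touches exponents at most -(n + 1).
    precision : ℤ → ℕ
    precision (+ _)    = 0
    precision -[1+ k ] = suc k

    precise : ∀ i → ℤ.- + suc (precision i) ℤ.< i
    precise (+ n)    = ℤ.-<+
    precise -[1+ k ] = ℤ.-<- (ℕₚ.n<1+n k)

    sufficient : ∀ n i → ℤ.- + suc n ℤ.< i → precision i ℕ.≤ n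
    sufficient n (+ _) _              = ℕ.z≤n
    sufficient n -[1+ k ] (ℤ.-<- k<n) = k<n

    lim : Series
    lim = mkLS (top (proj₁ (x 0)) ℤ.⊔ + 0) (λ i → coeff (proj₁ (x (precision i))) i) , isLS
      where
      isLS : ∀ i → top (proj₁ (x 0)) ℤ.⊔ + 0 ℤ.< i → coeff (proj₁ (x (precision i))) i ≈ 0#
      isLS (+ n) lt    = proj₂ (x 0) (+ n) (ℤₚ.≤-<-trans (ℤₚ.i≤i⊔j _ (+ 0)) lt)
      isLS -[1+ n ] lt with ℤₚ.≤-<-trans (ℤₚ.i≤j⊔i (top (proj₁ (x 0))) (+ 0)) lt
      ... | ()

    lim-close : ∀ n → LeS (lim +S (-S (x n))) (ℤ.- + suc n)
    lim-close n i lt = trans (+-congˡ (-‿cong (trans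
        (reflexive (≡.cong (λ z → coeff (proj₁ (x z)) i) (≡.sym (ℕₚ.m∸n+n≡m (sufficient n i lt)))))
        (stable (precision i) (n ℕ.∸ precision i) i (precise i))))) (-‿inverseʳ _)

  valued : ValuedRing
  valued = record
    { R = seriesRing
    ; Le = LeS
    ; Le-resp = λ e p i lt → trans (sym (e i)) (p i lt)
    ; Le-mono = λ {x} → AbsLe-mono (proj₁ x)
    ; Le-0 = λ _ _ → refl
    ; Le-+ = λ {x} {y} {m} → AbsLe-+ (proj₁ x) (proj₁ y) m
    ; Le-neg = λ p i lt → trans (-‿cong (p i lt)) -0#≈0#
    ; Le-* = λ {x} {y} → LeS-* x y
    ; Le-stable = λ p i lt → decidable-stable (_ ≈? _) λ ≉0 → p λ le → ≉0 (le i lt)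
    ; Le-bounded = λ x → top (proj₁ x) , proj₂ x
    ; Le-zero = λ {x} → LeS-zero x
    ; Deg-* = λ {x} {y} → DegS-* x y
    ; Poly = PolyS
    ; Poly-resp = λ e p k → trans (sym (e -[1+ k ])) (p k)
    ; Poly-0 = λ _ → refl
    ; Poly-1 = λ _ → refl
    ; Poly-+ = λ p q k → trans (+-cong (p k) (q k)) (+-identityˡ 0#)
    ; Poly-neg = λ p k → trans (-‿cong (p k)) -0#≈0#
    ; Poly-* = λ {x} {y} → PolyS-* x y
    ; Poly-zero = λ {x} → PolyS-zero x
    ; Deg-1 = leading⇒DegS 1S (AbsLe-const 1#) 1≉0
    ; residue = λ {x} {y} → residueS x y
    ; Y = indeterminate
    ; Y⁻¹ = reciprocal
    ; Poly-Y = λ _ → refl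
    ; Deg-Y = Deg-linear 1# 0# 1≉0
    ; Y-inverse = reciprocal-inverse
    ; limit = λ x cauchy → Limit.lim x cauchy , Limit.lim-close x cauchy }

  -- Pairs with leading coefficient zero are sent to Y, so that all pairs of constants index linear
  -- polynomials and the alphabet is a full `Fin`.
  letter-of : Carrier → Carrier → Series
  letter-of c v with c ≈? 0#
  ... | yes _ = indeterminate
  ... | no _  = linear c v

  Poly-letter-of : ∀ c v → PolyS (letter-of c v)
  Poly-letter-of c v with c ≈? 0#
  ... | yes _ = λ _ → refl
  ... | no _  = λ _ → refl

  Deg-letter-of : ∀ c v → DegS (letter-of c v) (+ 1)
  Deg-letter-of c v with c ≈? 0#
  ... | yes _  = Deg-linear 1# 0# 1≉0
  ... | no c≉0 = Deg-linear c v c≉0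

  letter-of-≈ : ∀ c v x → PolyS x → DegS x (+ 1) → c ≈ coeff (proj₁ x) (+ 1) → v ≈ coeff (proj₁ x) (+ 0) →
                letter-of c v ≈S x
  letter-of-≈ c v x Px dx ec ev k with c ≈? 0#
  ... | yes c≈0 = ⊥-elim (DegS⇒leading x dx (trans (sym ec) c≈0))
  ... | no _    = go k
    where
    go : linear c v ≈S x
    go -[1+ n ]        = sym (Px n)
    go (+ zero)        = ev
    go (+ suc zero)    = ec
    go (+ suc (suc n)) = sym (proj₁ dx (+ suc (suc n)) (ℤ.+<+ (ℕ.s≤s (ℕ.s≤s ℕ.z≤n))))

  letter : Fin (card ℕ.* card) → Series
  letter i = let (j , k) = Fin.remQuot {card} card i in letter-of (enum j) (enum k)

  letter-surjective : ∀ {x} → PolyS x → DegS x (+ 1) → ∃ λ i → letter i ≈S x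
  letter-surjective {x} Px dx with enum-surj (coeff (proj₁ x) (+ 1)) | enum-surj (coeff (proj₁ x) (+ 0))
  ... | j , ej | k , ek = Fin.combine j k ,
    ≡.subst (λ z → letter-of (enum (proj₁ z)) (enum (proj₂ z)) ≈S x) (≡.sym (Finₚ.remQuot-combine j k))
      (letter-of-≈ (enum j) (enum k) x Px dx ej ek)

  coefficients : (ℤ → Carrier) → ℕ → ℕ → Poly
  coefficients c zero start    = []
  coefficients c (suc n) start = c (+ start) ∷ coefficients c n (suc start)

  lookup-coefficients : ∀ c n start k → (∀ j → start ℕ.+ n ℕ.≤ j → c (+ j) ≈ 0#) →
                        lookupP (coefficients c n start) k ≈ c (+ (start ℕ.+ k))
  lookup-coefficients c zero start k zero-above =
    sym (zero-above (start ℕ.+ k) (ℕₚ.+-monoʳ-≤ start ℕ.z≤n))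
  lookup-coefficients c (suc n) start zero zero-above =
    reflexive (≡.cong (λ j → c (+ j)) (≡.sym (ℕₚ.+-identityʳ start)))
  lookup-coefficients c (suc n) start (suc k) zero-above = trans
    (lookup-coefficients c n (suc start) k
      (λ j le → zero-above j (≡.subst (ℕ._≤ j) (≡.sym (ℕₚ.+-suc start n)) le)))
    (reflexive (≡.cong (λ j → c (+ j)) (≡.sym (ℕₚ.+-suc start k))))

  toPoly : ∀ x → PolyS x → ∃ λ P → polyS P ≈S x
  toPoly x Px = coefficients (coeff (proj₁ x)) n 0 , agree
    where
    n = suc ℤ.∣ top (proj₁ x) ∣
    agree : polyS (coefficients (coeff (proj₁ x)) n 0) ≈S x
    agree -[1+ k ] = sym (Px k)
    agree (+ k)    = lookup-coefficients (coeff (proj₁ x)) n 0 k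
      (λ j n≤j → proj₂ x (+ j) (ℤₚ.≤-<-trans (i≤∣i∣ _) (ℤ.+<+ n≤j)))

  constant : ∀ x → PolyS x → LeS x (+ 0) → x ≈S constS (coeff (proj₁ x) (+ 0))
  constant x Px le -[1+ k ]   = Px k
  constant x Px le (+ zero)   = refl
  constant x Px le (+ suc k)  = le (+ suc k) (ℤ.+<+ (ℕ.s≤s ℕ.z≤n))

-- The spectrum of α and its gaps

module Translation (F : FiniteField) (ℓ : ℕ)
  (spec : QuadraticSpectrum (SeriesValuation.valued F) ℓ) where
  private
    V = SeriesValuation.valued F
    module 𝔽 = CommutativeRing (FiniteField.ring F)
  open Laurent F hiding (Poly)
  open LaurentRing F using (Series; polyS; AbsLe-const)
  open SeriesValuation F using (embed-poly; toPoly; constant; constS; DegS⇒leading; leading⇒DegS)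
  open ValuedRing V
  open Degree V
  open Geodesic V
  open Reversal V using (turn)
  open Comparison V
  open QuadraticSpectrum spec

  ασ : Series
  ασ = - η₀

  notInK : ∀ f → (∀ {p r} → Poly p → Poly r → p * f ≈ r → p ≈ 0#) → NotInK (proj₁ f)
  notInK f irr P Q Q≠0 e = Q≠0 (irr {polyS Q} {polyS P} (embed-poly Q) (embed-poly P) e)

  irrational : ∀ f → NotInK (proj₁ f) → ∀ {p r} → Poly p → Poly r → p * f ≈ r → p ≈ 0#
  irrational f f∉K {p} {r} Pp Pr e with toPoly p Pp | toPoly r Pr
  ... | P , eP | R , eR = irrational-cong f p r (polyS P) (polyS R) eP eR e (f∉K R P)

  Deg-ασ-α : Deg (ασ - α) (+ 1)
  Deg-ασ-α = Deg-flip α ασ Deg-α-ασ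

  quad : Quad
  quad = record
    { α = proj₁ α ; ασ = proj₁ ασ ; α-ok = proj₂ α ; ασ-ok = proj₂ ασ
    ; α∉K = notInK α (λ {p} {r} → α-irrational {p} {r})
    ; α≉ασ = λ e → DegS⇒leading (α - ασ) Deg-α-ασ (𝔽.trans (𝔽.+-congʳ (e (+ 1))) (𝔽.-‿inverseʳ _))
    ; A = PA ; B = PB ; C = PC
    ; A≠0 = λ e → A≉0 (trans {A} {polyS PA} {0#} (sym {polyS PA} {A} eA) e)
    ; α-root = root-cong (polyS PA) (polyS PB) (polyS PC) A B C α eA eB eC α-root
    ; ασ-root = root-cong (polyS PA) (polyS PB) (polyS PC) A B C ασ eA eB eC ασ-root }
    where
    PA = proj₁ (toPoly A Poly-A)
    PB = proj₁ (toPoly B Poly-B)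
    PC = proj₁ (toPoly C Poly-C)
    eA = proj₂ (toPoly A Poly-A)
    eB = proj₂ (toPoly B Poly-B)
    eC = proj₂ (toPoly C Poly-C)

  Deg-constant : ∀ u → ¬ u 𝔽.≈ 𝔽.0# → Deg (constS u) (+ 0)
  Deg-constant u = leading⇒DegS (constS u) (AbsLe-const u)

  matrix : (o : OrbitElt) → Σ Mat λ M →
    Inverts M (polyS (OrbitElt.a o)) (polyS (OrbitElt.b o)) (polyS (OrbitElt.c o)) (polyS (OrbitElt.d o))
  matrix o = inverse-matrix (polyS a) (polyS b) (polyS c) (polyS d) (constS u)
    (embed-poly a) (embed-poly b) (embed-poly c) (embed-poly d) (Deg-constant u u≠0) (OrbitElt.det o)
    where open OrbitElt o using (a; b; c; d; u; u≠0)

  -- A swapped element exchanges the ends 1/ξ₀ and -η₀; composing with z ↦ -1/z brings them to the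
  -- shape of the reversed line.
  errorAt : Series → OrbitElt → Series
  errorAt f o@(record { swap = false }) = error (proj₁ (matrix o)) ξ₀ η₀ f
  errorAt f o@(record { swap = true })  = error (turn (proj₁ (matrix o))) η₀ ξ₀ f

  heightAt : OrbitElt → Series
  heightAt o@(record { swap = false }) = height (proj₁ (matrix o)) ξ₀ η₀
  heightAt o@(record { swap = true })  = height (turn (proj₁ (matrix o))) η₀ ξ₀

  record Dictionary (f : Series) (o : OrbitElt) : Set where
    field
      ratioLe⇒ : ∀ n → RatioLe quad (proj₁ f) o n → Le (errorAt f o) (ℤ.- n)
      ratioLe⇐ : ∀ n → Le (errorAt f o) (ℤ.- n) → RatioLe quad (proj₁ f) o n
      ratioGe⇒ : ∀ n → RatioGe quad (proj₁ f) o n → ¬ Le (errorAt f o) (ℤ.- n ℤ.- + 1)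
      ratioGe⇐ : ∀ n → ¬ Le (errorAt f o) (ℤ.- n ℤ.- + 1) → RatioGe quad (proj₁ f) o n
      distLe⇒  : ∀ n → DistLe quad o n → ¬ Le (heightAt o) (ℤ.- n ℤ.- + 1)
      distLe⇐  : ∀ n → ¬ Le (heightAt o) (ℤ.- n ℤ.- + 1) → DistLe quad o n

  dictionary : ∀ f o → Dictionary f o
  dictionary f o@(record { a = a ; b = b ; c = c ; d = d ; swap = false }) = record
    { ratioLe⇒ = E.upper⇒ ; ratioLe⇐ = E.upper⇐ ; ratioGe⇒ = E.lower⇒ ; ratioGe⇐ = E.lower⇐
    ; distLe⇒ = H.lower⇒ ; distLe⇐ = H.lower⇐ }
    where
    M = proj₁ (matrix o)
    inv = proj₂ (matrix o)
    module E = Scaled {error M ξ₀ η₀ f} {ξ₀} {distance (polyS a) (polyS b) (polyS c) (polyS d) f α ασ} {α - ασ}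
      Deg-ξ₀ Deg-α-ασ (error-right inv f α ξ₀ η₀ ξ₀α≈1)
    module H = Scaled {height M ξ₀ η₀} {ξ₀} {norm (polyS c) (polyS d) α ασ} {α - ασ}
      Deg-ξ₀ Deg-α-ασ (height-right inv α ξ₀ η₀ ξ₀α≈1)
  dictionary f o@(record { a = a ; b = b ; c = c ; d = d ; swap = true }) = record
    { ratioLe⇒ = E.upper⇒ ; ratioLe⇐ = E.upper⇐ ; ratioGe⇒ = E.lower⇒ ; ratioGe⇐ = E.lower⇐
    ; distLe⇒ = H.lower⇒ ; distLe⇐ = H.lower⇐ }
    where
    M = proj₁ (matrix o)
    inv = proj₂ (matrix o)
    module E = Scaled {error (turn M) η₀ ξ₀ f} { - ξ₀} {distance (polyS a) (polyS b) (polyS c) (polyS d) f ασ α} {ασ - α}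
      (Deg-neg {ξ₀} Deg-ξ₀) Deg-ασ-α (error-left inv f α ξ₀ η₀ ξ₀α≈1)
    module H = Scaled {height (turn M) η₀ ξ₀} { - ξ₀} {norm (polyS c) (polyS d) ασ α} {ασ - α}
      (Deg-neg {ξ₀} Deg-ξ₀) Deg-ασ-α (height-left inv α ξ₀ η₀ ξ₀α≈1)

  module _ (M : Mat) where
    private
      A′ = toPoly (Mat.s M) (Mat.Poly-s M)
      B′ = toPoly (- Mat.q M) (Poly-neg {Mat.q M} (Mat.Poly-q M))
      C′ = toPoly (- Mat.r M) (Poly-neg {Mat.r M} (Mat.Poly-r M))
      D′ = toPoly (Mat.p M) (Mat.Poly-p M)
      a = polyS (proj₁ A′)
      b = polyS (proj₁ B′)
      c = polyS (proj₁ C′)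
      d = polyS (proj₁ D′)
      u = coeff (proj₁ (Mat.det M)) (+ 0)
      inv : Inverts M a b c d
      inv = inverts M a b c d (proj₂ A′) (proj₂ B′) (proj₂ C′) (proj₂ D′)

    orbitElt : OrbitElt
    orbitElt = record
      { a = proj₁ A′ ; b = proj₁ B′ ; c = proj₁ C′ ; d = proj₁ D′ ; u = u
      ; u≠0 = DegS⇒leading (Mat.det M) (Mat.Deg-det M)
      ; det = inverse-det M a b c d (constS u) inv (constant (Mat.det M) (Poly-det M) (proj₁ (Mat.Deg-det M)))
      ; swap = false }

    error-orbitElt : ∀ f {m} → (Le (error M ξ₀ η₀ f) m → Le (errorAt f orbitElt) m) × (Le (errorAt f orbitElt) m → Le (error M ξ₀ η₀ f) m)
    error-orbitElt f = same-value (error M ξ₀ η₀ f) (errorAt f orbitElt) (ξ₀ * distance a b c d f α ασ)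
      (error-right inv f α ξ₀ η₀ ξ₀α≈1) (error-right (proj₂ (matrix orbitElt)) f α ξ₀ η₀ ξ₀α≈1)

    height-orbitElt : ∀ {m} → (Le (height M ξ₀ η₀) m → Le (heightAt orbitElt) m) × (Le (heightAt orbitElt) m → Le (height M ξ₀ η₀) m)
    height-orbitElt = same-value (height M ξ₀ η₀) (heightAt orbitElt) (ξ₀ * norm c d α ασ)
      (height-right inv α ξ₀ η₀ ξ₀α≈1) (height-right (proj₂ (matrix orbitElt)) α ξ₀ η₀ ξ₀α≈1)

  -- If f were β, the error would vanish and satisfy every bound; this contradicts the upper bounds
  -- in `Attained` and so keeps f out of the orbit.
  beta-ratio : ∀ f o n → IsBeta quad (proj₁ f) o → RatioLe quad (proj₁ f) o n
  beta-ratio f o@(record { a = a ; b = b ; c = c ; d = d ; swap = false }) n e m _ i _ =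
    vanishing-difference (f * (polyS c * α + polyS d)) (polyS a * α + polyS b) (polyS c * ασ + polyS d) e i
  beta-ratio f o@(record { a = a ; b = b ; c = c ; d = d ; swap = true }) n e m _ i _ =
    vanishing-difference (f * (polyS c * ασ + polyS d)) (polyS a * ασ + polyS b) (polyS c * α + polyS d) e i

  attained⇒inSp : ∀ {m} → Attained V ξ₀ η₀ m → InSp quad m
  attained⇒inSp {m} att = proj₁ f , proj₂ f , notInK f (λ {p} {r} → irr {p} {r}) ,
    (λ o β → far o (Le-cast {errorAt f o} (lem m) (Dictionary.ratioLe⇒ (dictionary f o) (m ℤ.+ + 1) (beta-ratio f o (m ℤ.+ + 1) β)))) ,
    -- The bound holds for all elements of the orbit, so any threshold serves.
    (+ 0 , λ o _ → Dictionary.ratioGe⇐ (dictionary f o) m (far o)) ,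
    λ k → let (M , le , high) = lower (ℤ.- k ℤ.- + 1)
              dict = dictionary f (orbitElt M)
          in orbitElt M , Dictionary.distLe⇐ dict k (high ∘ proj₂ (height-orbitElt M)) ,
             Dictionary.ratioLe⇐ dict m (proj₁ (error-orbitElt M f) le)
    where
    open Attained att renaming (irrational to irr)
    lem : ∀ m → ℤ.- (m ℤ.+ + 1) ≡ ℤ.- m ℤ.- + 1
    lem = ring-ℤ
    far : ∀ o → ¬ Le (errorAt f o) (ℤ.- m ℤ.- + 1)
    far o@(record { swap = false }) = upper (proj₁ (matrix o))
    far o@(record { swap = true })  = upperʳ (turn (proj₁ (matrix o)))

  gapValue : ℕ → ℤ
  gapValue k = + suc k ℤ.+ + suc k ℤ.+ + 1

  -- By contraposition: a large height brings β and β^σ within the threshold `m₀`, where errors this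
  -- small are excluded.
  shallow : ∀ f m₀ n → (∀ o → DistLe quad o m₀ → RatioGe quad (proj₁ f) o n) → ∀ {e} → e ℤ.≤ ℤ.- n ℤ.- + 1 →
            ∀ N → Le (error N ξ₀ η₀ f) e → Le (height N ξ₀ η₀) (ℤ.- m₀ ℤ.- + 1)
  shallow f m₀ n ge e≤ N le = Le-stable {height N ξ₀ η₀} λ high →
    Dictionary.ratioGe⇒ dict n (ge (orbitElt N) (Dictionary.distLe⇐ dict m₀ (high ∘ proj₂ (height-orbitElt N))))
      (proj₁ (error-orbitElt N f) (Le-mono {error N ξ₀ η₀ f} e≤ le))
    where dict = dictionary f (orbitElt N)

  gap-¬inSp : ∀ k → suc k ℕ.≤ ℓ → ¬ InSp quad (gapValue k)
  gap-¬inSp k k<ℓ (g , g-ok , _ , _ , (m₀ , ge) , close) =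
    contra o (Le-cast {errorAt f o} (lem₂ (+ suc k)) (Dictionary.ratioLe⇒ (dictionary f o) (gapValue k) ratio))
             (λ le → Dictionary.distLe⇒ (dictionary f o) (m₀ ℤ.- + 4) dist (Le-cast {heightAt o} (lem₁ m₀) le))
    where
    f : Series
    f = g , g-ok
    -- The prolonging geodesic may be less high by 4, so the given one is chosen beyond the
    -- threshold by this margin.
    o = proj₁ (close (m₀ ℤ.- + 4))
    dist = proj₁ (proj₂ (close (m₀ ℤ.- + 4)))
    ratio = proj₂ (proj₂ (close (m₀ ℤ.- + 4)))
    lem₁ : ∀ m → ℤ.- m ℤ.- + 1 ℤ.+ + 4 ≡ ℤ.- (m ℤ.- + 4) ℤ.- + 1
    lem₁ = ring-ℤ
    lem₂ : ∀ k → ℤ.- (k ℤ.+ k ℤ.+ + 1) ≡ ℤ.- k ℤ.- k ℤ.- + 1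
    lem₂ = ring-ℤ
    lem₃ : ∀ k → ℤ.- k ℤ.- k ℤ.- + 2 ≡ ℤ.- (k ℤ.+ k ℤ.+ + 1) ℤ.- + 1
    lem₃ = ring-ℤ
    near = shallow f m₀ (gapValue k) ge (ℤₚ.≤-reflexive (lem₃ (+ suc k)))
    contra : ∀ o → Le (errorAt f o) (ℤ.- + suc k ℤ.- + suc k ℤ.- + 1) → ¬ ¬ Le (heightAt o) (ℤ.- m₀ ℤ.- + 1 ℤ.+ + 4)
    contra o@(record { swap = false }) le deep = gap-right f (ℤ.- m₀ ℤ.- + 1) k k<ℓ (proj₁ (matrix o)) le deep near
    contra o@(record { swap = true }) le deep = gap-left f (ℤ.- m₀ ℤ.- + 1) k k<ℓ (turn (proj₁ (matrix o))) le deep near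

  inSp-≥2 : ∀ n → InSp quad n → + 2 ℤ.≤ n
  inSp-≥2 n (g , g-ok , g∉K , _ , (m₀ , ge) , _) with ≤-or-> (+ 2) n
  ... | inj₁ (d , eq) = ≤-by d eq
  ... | inj₂ (d , eq) = ⊥-elim (minimal f (λ {p} {r} → irrational f g∉K {p} {r}) (ℤ.- m₀ ℤ.- + 1)
          (shallow f m₀ n ge (≤-by d (≡.trans (lem n (+ d)) (≡.cong (λ z → ℤ.- z ℤ.+ + d) (≡.sym eq))))))
    where
    f : Series
    f = g , g-ok
    lem : ∀ n d → ℤ.- n ℤ.- + 1 ≡ ℤ.- (n ℤ.+ (+ 1 ℤ.+ d)) ℤ.+ d
    lem = ring-ℤ

  halve : ∀ m → ∃ λ K → m ≡ K ℕ.+ K ⊎ m ≡ suc (K ℕ.+ K)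
  halve zero    = 0 , inj₁ ≡.refl
  halve (suc m) with halve m
  ... | K , inj₁ ≡.refl = K , inj₂ ≡.refl
  ... | K , inj₂ ≡.refl = suc K , inj₁ (≡.cong suc (≡.sym (ℕₚ.+-suc K K)))

  even-or-gapValue : ∀ n → + 2 ℤ.≤ n → ∃ λ K → n ≡ + suc K ℤ.+ + suc K ⊎ n ≡ gapValue K
  even-or-gapValue n 2≤n with ≤⇒+ 2≤n
  ... | m , ≡.refl with halve m
  ... | K , inj₁ ≡.refl = K , inj₁ (lem (+ K))
    where
    lem : ∀ k → + 2 ℤ.+ (k ℤ.+ k) ≡ + 1 ℤ.+ k ℤ.+ (+ 1 ℤ.+ k)
    lem = ring-ℤ
  ... | K , inj₂ ≡.refl = K , inj₂ (lem (+ K))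
    where
    lem : ∀ k → + 2 ℤ.+ (+ 1 ℤ.+ (k ℤ.+ k)) ≡ + 1 ℤ.+ k ℤ.+ (+ 1 ℤ.+ k) ℤ.+ + 1
    lem = ring-ℤ

  exactly-gaps : HasExactlyGaps quad ℓ
  exactly-gaps = + 2 , (attained⇒inSp (even 0) , inSp-≥2) , lo , lo ,
    (λ i → ≤-by (suc (toℕ i ℕ.+ toℕ i)) (lem₁ (+ toℕ i)) , ℤₚ.≤-refl) ,
    (λ i j e → ≡.subst (λ z → lo i ℤ.+ + 1 ℤ.< gapValue z) (≡.sym e) (<-by 0 (lem₂ (+ toℕ i)))) ,
    λ n 2≤n → mk⇔ (missing n 2≤n)
      (λ (i , lo≤n , n≤lo) → ≡.subst (λ z → ¬ InSp quad z) (ℤₚ.≤-antisym lo≤n n≤lo) (gap-¬inSp (toℕ i) (Finₚ.toℕ<n i)))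
    where
    lo : Fin ℓ → ℤ
    lo i = gapValue (toℕ i)
    lem₁ : ∀ k → + 1 ℤ.+ k ℤ.+ (+ 1 ℤ.+ k) ℤ.+ + 1 ≡ + 2 ℤ.+ (+ 1 ℤ.+ (k ℤ.+ k))
    lem₁ = ring-ℤ
    lem₂ : ∀ k → + 2 ℤ.+ k ℤ.+ (+ 2 ℤ.+ k) ℤ.+ + 1 ≡ + 1 ℤ.+ k ℤ.+ (+ 1 ℤ.+ k) ℤ.+ + 1 ℤ.+ + 1 ℤ.+ + 1
    lem₂ = ring-ℤ
    missing : ∀ n → + 2 ℤ.≤ n → ¬ InSp quad n → ∃ λ i → (lo i ℤ.≤ n) × (n ℤ.≤ lo i)
    missing n 2≤n n∉Sp with even-or-gapValue n 2≤n
    ... | K , inj₁ ≡.refl = ⊥-elim (n∉Sp (attained⇒inSp (even K)))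
    ... | K , inj₂ ≡.refl with K ℕ.<? ℓ
    ...   | no K≮ℓ  = ⊥-elim (n∉Sp (attained⇒inSp (odd K (ℕₚ.≮⇒≥ K≮ℓ))))
    ...   | yes K<ℓ = Fin.fromℕ< K<ℓ , ℤₚ.≤-reflexive (≡.cong gapValue (Finₚ.toℕ-fromℕ< K<ℓ)) ,
                      ℤₚ.≤-reflexive (≡.cong gapValue (≡.sym (Finₚ.toℕ-fromℕ< K<ℓ)))

theorem1p5 : (F : FiniteField) (ℓ : ℕ) → ℓ ≥ 1 →
    ∃ λ (α : Laurent.Quad F) → Laurent.HasExactlyGaps F α ℓ
theorem1p5 F (suc n) _ = Translation.quad F (suc n) spec , Translation.exactly-gaps F (suc n) spec
  where
  open SeriesValuation F
  spec : QuadraticSpectrum valued (suc n)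
  spec = spectrum valued (FiniteField.card F ℕ.* FiniteField.card F) letter
    (λ i → Poly-letter-of _ _) (λ i → Deg-letter-of _ _) (λ {x} → letter-surjective {x}) n
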